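{- Let $n\ge0$ and $\Phi\in\mathrm{End}(\mathcal{Q})$. Suppose that the numbers $c_{\alpha,(n)}$, $\alpha\in\operatorname{Comp}(n)$, are nonnegative and not all zero, and that $c_{\alpha,(n)}>0$ for some $\alpha\in\operatorname{Comp}(n)\setminus\{(n),(1^n)\}$. Then $K$ has a unique stationary distribution, namely the uniform distribution on $\mathfrak{S}_n$, and $\overline{K}$ has a unique stationary distribution, namely the distribution of descent compositions of a uniformly random permutation, $\alpha\mapsto \#\{\sigma\in\mathfrak{S}_n: D(\sigma)=\alpha\}/n!$.
   Context: Work over $\mathbb{Q}$. A composition of $n\ge0$ is a sequence $\alpha=(a_1,\dots,a_k)$ of positive integers with sum $n$; $\operatorname{Comp}(n)$ is the set of them, $(n)$ is the one-part composition and $(1^n)$ the composition with $n$ parts equal to $1$. Put $S_\alpha=\{a_1,\dots,a_1+\dots+a_{k-1}\}\subseteq[n-1]$, with inverse bijection $S\mapsto\operatorname{co}(S)$. Order $\operatorname{Comp}(n)$ by $\alpha\le\beta$ iff $S_\alpha\subseteq S_\beta$. $M_\alpha=\sum_{i_1<\dots<i_k}x_{i_1}^{a_1}\cdots x_{i_k}^{a_k}$; $\mathcal{Q}_n=\operatorname{span}\{M_\alpha\}_{\alpha\in\operatorname{Comp}(n)}$; $\mathcal{Q}=\bigoplus_n\mathcal{Q}_n$ is the graded Hopf algebra of quasisymmetric functions (product of power series, coproduct $\Delta(M_\alpha)=\sum_{\alpha=\beta\cdot\gamma}M_\beta\otimes M_\gamma$ over deconcatenations). $F_\alpha=\sum_{\beta\ge\alpha}M_\beta$.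 $\mathrm{End}(\mathcal{Q})$ is the set of graded Hopf algebra endomorphisms of $\mathcal{Q}$. For $\sigma\in\mathfrak{S}_n$ in one-line notation, $D(\sigma)=\operatorname{co}(\{i:\sigma_i>\sigma_{i+1}\})$; the product in $\mathfrak{S}_n$ is composition. Define $c_{\alpha,\beta}$ by $\Phi(F_\alpha)=\sum_\beta c_{\alpha,\beta}F_\beta$, $\lambda$ by $\Phi(M_{(1)})=\lambda M_{(1)}$, $\mathrm{Prob}_\Phi(\pi)=c_{D(\pi),(n)}/\sum_{\sigma}c_{D(\sigma),(n)}$, the matrix $K(\pi,\sigma\pi)=\mathrm{Prob}_\Phi(\sigma^{ -1})$ on $\mathfrak{S}_n$, and $\overline{K}(\alpha,\beta)=c_{\alpha,\beta}/\lambda^n$ on $\operatorname{Comp}(n)$ (under the hypotheses $\lambda^n>0$ and both are stochastic matrices). A stationary distribution of a stochastic matrix $P$ is a probability row vector $\mu$ with $\mu P=\mu$.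
   Formalization: Stationary distributions are taken to be probability vectors with rational entries, so uniqueness is stated among rational distributions; the real case follows since the matrices are rational and the stated distributions are strictly positive. -}

module Defs where

open import Data.Bool using (Bool; true; false; if_then_else_; _∧_; _∨_)
open import Data.Nat as ℕ using (ℕ; zero; suc; _∸_; _≡ᵇ_; _<ᵇ_; _!)
open import Data.Nat.Properties using (_!≢0)
open import Data.Integer using (+_)
open import Data.Rational using (ℚ; 0ℚ; 1ℚ; _+_; _*_; _÷_; _/_; _≤_; _<_; ≢-nonZero)
open import Data.Rational.Properties using (_≟_)
open import Data.List using (List; []; _∷_; _++_; map; foldr; concatMap; replicate; applyUpTo; upTo; length; filterᵇ)
open import Data.Bool.ListAction using (all; any)
open import Data.Nat.ListAction using (sum)
open import Data.List.Membership.Propositional using (_∈_)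
open import Data.Product using (_×_; _,_; Σ; proj₁; proj₂)
open import Relation.Nullary using (yes; no; ¬_)
open import Relation.Binary.PropositionalEquality using (_≡_; _≢_)

∑ : {A : Set} → List A → (A → ℚ) → ℚ
∑ xs f = foldr (λ x acc → f x + acc) 0ℚ xs

ι : ℕ → ℚ
ι n = + n / 1

-- division, with the (never used under the hypotheses) convention p/0 = 0
_÷₀_ : ℚ → ℚ → ℚ
p ÷₀ q with q ≟ 0ℚ
... | yes _ = 0ℚ
... | no q≢0 = _÷_ p q {{≢-nonZero q≢0}}

_^ℚ_ : ℚ → ℕ → ℚ
x ^ℚ zero = 1ℚ
x ^ℚ suc n = x * (x ^ℚ n)

-- all compositions of n (each exactly once)
comps : ℕ → List (List ℕ)
comps zero = [] ∷ []
comps (suc zero) = (1 ∷ []) ∷ []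
comps (suc (suc n)) = concatMap (λ c → (1 ∷ c) ∷ inc c ∷ []) (comps (suc n))
  where
  inc : List ℕ → List ℕ
  inc [] = []
  inc (a ∷ as) = suc a ∷ as

single : ℕ → List ℕ
single zero = []
single (suc n) = suc n ∷ []

ones : ℕ → List ℕ
ones n = replicate n 1

cumsums : ℕ → List ℕ → List ℕ
cumsums acc [] = []
cumsums acc (a ∷ as) = (acc ℕ.+ a) ∷ cumsums (acc ℕ.+ a) as

dropLast : List ℕ → List ℕ
dropLast [] = []
dropLast (x ∷ []) = []
dropLast (x ∷ y ∷ ys) = x ∷ dropLast (y ∷ ys)

S : List ℕ → List ℕ
S α = dropLast (cumsums 0 α)

_≤ᶜ_ : List ℕ → List ℕ → Bool
α ≤ᶜ β = all (λ s → any (λ t → s ≡ᵇ t) (S β)) (S α)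

-- co(S) for S ⊆ [n-1] given as an increasing list
co : ℕ → List ℕ → List ℕ
co zero _ = []
co (suc n) T = go 0 T
  where
  go : ℕ → List ℕ → List ℕ
  go prev [] = (suc n ∸ prev) ∷ []
  go prev (s ∷ ss) = (s ∸ prev) ∷ go s ss

-- quasi-shuffle (stuffle): M_α M_β = Σ_{γ ∈ stuffle α β} M_γ (with multiplicity)
stuffle : List ℕ → List ℕ → List (List ℕ)
stuffle [] b = b ∷ []
stuffle (a ∷ as) [] = (a ∷ as) ∷ []
stuffle (a ∷ as) (b ∷ bs) =
  map (a ∷_) (stuffle as (b ∷ bs)) ++
  map (b ∷_) (stuffle (a ∷ as) bs) ++
  map ((a ℕ.+ b) ∷_) (stuffle as bs)

eqList : List ℕ → List ℕ → Bool
eqList [] [] = true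
eqList [] (_ ∷ _) = false
eqList (_ ∷ _) [] = false
eqList (x ∷ xs) (y ∷ ys) = (x ≡ᵇ y) ∧ eqList xs ys

count : List ℕ → List (List ℕ) → ℕ
count γ l = length (filterᵇ (eqList γ) l)

deconcat : List ℕ → List (List ℕ × List ℕ)
deconcat [] = ([] , []) ∷ []
deconcat (a ∷ as) = ([] , a ∷ as) ∷ map (λ p → (a ∷ proj₁ p , proj₂ p)) (deconcat as)

-- A graded linear endomorphism Φ of QSym is given by its matrix in the
-- M-basis: Φ(M_α) = Σ_{β ∈ Comp(|α|)} φ α β M_β  (entries φ α β with
-- |β| ≠ |α| are never used).  It is a Hopf algebra endomorphism iff:
record IsHopfEndo (φ : List ℕ → List ℕ → ℚ) : Set where
  field
    unit  : φ [] [] ≡ 1ℚ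
    mult  : ∀ m k α β γ → α ∈ comps m → β ∈ comps k → γ ∈ comps (m ℕ.+ k) →
            ∑ (stuffle α β) (λ δ → φ δ γ)
              ≡ ∑ (comps m) (λ α′ → ∑ (comps k) (λ β′ →
                    φ α α′ * φ β β′ * ι (count γ (stuffle α′ β′))))
    comult : ∀ i j α β′ γ′ → α ∈ comps (i ℕ.+ j) → β′ ∈ comps i → γ′ ∈ comps j →
            φ α (β′ ++ γ′)
              ≡ ∑ (deconcat α) (λ p →
                    if sum (proj₁ p) ≡ᵇ i then φ (proj₁ p) β′ * φ (proj₂ p) γ′ else 0ℚ)

-- c is the matrix of Φ on Q_n in the F-basis: Φ(F_α) = Σ_β c α β F_β,
-- where F_α = Σ_{β ≥ α} M_β (compare M-coefficients of both sides).
IsFCoeffs : (List ℕ → List ℕ → ℚ) → (List ℕ → List ℕ → ℚ) → ℕ → Set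
IsFCoeffs φ c n = ∀ α δ → α ∈ comps n → δ ∈ comps n →
  ∑ (comps n) (λ β → if α ≤ᶜ β then φ β δ else 0ℚ)
    ≡ ∑ (comps n) (λ β → if β ≤ᶜ δ then c α β else 0ℚ)

-- Φ(M_(1)) = λ M_(1)
lam : (List ℕ → List ℕ → ℚ) → ℚ
lam φ = φ (1 ∷ []) (1 ∷ [])

-- Permutations in one-line notation, values 0,…,n-1

insertAll : ℕ → List ℕ → List (List ℕ)
insertAll x [] = (x ∷ []) ∷ []
insertAll x (y ∷ ys) = (x ∷ y ∷ ys) ∷ map (y ∷_) (insertAll x ys)

-- all permutations of {0,…,n-1} (each exactly once)
perms : ℕ → List (List ℕ)
perms zero = [] ∷ []
perms (suc n) = concatMap (insertAll n) (perms n)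

at : List ℕ → ℕ → ℕ
at [] i = 0
at (x ∷ xs) zero = x
at (x ∷ xs) (suc i) = at xs i

indexOf : ℕ → List ℕ → ℕ
indexOf j [] = 0
indexOf j (x ∷ xs) = if j ≡ᵇ x then 0 else suc (indexOf j xs)

compose : List ℕ → List ℕ → List ℕ
compose σ π = map (at σ) π

inverse : List ℕ → List ℕ
inverse σ = map (λ j → indexOf j σ) (upTo (length σ))

-- descent set {i ∈ [n-1] : σ_i > σ_{i+1}} (1-based positions), increasing
descents : List ℕ → List ℕ
descents σ = filterᵇ (λ i → at σ i <ᵇ at σ (i ∸ 1)) (applyUpTo suc (length σ ∸ 1))

D : List ℕ → List ℕ
D σ = co (length σ) (descents σ)

Prob : (List ℕ → List ℕ → ℚ) → ℕ → List ℕ → ℚ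
Prob c n π = c (D π) (single n) ÷₀ ∑ (perms n) (λ σ → c (D σ) (single n))

-- K(π, σπ) = Prob(σ⁻¹), i.e. K(π, τ) = Prob((τπ⁻¹)⁻¹)
K : (List ℕ → List ℕ → ℚ) → ℕ → List ℕ → List ℕ → ℚ
K c n π τ = Prob c n (inverse (compose τ (inverse π)))

Kbar : (List ℕ → List ℕ → ℚ) → (List ℕ → List ℕ → ℚ) → ℕ → List ℕ → List ℕ → ℚ
Kbar φ c n α β = c α β ÷₀ (lam φ ^ℚ n)

IsStochastic : List (List ℕ) → (List ℕ → List ℕ → ℚ) → Set
IsStochastic states P =
  (∀ x y → x ∈ states → y ∈ states → 0ℚ ≤ P x y) ×
  (∀ x → x ∈ states → ∑ states (λ y → P x y) ≡ 1ℚ)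

IsStationary : List (List ℕ) → (List ℕ → List ℕ → ℚ) → (List ℕ → ℚ) → Set
IsStationary states P μ =
  (∀ x → x ∈ states → 0ℚ ≤ μ x) ×
  (∑ states μ ≡ 1ℚ) ×
  (∀ y → y ∈ states → ∑ states (λ x → μ x * P x y) ≡ μ y)

UniqueStationary : List (List ℕ) → (List ℕ → List ℕ → ℚ) → (List ℕ → ℚ) → Set
UniqueStationary states P ν =
  IsStationary states P ν ×
  (∀ (μ : List ℕ → ℚ) → IsStationary states P μ → ∀ x → x ∈ states → μ x ≡ ν x)

invFact : ℕ → ℚ
invFact n = _/_ (+ 1) (n !) {{n !≢0}}

uniform : ℕ → List ℕ → ℚ
uniform n π = invFact n

descentDist : ℕ → List ℕ → ℚ
descentDist n α = ι (count α (map D (perms n))) * invFact n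

module Submission where

open import Defs
open import Algebra.Bundles using (Group)
open import Data.Bool as Bool using (Bool; T; true; false; if_then_else_; not; _∧_; _∨_)
open import Data.Bool.ListAction using (all; any)
import Data.Integer as ℤ
import Data.Integer.Properties as ℤ
open import Data.List
  using ( List; []; _∷_; [_]; _++_; map; concatMap; length; take; drop; replicate; filter; filterᵇ; applyUpTo; upTo)
open import Data.List.Properties
  using ( map-∘; map-++; map-concatMap; map-id-local; map-cong-local; map-upTo; concatMap-map; concatMap-cong
        ; ∷-injectiveʳ; ∷-injectiveˡ; ++-assoc; length-map; length-++; length-upTo; length-replicate; length-take
        ; length-drop; take++drop≡id; applyUpTo-∷ʳ; filter-all; filter-reject; filter-accept; ≡-dec)
open import Data.List.Membership.Propositional using (_∈_; lose)
open import Data.List.Membership.Propositional.Properties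
  using ( ∈-map⁺; ∈-map⁻; ∈-concatMap⁺; ∈-concatMap⁻; ∈-upTo⁻; ∈-upTo⁺; ∈-∃++)
open import Data.List.Membership.Propositional.Properties.WithK using (unique∧set⇒bag)
open import Data.List.Relation.Binary.BagAndSetEquality using (∼bag⇒↭)
open import Data.List.Relation.Binary.Disjoint.Propositional using (Disjoint)
open import Data.List.Relation.Binary.Permutation.Propositional
  using ( _↭_; ↭-sym; ↭-trans; ↭-reflexive; ↭-prep; ↭-swap; ↭⇒↭ₛ)
open import Data.List.Relation.Binary.Permutation.Propositional.Properties
  using ( ∷↭∷ʳ; ↭-length; ↭-empty-inv; All-resp-↭; ∈-resp-↭; drop-mid; map⁺; shift; ++⁺; ++⁺ˡ)
import Data.List.Relation.Binary.Permutation.Setoid.Properties as ↭ₛ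
open import Data.List.Relation.Unary.All as All using (All; []; _∷_)
import Data.List.Relation.Unary.All.Properties as All
open import Data.List.Relation.Unary.AllPairs using (AllPairs; []; _∷_)
import Data.List.Relation.Unary.AllPairs.Properties as AllPairs
open import Data.List.Relation.Unary.Any as Any using (Any; here; there)
open import Data.List.Relation.Unary.Unique.Propositional using (Unique)
import Data.List.Relation.Unary.Unique.Propositional.Properties as Unique
open import Data.Nat as ℕ using (ℕ; zero; suc; _∸_; _≡ᵇ_; _<ᵇ_; s≤s; z≤n; _!)
import Data.Nat.Properties as ℕ
open import Data.Nat.ListAction using (sum)
open import Data.Nat.ListAction.Properties using (sum-++)
open import Data.Product using (Σ; _×_; _,_; proj₁; proj₂)
open import Data.Rational
  using ( ℚ; 0ℚ; 1ℚ; _+_; _*_; _-_; -_; _/_; 1/_; _≤_; _<_; ∣_∣; toℚᵘ; positive; nonNegative; ≢-nonZero)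
open import Data.Rational.Properties
  using ( +-identityˡ; +-identityʳ; +-assoc; +-comm; +-inverseʳ; +-0-group; *-identityˡ; *-identityʳ; *-zeroˡ
        ; *-zeroʳ; *-assoc; *-comm; *-inverseˡ; *-inverseʳ; *-distribˡ-+; *-distribʳ-+; ≤-refl; ≤-reflexive; ≤-trans
        ; ≤-antisym; <-trans; <-≤-trans; ≤-<-trans; <⇒≤; <-irrefl; ≮⇒≥; _<?_; _≟_; +-mono-≤; +-monoʳ-≤; +-monoˡ-≤
        ; +-monoʳ-<; neg-antimono-<; *-monoˡ-<-pos; *-monoʳ-<-pos; *-monoˡ-≤-nonNeg; *-cancelˡ-<-nonNeg
        ; *-cancelʳ-≤-pos; positive⁻¹; nonNegative⁻¹; normalize-nonNeg; ∣p∣≡0⇒p≡0; 0≤∣p∣; 0≤p⇒∣p∣≡p; ∣p∣≡p∨∣p∣≡-p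
        ; ∣p-q∣≤∣p∣+∣q∣; ∣p*q∣≡∣p∣*∣q∣; toℚᵘ-injective; toℚᵘ-homo-+; toℚᵘ-homo-*; toℚᵘ-fromℚᵘ; module ≤-Reasoning)
open import Data.Rational.Solver using (module +-*-Solver)
open import Data.Rational.Unnormalised as ℚᵘ using (mkℚᵘ; *≡*)
import Data.Rational.Unnormalised.Properties as ℚᵘ
open import Data.Sum using (_⊎_; inj₁; inj₂)
open import Function using (_∘_; id; mk⇔; _on_)
open import Level using (0ℓ)
open import Relation.Binary.Definitions using (tri<; tri≈; tri>)
open import Relation.Binary.PropositionalEquality
  using ( _≡_; _≢_; refl; sym; trans; cong; cong₂; subst; subst₂; ≢-sym; setoid; module ≡-Reasoning)
open import Relation.Nullary using (contradiction; yes; no; ¬?)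
open import Algebra.Properties.Group +-0-group using () renaming (∙-cancelʳ to +-cancelʳ; x∙y⁻¹≈ε⇒x≈y to p-q≡0⇒p≡q)

-- Let ζ(F_α) = c_{α,(n)}, the coefficient of M_(n) in Φ(F_α). Comultiplicativity makes Φ triangular in the basis M_γ,
-- with diagonal entries Π t_{γᵢ}, where t_k = ζ(M_(k)) and t_1 = λ. Since F_α M_(1) is the sum of the F_{D(w)} over
-- the insertions w of a new maximum into a permutation with descent composition α, multiplicativity gives
-- λ ζ(F_α) = Σ ζ(F_{D(w)}); descending in the degree, nonnegativity and the positive value at a composition other than
-- (n), (1^n) yield |t_k| < |λ|^k for 2 ≤ k ≤ n. Hence λ^n is a simple eigenvalue of Φ on Q_n, and its eigenvector is
-- M_(1)^n = Σ_σ F_{D(σ)}, which gives the statement about K̄.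
--
-- For K, the Dirichlet form Σ K(π,τ) (μ(π) - μ(τ))² of a stationary μ vanishes because K is doubly stochastic, so μ is
-- invariant under left multiplication by every σ with D(σ) = α for one α other than (n), (1^n). These σ generate the
-- symmetric group: putting an extreme value at a peak or valley of α, with v and v + 1 on different sides of it, shows
-- that the subgroup contains the transposition (v v+1).

-- Finite sums

-- Everything stays over the rationals, without Perron-Frobenius theory or complex eigenvalues:
-- triangularity exhibits each eigenvalue of Φ on Q_n as a product of the t_k. The difference of two
-- stationary vectors of K̄ is an eigenvector for λ^n whose coordinate at M_(1^n) is the sum of its
-- entries, hence 0, and this forces the other coordinates to vanish. The strictness of |t_k| <
-- |λ|^k comes from counting. Every word of length m + 1 is an insertion of some word of length m,
-- so the sums of ζ, rescaled by powers of λ, weakly decrease with the degree. Between degrees 2 and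
-- 3 the drop is the mass of (1,2) and (2,1), each of which arises from both (2) and (1,1); it is
-- positive because a mixed word can be shortened to a mixed word. Absolute values are needed since
-- λ may be negative when n is even. For generation the obstacle is that exchanging v and v + 1
-- changes a pattern when they are neighbours; an extreme value between them prevents this.
-- Transpositions that move the extreme value itself have to come from conjugation.

private variable
  A B : Set

+-interchange : ∀ a b c d → (a + b) + (c + d) ≡ (a + c) + (b + d)
+-interchange = solve 4 (λ a b c d → (a :+ b) :+ (c :+ d) := (a :+ c) :+ (b :+ d)) refl
  where open +-*-Solver

∑-cong : {f g : A → ℚ} (xs : List A) → (∀ x → x ∈ xs → f x ≡ g x) → ∑ xs f ≡ ∑ xs g
∑-cong [] e = refl
∑-cong (x ∷ xs) e = cong₂ _+_ (e x (here refl)) (∑-cong xs (λ y y∈ → e y (there y∈)))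

∑-ext : {f g : A → ℚ} (xs : List A) → (∀ x → f x ≡ g x) → ∑ xs f ≡ ∑ xs g
∑-ext xs e = ∑-cong xs (λ x _ → e x)

∑-0 : (xs : List A) → ∑ xs (λ _ → 0ℚ) ≡ 0ℚ
∑-0 [] = refl
∑-0 (x ∷ xs) = trans (+-identityˡ _) (∑-0 xs)

∑-zero : {f : A → ℚ} (xs : List A) → (∀ x → x ∈ xs → f x ≡ 0ℚ) → ∑ xs f ≡ 0ℚ
∑-zero xs e = trans (∑-cong xs e) (∑-0 xs)

∑-+ : (xs : List A) (f g : A → ℚ) → ∑ xs (λ x → f x + g x) ≡ ∑ xs f + ∑ xs g
∑-+ [] f g = refl
∑-+ (x ∷ xs) f g = trans (cong (f x + g x +_) (∑-+ xs f g)) (+-interchange (f x) (g x) _ _)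

∑-*ˡ : (xs : List A) (c : ℚ) (f : A → ℚ) → ∑ xs (λ x → c * f x) ≡ c * ∑ xs f
∑-*ˡ [] c f = sym (*-zeroʳ c)
∑-*ˡ (x ∷ xs) c f = trans (cong (c * f x +_) (∑-*ˡ xs c f)) (sym (*-distribˡ-+ c (f x) _))

∑-*ʳ : (xs : List A) (c : ℚ) (f : A → ℚ) → ∑ xs (λ x → f x * c) ≡ ∑ xs f * c
∑-*ʳ xs c f = trans (∑-ext xs (λ x → *-comm (f x) c)) (trans (∑-*ˡ xs c f) (*-comm c _))

∑-- : (xs : List A) (f g : A → ℚ) → ∑ xs (λ x → f x - g x) ≡ ∑ xs f - ∑ xs g
∑-- [] f g = refl
∑-- (x ∷ xs) f g = trans (cong (f x - g x +_) (∑-- xs f g)) (lemma (f x) (g x) _ _)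
  where
  open +-*-Solver
  lemma : ∀ a b c d → (a - b) + (c - d) ≡ (a + c) - (b + d)
  lemma = solve 4 (λ a b c d → (a :- b) :+ (c :- d) := (a :+ c) :- (b :+ d)) refl

∑-swap : (xs : List A) (ys : List B) (f : A → B → ℚ) →
  ∑ xs (λ x → ∑ ys (f x)) ≡ ∑ ys (λ y → ∑ xs (λ x → f x y))
∑-swap [] ys f = sym (∑-0 ys)
∑-swap (x ∷ xs) ys f = trans (cong (∑ ys (f x) +_) (∑-swap xs ys f)) (sym (∑-+ ys (f x) _))

∑-++ : (xs ys : List A) (f : A → ℚ) → ∑ (xs ++ ys) f ≡ ∑ xs f + ∑ ys f
∑-++ [] ys f = sym (+-identityˡ _)
∑-++ (x ∷ xs) ys f = trans (cong (f x +_) (∑-++ xs ys f)) (sym (+-assoc (f x) _ _))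

∑-map : (h : A → B) (xs : List A) (f : B → ℚ) → ∑ (map h xs) f ≡ ∑ xs (f ∘ h)
∑-map h [] f = refl
∑-map h (x ∷ xs) f = cong (f (h x) +_) (∑-map h xs f)

∑-concatMap : (h : A → List B) (xs : List A) (f : B → ℚ) → ∑ (concatMap h xs) f ≡ ∑ xs (λ x → ∑ (h x) f)
∑-concatMap h [] f = refl
∑-concatMap h (x ∷ xs) f = trans (∑-++ (h x) _ f) (cong (∑ (h x) f +_) (∑-concatMap h xs f))

∑-↭ : {xs ys : List A} (f : A → ℚ) → xs ↭ ys → ∑ xs f ≡ ∑ ys f
∑-↭ f _↭_.refl = refl
∑-↭ f (_↭_.prep x p) = cong (f x +_) (∑-↭ f p)
∑-↭ f (_↭_.swap {xs} {ys} x y p) = begin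
  f x + (f y + ∑ xs f)  ≡⟨ cong (λ s → f x + (f y + s)) (∑-↭ f p) ⟩
  f x + (f y + ∑ ys f)  ≡⟨ lemma (f x) (f y) (∑ ys f) ⟩
  f y + (f x + ∑ ys f)  ∎
  where
  open ≡-Reasoning
  lemma : ∀ a b c → a + (b + c) ≡ b + (a + c)
  lemma = let open +-*-Solver in solve 3 (λ a b c → a :+ (b :+ c) := b :+ (a :+ c)) refl
∑-↭ f (_↭_.trans p q) = trans (∑-↭ f p) (∑-↭ f q)

∑-mono : {f g : A → ℚ} (xs : List A) → (∀ x → x ∈ xs → f x ≤ g x) → ∑ xs f ≤ ∑ xs g
∑-mono [] le = ≤-refl
∑-mono (x ∷ xs) le = +-mono-≤ (le x (here refl)) (∑-mono xs (λ y y∈ → le y (there y∈)))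

0≤+ : ∀ {p q} → 0ℚ ≤ p → 0ℚ ≤ q → 0ℚ ≤ p + q
0≤+ = +-mono-≤ {0ℚ} {_} {0ℚ}

0≤* : ∀ {p q} → 0ℚ ≤ p → 0ℚ ≤ q → 0ℚ ≤ p * q
0≤* {p} {q} 0≤p 0≤q = subst (_≤ p * q) (*-zeroʳ p) (*-monoˡ-≤-nonNeg p {{nonNegative 0≤p}} 0≤q)

p≤p+q : ∀ {p q} → 0ℚ ≤ q → p ≤ p + q
p≤p+q {p} 0≤q = ≤-trans (≤-reflexive (sym (+-identityʳ p))) (+-monoʳ-≤ p 0≤q)

q≤p+q : ∀ {p q} → 0ℚ ≤ p → q ≤ p + q
q≤p+q {p} {q} 0≤p = ≤-trans (≤-reflexive (sym (+-identityˡ q))) (+-monoˡ-≤ q 0≤p)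

∑-nonneg : {f : A → ℚ} (xs : List A) → (∀ x → x ∈ xs → 0ℚ ≤ f x) → 0ℚ ≤ ∑ xs f
∑-nonneg [] nn = ≤-refl
∑-nonneg (x ∷ xs) nn = 0≤+ (nn x (here refl)) (∑-nonneg xs (λ y y∈ → nn y (there y∈)))

term≤∑ : {f : A → ℚ} {xs : List A} {x : A} → (∀ x → x ∈ xs → 0ℚ ≤ f x) → x ∈ xs → f x ≤ ∑ xs f
term≤∑ {xs = _ ∷ xs} nn (here refl) = p≤p+q (∑-nonneg xs (λ y y∈ → nn y (there y∈)))
term≤∑ {xs = _ ∷ xs} nn (there x∈) = ≤-trans (term≤∑ (λ y y∈ → nn y (there y∈)) x∈) (q≤p+q (nn _ (here refl)))

∑≡0⇒term≡0 : {f : A → ℚ} {xs : List A} {x : A} → (∀ x → x ∈ xs → 0ℚ ≤ f x) → ∑ xs f ≡ 0ℚ →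
  x ∈ xs → f x ≡ 0ℚ
∑≡0⇒term≡0 nn s x∈ = ≤-antisym (≤-trans (term≤∑ nn x∈) (≤-reflexive s)) (nn _ x∈)

-- Compositions as descent words

-- A composition of m + 1 is encoded by the indicator word of S_α ⊆ [m]; true marks a descent.
Word : Set
Word = List Bool

-- A copy of the local function `inc` of `comps`, which has no name outside its definition.
bump : List ℕ → List ℕ
bump [] = []
bump (a ∷ as) = suc a ∷ as

comp : Word → List ℕ
comp [] = 1 ∷ []
comp (true ∷ d) = 1 ∷ comp d
comp (false ∷ d) = bump (comp d)

words : ℕ → List Word
words zero = [] ∷ []
words (suc m) = concatMap (λ d → (true ∷ d) ∷ (false ∷ d) ∷ []) (words m)

comps≡map-comp : ∀ m → comps (suc m) ≡ map comp (words m)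
comps≡map-comp zero = refl
comps≡map-comp (suc m) = begin
  comps (suc (suc m))
    ≡⟨ concatMap-cong (λ { [] → refl ; (_ ∷ _) → refl }) (comps (suc m)) ⟩
  concatMap (λ c → (1 ∷ c) ∷ bump c ∷ []) (comps (suc m))
    ≡⟨ cong (concatMap _) (comps≡map-comp m) ⟩
  concatMap (λ c → (1 ∷ c) ∷ bump c ∷ []) (map comp (words m))
    ≡⟨ concatMap-map _ comp (words m) ⟩
  concatMap (λ d → comp (true ∷ d) ∷ comp (false ∷ d) ∷ []) (words m)
    ≡⟨ sym (map-concatMap comp _ (words m)) ⟩
  map comp (words (suc m)) ∎
  where open ≡-Reasoning

∈-words : ∀ d → d ∈ words (length d)
∈-words [] = here refl
∈-words (true ∷ d) = ∈-concatMap⁺ _ (Any.map (λ { refl → here refl }) (∈-words d))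
∈-words (false ∷ d) = ∈-concatMap⁺ _ (Any.map (λ { refl → there (here refl) }) (∈-words d))

words-length : ∀ m {d} → d ∈ words m → length d ≡ m
words-length zero (here refl) = refl
words-length (suc m) {d} d∈ = go (words m) (λ _ → words-length m) (∈-concatMap⁻ _ d∈)
  where
  go : ∀ ds → (∀ e → e ∈ ds → length e ≡ m) →
       Any.Any (λ e → d ∈ (true ∷ e) ∷ (false ∷ e) ∷ []) ds → length d ≡ suc m
  go _ h (here (here refl)) = cong suc (h _ (here refl))
  go _ h (here (there (here refl))) = cong suc (h _ (here refl))
  go _ h (there p) = go _ (λ e e∈ → h e (there e∈)) p

comp∈comps : ∀ d → comp d ∈ comps (suc (length d))
comp∈comps d = subst (comp d ∈_) (sym (comps≡map-comp (length d))) (∈-map⁺ comp (∈-words d))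

comps-word : ∀ {m α} → α ∈ comps (suc m) → Σ Word λ d → length d ≡ m × α ≡ comp d
comps-word {m} α∈ with d , d∈ , eq ← ∈-map⁻ comp (subst (_ ∈_) (comps≡map-comp m) α∈) =
  d , words-length m d∈ , eq

∑-comps : ∀ m (g : List ℕ → ℚ) → ∑ (comps (suc m)) g ≡ ∑ (words m) (g ∘ comp)
∑-comps m g = trans (cong (λ l → ∑ l g) (comps≡map-comp m)) (∑-map comp (words m) g)

∑-words : ∀ m (g : Word → ℚ) → ∑ (words (suc m)) g ≡ ∑ (words m) (g ∘ (true ∷_)) + ∑ (words m) (g ∘ (false ∷_))
∑-words m g = begin
  ∑ (words (suc m)) g
    ≡⟨ ∑-concatMap _ (words m) g ⟩
  ∑ (words m) (λ d → g (true ∷ d) + (g (false ∷ d) + 0ℚ))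
    ≡⟨ ∑-ext (words m) (λ d → cong (g (true ∷ d) +_) (+-identityʳ _)) ⟩
  ∑ (words m) (λ d → g (true ∷ d) + g (false ∷ d))
    ≡⟨ ∑-+ (words m) (g ∘ (true ∷_)) (g ∘ (false ∷_)) ⟩
  ∑ (words m) (g ∘ (true ∷_)) + ∑ (words m) (g ∘ (false ∷_)) ∎
  where open ≡-Reasoning

comp-nonempty : ∀ d → Σ ℕ λ a → Σ (List ℕ) λ as → comp d ≡ suc a ∷ as
comp-nonempty [] = 0 , [] , refl
comp-nonempty (true ∷ d) = 0 , comp d , refl
comp-nonempty (false ∷ d) with a , as , eq ← comp-nonempty d = suc a , as , cong bump eq

comp-injective : ∀ d e → comp d ≡ comp e → d ≡ e
comp-injective [] [] eq = refl
comp-injective [] (true ∷ e) eq with comp e | comp-nonempty e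
comp-injective [] (true ∷ e) () | _ | _ , _ , refl
comp-injective [] (false ∷ e) eq with comp e | comp-nonempty e
comp-injective [] (false ∷ e) () | _ | _ , _ , refl
comp-injective (true ∷ d) [] eq with comp d | comp-nonempty d
comp-injective (true ∷ d) [] () | _ | _ , _ , refl
comp-injective (false ∷ d) [] eq with comp d | comp-nonempty d
comp-injective (false ∷ d) [] () | _ | _ , _ , refl
comp-injective (true ∷ d) (true ∷ e) eq with comp d in p | comp e in q
comp-injective (true ∷ d) (true ∷ e) refl | _ | _ = cong (true ∷_) (comp-injective d e (trans p (sym q)))
comp-injective (true ∷ d) (false ∷ e) eq with comp e | comp-nonempty e
comp-injective (true ∷ d) (false ∷ e) () | _ | _ , _ , refl
comp-injective (false ∷ d) (true ∷ e) eq with comp d | comp-nonempty d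
comp-injective (false ∷ d) (true ∷ e) () | _ | _ , _ , refl
comp-injective (false ∷ d) (false ∷ e) eq with comp d in p | comp-nonempty d | comp e in q | comp-nonempty e
comp-injective (false ∷ d) (false ∷ e) refl | _ | _ , _ , refl | _ | _ , _ , refl =
  cong (false ∷_) (comp-injective d e (trans p (sym q)))

comp-single : ∀ m → comp (replicate m false) ≡ single (suc m)
comp-single zero = refl
comp-single (suc m) = cong bump (comp-single m)

comp-ones : ∀ m → comp (replicate m true) ≡ ones (suc m)
comp-ones zero = refl
comp-ones (suc m) = cong (1 ∷_) (comp-ones m)

positions : ℕ → Word → List ℕ
positions k [] = []
positions k (true ∷ d) = k ∷ positions (suc k) d
positions k (false ∷ d) = positions (suc k) d

S-comp : ∀ a d → dropLast (cumsums a (comp d)) ≡ positions (suc a) d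
S-comp a [] = refl
S-comp a (true ∷ d) with comp d | comp-nonempty d | S-comp (suc a) d
... | _ | _ , _ , refl | ih rewrite ℕ.+-comm a 1 = cong (suc a ∷_) ih
S-comp a (false ∷ d) with comp d | comp-nonempty d | S-comp (suc a) d
... | _ | b , _ , refl | ih rewrite ℕ.+-suc a (suc b) = ih

-- Refinement order and sums over its up-sets and down-sets

infix 4 _⊑_
_⊑_ : Word → Word → Bool
[] ⊑ [] = true
(a ∷ d) ⊑ (b ∷ e) = (not a ∨ b) ∧ (d ⊑ e)
_ ⊑ _ = false

private
  mem : ℕ → List ℕ → Bool
  mem s = any (λ t → s ≡ᵇ t)

≡ᵇ-refl : ∀ n → (n ≡ᵇ n) ≡ true
≡ᵇ-refl zero = refl
≡ᵇ-refl (suc n) = ≡ᵇ-refl n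

<⇒≢ᵇ : ∀ {m n} → m ℕ.< n → (m ≡ᵇ n) ≡ false
<⇒≢ᵇ {zero} {suc n} lt = refl
<⇒≢ᵇ {suc m} {suc n} (s≤s lt) = <⇒≢ᵇ lt

>⇒≢ᵇ : ∀ {m n} → n ℕ.< m → (m ≡ᵇ n) ≡ false
>⇒≢ᵇ {suc m} {zero} lt = refl
>⇒≢ᵇ {suc m} {suc n} (s≤s lt) = >⇒≢ᵇ lt

mem-< : ∀ {s k} e → s ℕ.< k → mem s (positions k e) ≡ false
mem-< [] lt = refl
mem-< (true ∷ e) lt rewrite <⇒≢ᵇ lt = mem-< e (ℕ.m<n⇒m<1+n lt)
mem-< (false ∷ e) lt = mem-< e (ℕ.m<n⇒m<1+n lt)

-- The scanned positions all exceed k, so none of them can match k; this lets the two words be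
-- compared letter by letter.
all-mem-skip : ∀ {k j} d l → k ℕ.< j →
  all (λ s → mem s (k ∷ l)) (positions j d) ≡ all (λ s → mem s l) (positions j d)
all-mem-skip [] l lt = refl
all-mem-skip {k} {j} (true ∷ d) l lt rewrite >⇒≢ᵇ lt = cong (mem j l ∧_) (all-mem-skip d l (ℕ.m<n⇒m<1+n lt))
all-mem-skip (false ∷ d) l lt = all-mem-skip d l (ℕ.m<n⇒m<1+n lt)

all-mem : ∀ k d e → length d ≡ length e → all (λ s → mem s (positions k e)) (positions k d) ≡ (d ⊑ e)
all-mem k [] [] eq = refl
all-mem k (true ∷ d) (true ∷ e) eq rewrite ≡ᵇ-refl k =
  trans (all-mem-skip d (positions (suc k) e) (ℕ.n<1+n k)) (all-mem (suc k) d e (ℕ.suc-injective eq))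
all-mem k (true ∷ d) (false ∷ e) eq rewrite mem-< e (ℕ.n<1+n k) = refl
all-mem k (false ∷ d) (true ∷ e) eq =
  trans (all-mem-skip d (positions (suc k) e) (ℕ.n<1+n k)) (all-mem (suc k) d e (ℕ.suc-injective eq))
all-mem k (false ∷ d) (false ∷ e) eq = all-mem (suc k) d e (ℕ.suc-injective eq)

≤ᶜ-comp : ∀ d e → length d ≡ length e → (comp d ≤ᶜ comp e) ≡ (d ⊑ e)
≤ᶜ-comp d e eq rewrite S-comp 0 d | S-comp 0 e = all-mem 1 d e eq

-- Sums over the words above and below d in the Boolean lattice, with recursion on d in place of the
-- test `_≤ᶜ_`. If g is the family M_e, then `↑∑ d g` is F_d; if g lists the F-coefficients of an
-- element, then `↓∑ d g` is its coefficient at M_d.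
↑∑ ↓∑ : Word → (Word → ℚ) → ℚ
↑∑ [] g = g []
↑∑ (true ∷ d) g = ↑∑ d (g ∘ (true ∷_))
↑∑ (false ∷ d) g = ↑∑ d (g ∘ (true ∷_)) + ↑∑ d (g ∘ (false ∷_))
↓∑ [] g = g []
↓∑ (true ∷ d) g = ↓∑ d (g ∘ (true ∷_)) + ↓∑ d (g ∘ (false ∷_))
↓∑ (false ∷ d) g = ↓∑ d (g ∘ (false ∷_))

private
  when : Bool → ℚ → ℚ
  when b q = if b then q else 0ℚ

↑∑-words : ∀ d g → ∑ (words (length d)) (λ e → when (d ⊑ e) (g e)) ≡ ↑∑ d g
↑∑-words [] g = +-identityʳ _
↑∑-words (true ∷ d) g = trans (∑-words (length d) (λ e → when (true ∷ d ⊑ e) (g e))) (trans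
  (cong₂ _+_ (↑∑-words d (g ∘ (true ∷_))) (∑-0 (words (length d)))) (+-identityʳ _))
↑∑-words (false ∷ d) g = trans (∑-words (length d) (λ e → when (false ∷ d ⊑ e) (g e)))
  (cong₂ _+_ (↑∑-words d (g ∘ (true ∷_))) (↑∑-words d (g ∘ (false ∷_))))

↓∑-words : ∀ d g → ∑ (words (length d)) (λ e → when (e ⊑ d) (g e)) ≡ ↓∑ d g
↓∑-words [] g = +-identityʳ _
↓∑-words (true ∷ d) g = trans (∑-words (length d) (λ e → when (e ⊑ true ∷ d) (g e)))
  (cong₂ _+_ (↓∑-words d (g ∘ (true ∷_))) (↓∑-words d (g ∘ (false ∷_))))
↓∑-words (false ∷ d) g = trans (∑-words (length d) (λ e → when (e ⊑ false ∷ d) (g e))) (trans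
  (cong₂ _+_ (∑-0 (words (length d))) (↓∑-words d (g ∘ (false ∷_)))) (+-identityˡ _))

↑∑-comps : ∀ d (g : List ℕ → ℚ) →
  ∑ (comps (suc (length d))) (λ β → if comp d ≤ᶜ β then g β else 0ℚ) ≡ ↑∑ d (g ∘ comp)
↑∑-comps d g = trans (∑-comps (length d) (λ β → when (comp d ≤ᶜ β) (g β))) (trans
  (∑-cong {f = λ e → when (comp d ≤ᶜ comp e) (g (comp e))} {g = λ e → when (d ⊑ e) (g (comp e))} (words (length d))
    (λ e e∈ → cong (λ b → when b (g (comp e))) (≤ᶜ-comp d e (sym (words-length _ e∈)))))
  (↑∑-words d (g ∘ comp)))

↓∑-comps : ∀ d (g : List ℕ → ℚ) →
  ∑ (comps (suc (length d))) (λ β → if β ≤ᶜ comp d then g β else 0ℚ) ≡ ↓∑ d (g ∘ comp)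
↓∑-comps d g = trans (∑-comps (length d) (λ β → when (β ≤ᶜ comp d) (g β))) (trans
  (∑-cong {f = λ e → when (comp e ≤ᶜ comp d) (g (comp e))} {g = λ e → when (e ⊑ d) (g (comp e))} (words (length d))
    (λ e e∈ → cong (λ b → when b (g (comp e))) (≤ᶜ-comp e d (words-length _ e∈))))
  (↓∑-words d (g ∘ comp)))

↓∑-single : ∀ m g → ↓∑ (replicate m false) g ≡ g (replicate m false)
↓∑-single zero g = refl
↓∑-single (suc m) g = ↓∑-single m (g ∘ (false ∷_))

↓∑-ones : ∀ m g → ↓∑ (replicate m true) g ≡ ∑ (words m) g
↓∑-ones zero g = sym (+-identityʳ _)
↓∑-ones (suc m) g = trans (cong₂ _+_ (↓∑-ones m (g ∘ (true ∷_))) (↓∑-ones m (g ∘ (false ∷_)))) (sym (∑-words m g))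

-- Descent patterns of words

pattern-of : List ℕ → Word
pattern-of [] = []
pattern-of (x ∷ []) = []
pattern-of (x ∷ y ∷ r) = (y <ᵇ x) ∷ pattern-of (y ∷ r)

length-pattern : ∀ x r → length (pattern-of (x ∷ r)) ≡ length r
length-pattern x [] = refl
length-pattern x (y ∷ r) = cong suc (length-pattern y r)

-- The start k, the index function h and the predicate p are general because the test in `descents`
-- refers to the whole permutation, whereas the induction passes to a tail.
filter-descents : ∀ x r k (h : ℕ → ℕ) (p : ℕ → Bool) → (∀ i → h i ≡ k ℕ.+ i) →
  (∀ i → p (k ℕ.+ i) ≡ (at (x ∷ r) (suc i) <ᵇ at (x ∷ r) i)) →
  filterᵇ p (applyUpTo h (length r)) ≡ positions k (pattern-of (x ∷ r))
filter-descents x [] k h p eh ep = refl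
filter-descents x (y ∷ r) k h p eh ep
  with p (h 0) | trans (cong p (eh 0)) (ep 0) | trans (eh 0) (ℕ.+-identityʳ k)
     | filter-descents y r (suc k) (h ∘ suc) p (λ i → trans (eh (suc i)) (ℕ.+-suc k i))
         (λ i → trans (cong p (sym (ℕ.+-suc k i))) (ep (suc i)))
... | b | eb | ek | ih with y <ᵇ x
filter-descents x (y ∷ r) k h p eh ep | _ | refl | ek | ih | true = cong₂ _∷_ ek ih
filter-descents x (y ∷ r) k h p eh ep | _ | refl | ek | ih | false = ih

-- The local function `go` of `co`, made available under a name.
gaps : ℕ → ℕ → List ℕ → List ℕ
gaps n p [] = (n ∸ p) ∷ []
gaps n p (s ∷ ss) = (s ∸ p) ∷ gaps n s ss

co≡gaps : ∀ n T → co (suc n) T ≡ gaps (suc n) 0 T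
co≡gaps n [] = refl
co≡gaps n (s ∷ ss) = cong (s ∷_) (tail≡ ss s)
  where
  tail≡ : ∀ ss p → drop 1 (co (suc n) (p ∷ ss)) ≡ gaps (suc n) p ss
  tail≡ [] p = refl
  tail≡ (s ∷ ss) p = cong ((s ∸ p) ∷_) (tail≡ ss s)

raise : ℕ → List ℕ → List ℕ
raise zero c = c
raise (suc a) c = raise a (bump c)

raise-∷ : ∀ a x xs → raise a (x ∷ xs) ≡ (a ℕ.+ x) ∷ xs
raise-∷ zero x xs = refl
raise-∷ (suc a) x xs = trans (raise-∷ a (suc x) xs) (cong (_∷ xs) (ℕ.+-suc a x))

-- Here p is the last cut, q the next position to be read and a the number of positions without a
-- descent passed since p. They belong to the part that is still open, which `raise a` accounts for.
gaps-positions : ∀ d {n p q a} → q ≡ suc (p ℕ.+ a) → n ≡ q ℕ.+ length d →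
  gaps n p (positions q d) ≡ raise a (comp d)
gaps-positions [] {p = p} {a = a} refl refl
  rewrite ℕ.+-identityʳ (p ℕ.+ a) | sym (ℕ.+-suc p a) | ℕ.m+n∸m≡n p (suc a) | raise-∷ a 1 [] | ℕ.+-comm a 1 = refl
gaps-positions (true ∷ d) {n} {p} {q} {a} refl eqₙ = begin
  (q ∸ p) ∷ gaps n q (positions (suc q) d)
    ≡⟨ cong₂ _∷_ (trans (cong (_∸ p) (sym (ℕ.+-suc p a))) (ℕ.m+n∸m≡n p (suc a)))
         (gaps-positions d (cong suc (sym (ℕ.+-identityʳ q))) (trans eqₙ (ℕ.+-suc q (length d)))) ⟩
  suc a ∷ comp d
    ≡⟨ cong (_∷ comp d) (ℕ.+-comm 1 a) ⟩
  (a ℕ.+ 1) ∷ comp d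
    ≡⟨ sym (raise-∷ a 1 (comp d)) ⟩
  raise a (1 ∷ comp d) ∎
  where open ≡-Reasoning
gaps-positions (false ∷ d) {n} {p} {q} {a} refl eqₙ =
  gaps-positions d (cong suc (sym (ℕ.+-suc p a))) (trans eqₙ (ℕ.+-suc q (length d)))

D≡comp-pattern : ∀ x r → D (x ∷ r) ≡ comp (pattern-of (x ∷ r))
D≡comp-pattern x r = begin
  D (x ∷ r)
    ≡⟨ cong (co (suc (length r))) (filter-descents x r 1 suc _ (λ _ → refl) (λ _ → refl)) ⟩
  co (suc (length r)) (positions 1 (pattern-of (x ∷ r)))
    ≡⟨ co≡gaps (length r) _ ⟩
  gaps (suc (length r)) 0 (positions 1 (pattern-of (x ∷ r)))
    ≡⟨ gaps-positions (pattern-of (x ∷ r)) refl (cong suc (sym (length-pattern x r))) ⟩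
  comp (pattern-of (x ∷ r)) ∎
  where open ≡-Reasoning

↑∑-cong : ∀ d {f g : Word → ℚ} → (∀ e → length e ≡ length d → f e ≡ g e) → ↑∑ d f ≡ ↑∑ d g
↑∑-cong [] eq = eq [] refl
↑∑-cong (true ∷ d) eq = ↑∑-cong d (λ e l → eq (true ∷ e) (cong suc l))
↑∑-cong (false ∷ d) eq =
  cong₂ _+_ (↑∑-cong d (λ e l → eq (true ∷ e) (cong suc l))) (↑∑-cong d (λ e l → eq (false ∷ e) (cong suc l)))

↑∑-+ : ∀ d f g → ↑∑ d (λ e → f e + g e) ≡ ↑∑ d f + ↑∑ d g
↑∑-+ [] f g = refl
↑∑-+ (true ∷ d) f g = ↑∑-+ d (f ∘ (true ∷_)) (g ∘ (true ∷_))
↑∑-+ (false ∷ d) f g = trans (cong₂ _+_ (↑∑-+ d (f ∘ (true ∷_)) (g ∘ (true ∷_))) (↑∑-+ d (f ∘ (false ∷_)) (g ∘ (false ∷_))))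
  (+-interchange (↑∑ d (f ∘ (true ∷_))) _ _ _)

↑∑-* : ∀ d c f → ↑∑ d (λ e → c * f e) ≡ c * ↑∑ d f
↑∑-* [] c f = refl
↑∑-* (true ∷ d) c f = ↑∑-* d c (f ∘ (true ∷_))
↑∑-* (false ∷ d) c f = trans (cong₂ _+_ (↑∑-* d c (f ∘ (true ∷_))) (↑∑-* d c (f ∘ (false ∷_)))) (sym (*-distribˡ-+ c _ _))

↑∑-∑ : ∀ d (xs : List A) (f : A → Word → ℚ) → ↑∑ d (λ e → ∑ xs (λ x → f x e)) ≡ ∑ xs (λ x → ↑∑ d (f x))
↑∑-∑ [] xs f = refl
↑∑-∑ (true ∷ d) xs f = ↑∑-∑ d xs (λ x → f x ∘ (true ∷_))
↑∑-∑ (false ∷ d) xs f = trans (cong₂ _+_ (↑∑-∑ d xs (λ x → f x ∘ (true ∷_))) (↑∑-∑ d xs (λ x → f x ∘ (false ∷_))))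
  (sym (∑-+ xs (λ x → ↑∑ d (f x ∘ (true ∷_))) (λ x → ↑∑ d (f x ∘ (false ∷_)))))

-- Multiplication by M_(1)

-- The patterns obtained by inserting a new maximum into a permutation with pattern d, in front or later.
laterInsertions insertions : Word → List Word
laterInsertions [] = (false ∷ []) ∷ []
laterInsertions (b ∷ d) = (false ∷ true ∷ d) ∷ map (b ∷_) (laterInsertions d)
insertions d = (true ∷ d) ∷ laterInsertions d

-- The terms M_δ of M_e M_(1), apart from the one in which the new part 1 comes first.
laterStuffles stuffles : Word → List Word
laterStuffles [] = (true ∷ []) ∷ (false ∷ []) ∷ []
laterStuffles (true ∷ e) = (false ∷ true ∷ e) ∷ (true ∷ true ∷ e) ∷ map (true ∷_) (laterStuffles e)
laterStuffles (false ∷ e) = map (false ∷_) (laterStuffles e)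
stuffles e = (true ∷ e) ∷ laterStuffles e

private
  -- `laterStuffles` on the level of compositions: the old first part stays first, possibly merged
  -- with the new part 1.
  afterFirst : (List ℕ → ℚ) → List ℕ → ℚ
  afterFirst g [] = 0ℚ
  afterFirst g (a ∷ as) = ∑ (stuffle as (1 ∷ [])) (g ∘ (a ∷_)) + g ((a ℕ.+ 1) ∷ as)

  stuffle-afterFirst : ∀ g a as →
    ∑ (stuffle (a ∷ as) (1 ∷ [])) g ≡ g (1 ∷ a ∷ as) + afterFirst g (a ∷ as)
  stuffle-afterFirst g a as = begin
    ∑ (stuffle (a ∷ as) (1 ∷ [])) g
      ≡⟨ ∑-++ (map (a ∷_) (stuffle as (1 ∷ []))) _ g ⟩
    ∑ (map (a ∷_) (stuffle as (1 ∷ []))) g + (g (1 ∷ a ∷ as) + ∑ (map ((a ℕ.+ 1) ∷_) (stuffle as [])) g)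
      ≡⟨ cong₂ (λ p q → p + (g (1 ∷ a ∷ as) + q)) (∑-map (a ∷_) (stuffle as (1 ∷ [])) g) (last as) ⟩
    ∑ (stuffle as (1 ∷ [])) (g ∘ (a ∷_)) + (g (1 ∷ a ∷ as) + g ((a ℕ.+ 1) ∷ as))
      ≡⟨ lemma (∑ (stuffle as (1 ∷ [])) (g ∘ (a ∷_))) (g (1 ∷ a ∷ as)) (g ((a ℕ.+ 1) ∷ as)) ⟩
    g (1 ∷ a ∷ as) + afterFirst g (a ∷ as) ∎
    where
    open ≡-Reasoning
    last : ∀ as → ∑ (map ((a ℕ.+ 1) ∷_) (stuffle as [])) g ≡ g ((a ℕ.+ 1) ∷ as)
    last [] = +-identityʳ _
    last (_ ∷ _) = +-identityʳ _
    lemma : ∀ p q r → p + (q + r) ≡ q + (p + r)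
    lemma = let open +-*-Solver in solve 3 (λ p q r → p :+ (q :+ r) := q :+ (p :+ r)) refl

  stuffle-comp-afterFirst : ∀ g e →
    ∑ (stuffle (comp e) (1 ∷ [])) g ≡ g (comp (true ∷ e)) + afterFirst g (comp e)
  stuffle-comp-afterFirst g e with comp e | comp-nonempty e
  ... | _ | a , as , refl = stuffle-afterFirst g (suc a) as

  -- The old first part stays first in all these terms, so enlarging it commutes with the
  -- multiplication.
  afterFirst-bump : ∀ g e → afterFirst g (bump (comp e)) ≡ afterFirst (g ∘ bump) (comp e)
  afterFirst-bump g e with comp e | comp-nonempty e
  ... | _ | a , as , refl = refl

  afterFirst-comp : ∀ g e → afterFirst g (comp e) ≡ ∑ (laterStuffles e) (g ∘ comp)
  afterFirst-comp g [] =
    trans (+-assoc (g (1 ∷ 1 ∷ [])) 0ℚ (g (2 ∷ []))) (cong (g (1 ∷ 1 ∷ []) +_) (+-comm 0ℚ (g (2 ∷ []))))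
  afterFirst-comp g (true ∷ e) = begin
    ∑ (stuffle (comp e) (1 ∷ [])) (g ∘ (1 ∷_)) + g (2 ∷ comp e)
      ≡⟨ +-comm _ (g (2 ∷ comp e)) ⟩
    g (2 ∷ comp e) + ∑ (stuffle (comp e) (1 ∷ [])) (g ∘ (1 ∷_))
      ≡⟨ cong (g (2 ∷ comp e) +_) (stuffle-comp-afterFirst (g ∘ (1 ∷_)) e) ⟩
    g (2 ∷ comp e) + (g (1 ∷ 1 ∷ comp e) + afterFirst (g ∘ (1 ∷_)) (comp e))
      ≡⟨ cong (λ q → g (2 ∷ comp e) + (g (1 ∷ 1 ∷ comp e) + q)) (trans (afterFirst-comp (g ∘ (1 ∷_)) e)
           (sym (∑-map (true ∷_) (laterStuffles e) (g ∘ comp)))) ⟩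
    ∑ (laterStuffles (true ∷ e)) (g ∘ comp) ∎
    where open ≡-Reasoning
  afterFirst-comp g (false ∷ e) = trans (afterFirst-bump g e) (trans (afterFirst-comp (g ∘ bump) e)
    (sym (∑-map (false ∷_) (laterStuffles e) (g ∘ comp))))

stuffle-comp : ∀ g e → ∑ (stuffle (comp e) (1 ∷ [])) g ≡ ∑ (stuffles e) (g ∘ comp)
stuffle-comp g e = trans (stuffle-comp-afterFirst g e) (cong (g (comp (true ∷ e)) +_) (afterFirst-comp g e))

private
  -- Words beginning with `true` lie above both `true ∷ d` and `false ∷ d`, so this computation is
  -- shared by both cases of the induction that follows.
  ↑∑-laterInsertions-true : ∀ d g →
    ∑ (laterInsertions d) (λ w → ↑∑ w (g ∘ (true ∷_))) ≡ ↑∑ d (λ e → ∑ (laterStuffles e) (g ∘ (true ∷_))) →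
    ↑∑ (false ∷ true ∷ d) g + ∑ (laterInsertions d) (λ w → ↑∑ w (g ∘ (true ∷_)))
      ≡ ↑∑ (true ∷ d) (λ e → ∑ (laterStuffles e) g)
  ↑∑-laterInsertions-true d g ih = begin
    (tt + ft) + ∑ (laterInsertions d) (λ w → ↑∑ w (g ∘ (true ∷_)))
      ≡⟨ cong ((tt + ft) +_) ih ⟩
    (tt + ft) + ↑∑ d (λ e → ∑ (laterStuffles e) (g ∘ (true ∷_)))
      ≡⟨ lemma tt ft _ ⟩
    ft + (tt + ↑∑ d (λ e → ∑ (laterStuffles e) (g ∘ (true ∷_))))
      ≡⟨ cong (λ q → ft + (tt + q)) (↑∑-cong d (λ e _ → sym (∑-map (true ∷_) (laterStuffles e) g))) ⟩
    ft + (tt + ↑∑ d (λ e → ∑ (map (true ∷_) (laterStuffles e)) g))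
      ≡⟨ cong (ft +_) (sym (↑∑-+ d _ _)) ⟩
    ft + ↑∑ d (λ e → g (true ∷ true ∷ e) + ∑ (map (true ∷_) (laterStuffles e)) g)
      ≡⟨ sym (↑∑-+ d _ _) ⟩
    ↑∑ (true ∷ d) (λ e → ∑ (laterStuffles e) g) ∎
    where
    open ≡-Reasoning
    tt = ↑∑ d (λ e → g (true ∷ true ∷ e))
    ft = ↑∑ d (λ e → g (false ∷ true ∷ e))
    lemma : ∀ p q r → (p + q) + r ≡ q + (p + r)
    lemma = let open +-*-Solver in solve 3 (λ p q r → (p :+ q) :+ r := q :+ (p :+ r)) refl

-- The product rule for F_d M_(1) with the front insertions removed. The removed terms agree
-- outright, both being the sum of g over `true ∷ e` with e above d; what is left can be handled one
-- letter at a time.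
↑∑-laterInsertions : ∀ d g → ∑ (laterInsertions d) (λ w → ↑∑ w g) ≡ ↑∑ d (λ e → ∑ (laterStuffles e) g)
↑∑-laterInsertions [] g = +-assoc (g (true ∷ [])) (g (false ∷ [])) 0ℚ
↑∑-laterInsertions (true ∷ d) g = trans
  (cong (↑∑ (false ∷ true ∷ d) g +_) (∑-map (true ∷_) (laterInsertions d) (λ w → ↑∑ w g)))
  (↑∑-laterInsertions-true d g (↑∑-laterInsertions d (g ∘ (true ∷_))))
↑∑-laterInsertions (false ∷ d) g = begin
  ft + ∑ (map (false ∷_) (laterInsertions d)) (λ w → ↑∑ w g)
    ≡⟨ cong (ft +_) (∑-map (false ∷_) (laterInsertions d) (λ w → ↑∑ w g)) ⟩
  ft + ∑ (laterInsertions d) (λ w → ↑∑ w (g ∘ (true ∷_)) + ↑∑ w (g ∘ (false ∷_)))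
    ≡⟨ cong (ft +_) (∑-+ (laterInsertions d) (λ w → ↑∑ w (g ∘ (true ∷_))) (λ w → ↑∑ w (g ∘ (false ∷_)))) ⟩
  ft + (∑ (laterInsertions d) (λ w → ↑∑ w (g ∘ (true ∷_))) + ∑ (laterInsertions d) (λ w → ↑∑ w (g ∘ (false ∷_))))
    ≡⟨ sym (+-assoc ft _ _) ⟩
  (ft + ∑ (laterInsertions d) (λ w → ↑∑ w (g ∘ (true ∷_)))) + ∑ (laterInsertions d) (λ w → ↑∑ w (g ∘ (false ∷_)))
    ≡⟨ cong₂ _+_
         (↑∑-laterInsertions-true d g (↑∑-laterInsertions d (g ∘ (true ∷_))))
         (trans (↑∑-laterInsertions d (g ∘ (false ∷_)))
                (↑∑-cong d (λ e _ → sym (∑-map (false ∷_) (laterStuffles e) g)))) ⟩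
  ↑∑ (false ∷ d) (λ e → ∑ (laterStuffles e) g) ∎
  where
  open ≡-Reasoning
  ft = ↑∑ (false ∷ true ∷ d) g

-- F_d M_(1) is the sum of the F_w over the insertions w of d.
↑∑-insertions : ∀ d (g : List ℕ → ℚ) →
  ∑ (insertions d) (λ w → ↑∑ w (g ∘ comp)) ≡ ↑∑ d (λ e → ∑ (stuffle (comp e) (1 ∷ [])) g)
↑∑-insertions d g = trans (cong (↑∑ d _ +_) (↑∑-laterInsertions d (g ∘ comp)))
  (trans (sym (↑∑-+ d _ _)) (↑∑-cong d (λ e _ → sym (stuffle-comp g e))))

-- A maximum placed between x and y replaces the letter of that step by an ascent followed by a
-- descent, whatever the letter was.
pattern-laterInsertions : ∀ M x r → All (ℕ._< M) (x ∷ r) →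
  map pattern-of (map (x ∷_) (insertAll M r)) ≡ laterInsertions (pattern-of (x ∷ r))
pattern-laterInsertions M x [] (x<M ∷ []) with M <ᵇ x in eq
... | false = refl
... | true = contradiction (ℕ.<ᵇ⇒< M x (subst T (sym eq) _)) (ℕ.<-asym x<M)
pattern-laterInsertions M x (y ∷ r) (x<M ∷ y<M ∷ r<M) with M <ᵇ x in eq | y <ᵇ M in eq′
... | true | _ = contradiction (ℕ.<ᵇ⇒< M x (subst T (sym eq) _)) (ℕ.<-asym x<M)
... | false | false = contradiction (subst T eq′ (ℕ.<⇒<ᵇ y<M)) (λ ())
... | false | true = cong₂ _∷_ refl (begin
  map pattern-of (map (x ∷_) (map (y ∷_) (insertAll M r)))
    ≡⟨ cong (map pattern-of) (sym (map-∘ (insertAll M r))) ⟩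
  map pattern-of (map (λ s → x ∷ y ∷ s) (insertAll M r))
    ≡⟨ sym (map-∘ (insertAll M r)) ⟩
  map (λ s → (y <ᵇ x) ∷ pattern-of (y ∷ s)) (insertAll M r)
    ≡⟨ map-∘ (insertAll M r) ⟩
  map ((y <ᵇ x) ∷_) (map (λ s → pattern-of (y ∷ s)) (insertAll M r))
    ≡⟨ cong (map ((y <ᵇ x) ∷_)) (map-∘ (insertAll M r)) ⟩
  map ((y <ᵇ x) ∷_) (map pattern-of (map (y ∷_) (insertAll M r)))
    ≡⟨ cong (map ((y <ᵇ x) ∷_)) (pattern-laterInsertions M y r (y<M ∷ r<M)) ⟩
  map ((y <ᵇ x) ∷_) (laterInsertions (pattern-of (y ∷ r))) ∎)
  where open ≡-Reasoning

pattern-insertAll : ∀ M x r → All (ℕ._< M) (x ∷ r) →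
  map pattern-of (insertAll M (x ∷ r)) ≡ insertions (pattern-of (x ∷ r))
pattern-insertAll M x r x<M@(p ∷ _) with x <ᵇ M in eq
... | true = cong ((true ∷ pattern-of (x ∷ r)) ∷_) (pattern-laterInsertions M x r x<M)
... | false = contradiction (subst T eq (ℕ.<⇒<ᵇ p)) (λ ())

-- Consequences of multiplicativity

-- Division normalises its result, so the identity is checked among unnormalised fractions.
ι-suc : ∀ n → ι (suc n) ≡ 1ℚ + ι n
ι-suc n = toℚᵘ-injective (begin
  toℚᵘ (ι (suc n))                  ≈⟨ toℚᵘ-fromℚᵘ (mkℚᵘ (ℤ.+ suc n) 0) ⟩
  mkℚᵘ (ℤ.+ suc n) 0                ≈⟨ *≡* (cong (λ i → (ℤ.1ℤ ℤ.+ i) ℤ.* ℤ.1ℤ) (sym (ℤ.*-identityʳ (ℤ.+ n)))) ⟩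
  ℚᵘ.1ℚᵘ ℚᵘ.+ mkℚᵘ (ℤ.+ n) 0        ≈⟨ ℚᵘ.+-congʳ ℚᵘ.1ℚᵘ (ℚᵘ.≃-sym (toℚᵘ-fromℚᵘ (mkℚᵘ (ℤ.+ n) 0))) ⟩
  toℚᵘ 1ℚ ℚᵘ.+ toℚᵘ (ι n)           ≈⟨ ℚᵘ.≃-sym (toℚᵘ-homo-+ 1ℚ (ι n)) ⟩
  toℚᵘ (1ℚ + ι n)                   ∎)
  where
  open ℚᵘ.≃-Reasoning

kron : List ℕ → List ℕ → ℚ
kron γ α = if eqList γ α then 1ℚ else 0ℚ

ι-count : ∀ γ l → ι (count γ l) ≡ ∑ l (kron γ)
ι-count γ [] = refl
ι-count γ (α ∷ l) with eqList γ α
... | true = trans (ι-suc (count γ l)) (cong (1ℚ +_) (ι-count γ l))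
... | false = trans (ι-count γ l) (sym (+-identityˡ _))

≡ᵇ⇒≡ : ∀ m n → (m ≡ᵇ n) ≡ true → m ≡ n
≡ᵇ⇒≡ m n eq = ℕ.≡ᵇ⇒≡ m n (subst T (sym eq) _)

eqList⇒≡ : ∀ α β → eqList α β ≡ true → α ≡ β
eqList⇒≡ [] [] eq = refl
eqList⇒≡ (a ∷ α) (b ∷ β) eq with a ≡ᵇ b in p
... | true = cong₂ _∷_ (≡ᵇ⇒≡ a b p) (eqList⇒≡ α β eq)

eqList-refl : ∀ α → eqList α α ≡ true
eqList-refl [] = refl
eqList-refl (a ∷ α) rewrite ≡ᵇ-refl a = eqList-refl α

wordKron : Word → Word → ℚ
wordKron [] [] = 1ℚ
wordKron (true ∷ d) (true ∷ e) = wordKron d e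
wordKron (false ∷ d) (false ∷ e) = wordKron d e
wordKron _ _ = 0ℚ

wordKron-refl : ∀ d → wordKron d d ≡ 1ℚ
wordKron-refl [] = refl
wordKron-refl (true ∷ d) = wordKron-refl d
wordKron-refl (false ∷ d) = wordKron-refl d

wordKron-≢ : ∀ d e → d ≢ e → wordKron d e ≡ 0ℚ
wordKron-≢ [] [] ne = contradiction refl ne
wordKron-≢ [] (_ ∷ e) ne = refl
wordKron-≢ (true ∷ d) [] ne = refl
wordKron-≢ (false ∷ d) [] ne = refl
wordKron-≢ (true ∷ d) (true ∷ e) ne = wordKron-≢ d e (ne ∘ cong (true ∷_))
wordKron-≢ (true ∷ d) (false ∷ e) ne = refl
wordKron-≢ (false ∷ d) (true ∷ e) ne = refl
wordKron-≢ (false ∷ d) (false ∷ e) ne = wordKron-≢ d e (ne ∘ cong (false ∷_))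

kron-comp : ∀ d e → kron (comp d) (comp e) ≡ wordKron d e
kron-comp d e with ≡-dec Bool._≟_ d e
... | yes refl rewrite eqList-refl (comp d) = sym (wordKron-refl d)
... | no d≢e with eqList (comp d) (comp e) in eq
...   | true = contradiction (comp-injective d e (eqList⇒≡ _ _ eq)) d≢e
...   | false = sym (wordKron-≢ d e d≢e)

∑-wordKronˡ : ∀ d (h : Word → ℚ) → ∑ (words (length d)) (λ e → h e * wordKron d e) ≡ h d
∑-wordKronˡ [] h = trans (+-identityʳ _) (*-identityʳ _)
∑-wordKronˡ (true ∷ d) h = trans (∑-words (length d) (λ e → h e * wordKron (true ∷ d) e)) (trans
  (cong₂ _+_ (∑-wordKronˡ d (h ∘ (true ∷_))) (∑-zero (words (length d)) (λ e _ → *-zeroʳ (h (false ∷ e)))))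
  (+-identityʳ _))
∑-wordKronˡ (false ∷ d) h = trans (∑-words (length d) (λ e → h e * wordKron (false ∷ d) e)) (trans
  (cong₂ _+_ (∑-zero (words (length d)) (λ e _ → *-zeroʳ (h (true ∷ e)))) (∑-wordKronˡ d (h ∘ (false ∷_))))
  (+-identityˡ _))

wordKron-sym : ∀ d e → wordKron d e ≡ wordKron e d
wordKron-sym d e with ≡-dec Bool._≟_ d e
... | yes refl = refl
... | no d≢e = trans (wordKron-≢ d e d≢e) (sym (wordKron-≢ e d (d≢e ∘ sym)))

∑-wordKronʳ : ∀ d (h : Word → ℚ) → ∑ (words (length d)) (λ e → h e * wordKron e d) ≡ h d
∑-wordKronʳ d h = trans (∑-ext (words (length d)) (λ e → cong (h e *_) (wordKron-sym e d))) (∑-wordKronˡ d h)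

↓∑-0 : ∀ d → ↓∑ d (λ _ → 0ℚ) ≡ 0ℚ
↓∑-0 [] = refl
↓∑-0 (true ∷ d) = cong₂ _+_ (↓∑-0 d) (↓∑-0 d)
↓∑-0 (false ∷ d) = ↓∑-0 d

↑∑-0 : ∀ d → ↑∑ d (λ _ → 0ℚ) ≡ 0ℚ
↑∑-0 [] = refl
↑∑-0 (true ∷ d) = ↑∑-0 d
↑∑-0 (false ∷ d) = cong₂ _+_ (↑∑-0 d) (↑∑-0 d)

-- Both sides are the indicator of `p ⊑ d`.
↓∑-wordKron : ∀ d p → length d ≡ length p → ↓∑ d (λ e → wordKron e p) ≡ ↑∑ p (wordKron d)
↓∑-wordKron [] [] eq = refl
↓∑-wordKron (true ∷ d) (true ∷ p) eq =
  trans (cong₂ _+_ (↓∑-wordKron d p (ℕ.suc-injective eq)) (↓∑-0 d)) (+-identityʳ _)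
↓∑-wordKron (true ∷ d) (false ∷ p) eq = trans (cong₂ _+_ (↓∑-0 d) (↓∑-wordKron d p (ℕ.suc-injective eq)))
  (trans (+-identityˡ (↑∑ p (wordKron d))) (sym (trans (cong (↑∑ p (wordKron d) +_) (↑∑-0 p)) (+-identityʳ (↑∑ p (wordKron d))))))
↓∑-wordKron (false ∷ d) (true ∷ p) eq = trans (↓∑-0 d) (sym (↑∑-0 p))
↓∑-wordKron (false ∷ d) (false ∷ p) eq = trans (↓∑-wordKron d p (ℕ.suc-injective eq))
  (sym (trans (cong (_+ ↑∑ p (wordKron d)) (↑∑-0 p)) (+-identityˡ _)))

-- Möbius inversion: the sum below `true ∷ d` minus the sum below `false ∷ d` involves only words
-- beginning with `true`.
↓∑-injective : ∀ m (f g : Word → ℚ) → (∀ d → length d ≡ m → ↓∑ d f ≡ ↓∑ d g) →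
  ∀ e → length e ≡ m → f e ≡ g e
↓∑-injective zero f g eq [] l = eq [] refl
↓∑-injective (suc m) f g eq (false ∷ e) l =
  ↓∑-injective m (f ∘ (false ∷_)) (g ∘ (false ∷_)) (λ d l → eq (false ∷ d) (cong suc l)) e (ℕ.suc-injective l)
↓∑-injective (suc m) f g eq (true ∷ e) l =
  ↓∑-injective m (f ∘ (true ∷_)) (g ∘ (true ∷_))
    (λ d l → +-cancelʳ (↓∑ d (f ∘ (false ∷_))) _ _
      (trans (eq (true ∷ d) (cong suc l)) (cong (↓∑ d (g ∘ (true ∷_)) +_) (sym (eq (false ∷ d) (cong suc l))))))
    e (ℕ.suc-injective l)

↓∑-cong : ∀ d {f g : Word → ℚ} → (∀ e → length e ≡ length d → f e ≡ g e) → ↓∑ d f ≡ ↓∑ d g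
↓∑-cong [] eq = eq [] refl
↓∑-cong (true ∷ d) eq =
  cong₂ _+_ (↓∑-cong d (λ e l → eq (true ∷ e) (cong suc l))) (↓∑-cong d (λ e l → eq (false ∷ e) (cong suc l)))
↓∑-cong (false ∷ d) eq = ↓∑-cong d (λ e l → eq (false ∷ e) (cong suc l))

↓∑-∑ : ∀ {A : Set} d (xs : List A) (f : A → Word → ℚ) → ↓∑ d (λ e → ∑ xs (λ x → f x e)) ≡ ∑ xs (λ x → ↓∑ d (f x))
↓∑-∑ [] xs f = refl
↓∑-∑ (false ∷ d) xs f = ↓∑-∑ d xs (λ x → f x ∘ (false ∷_))
↓∑-∑ (true ∷ d) xs f = trans (cong₂ _+_ (↓∑-∑ d xs (λ x → f x ∘ (true ∷_))) (↓∑-∑ d xs (λ x → f x ∘ (false ∷_))))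
  (sym (∑-+ xs (λ x → ↓∑ d (f x ∘ (true ∷_))) (λ x → ↓∑ d (f x ∘ (false ∷_)))))

↓∑-* : ∀ d c f → ↓∑ d (λ e → c * f e) ≡ c * ↓∑ d f
↓∑-* [] c f = refl
↓∑-* (false ∷ d) c f = ↓∑-* d c (f ∘ (false ∷_))
↓∑-* (true ∷ d) c f = trans (cong₂ _+_ (↓∑-* d c (f ∘ (true ∷_))) (↓∑-* d c (f ∘ (false ∷_)))) (sym (*-distribˡ-+ c _ _))

length-laterInsertions : ∀ d {w} → w ∈ laterInsertions d → length w ≡ suc (length d)
length-laterInsertions [] (here refl) = refl
length-laterInsertions (b ∷ d) (here refl) = refl
length-laterInsertions (b ∷ d) (there w∈) with w , w∈ , refl ← ∈-map⁻ (b ∷_) w∈ = cong suc (length-laterInsertions d w∈)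

length-insertions : ∀ d {w} → w ∈ insertions d → length w ≡ suc (length d)
length-insertions d (here refl) = refl
length-insertions d (there w∈) = length-laterInsertions d w∈

flat : Word → ℚ
flat [] = 1ℚ
flat (true ∷ e) = 0ℚ
flat (false ∷ e) = flat e

wordKron-flat : ∀ m e → length e ≡ m → wordKron (replicate m false) e ≡ flat e
wordKron-flat zero [] l = refl
wordKron-flat (suc m) (true ∷ e) l = refl
wordKron-flat (suc m) (false ∷ e) l = wordKron-flat m e (ℕ.suc-injective l)

-- `flat` is the indicator of the one-part compositions. A one-part term of M_e M_(1) can only come
-- from merging the new part with the sole part of e.
∑-laterStuffles-flat : ∀ e → ∑ (laterStuffles e) flat ≡ flat e
∑-laterStuffles-flat [] = refl
∑-laterStuffles-flat (true ∷ e) = trans (+-identityˡ _) (trans (+-identityˡ _) (trans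
  (∑-map (true ∷_) (laterStuffles e) flat) (∑-0 (laterStuffles e))))
∑-laterStuffles-flat (false ∷ e) = trans (∑-map (false ∷_) (laterStuffles e) flat) (∑-laterStuffles-flat e)

length-laterStuffles : ∀ e {w} → w ∈ laterStuffles e → length w ≡ suc (length e)
length-laterStuffles [] (here refl) = refl
length-laterStuffles [] (there (here refl)) = refl
length-laterStuffles (true ∷ e) (here refl) = refl
length-laterStuffles (true ∷ e) (there (here refl)) = refl
length-laterStuffles (true ∷ e) (there (there w∈))
  with w , w∈ , refl ← ∈-map⁻ (true ∷_) w∈ = cong suc (length-laterStuffles e w∈)
length-laterStuffles (false ∷ e) w∈
  with w , w∈ , refl ← ∈-map⁻ (false ∷_) w∈ = cong suc (length-laterStuffles e w∈)

-- The list of permutations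

upTo-suc-↭ : ∀ n → upTo (suc n) ↭ n ∷ upTo n
upTo-suc-↭ n = ↭-trans (↭-reflexive (sym (applyUpTo-∷ʳ (λ i → i) n))) (↭-sym (∷↭∷ʳ n (upTo n)))

insertAll-↭ : ∀ x ys {zs} → zs ∈ insertAll x ys → zs ↭ x ∷ ys
insertAll-↭ x [] (here refl) = _↭_.refl
insertAll-↭ x (y ∷ ys) (here refl) = _↭_.refl
insertAll-↭ x (y ∷ ys) (there zs∈) with zs , zs∈ , refl ← ∈-map⁻ (y ∷_) zs∈ =
  ↭-trans (_↭_.prep y (insertAll-↭ x ys zs∈)) (_↭_.swap y x _↭_.refl)

perms-↭ : ∀ n {σ} → σ ∈ perms n → σ ↭ upTo n
perms-↭ zero (here refl) = _↭_.refl
perms-↭ (suc n) {σ} σ∈ = go (perms n) (λ _ → perms-↭ n) (∈-concatMap⁻ (insertAll n) σ∈)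
  where
  go : ∀ ps → (∀ τ → τ ∈ ps → τ ↭ upTo n) → Any.Any (λ τ → σ ∈ insertAll n τ) ps → σ ↭ upTo (suc n)
  go (τ ∷ ps) h (here p) = ↭-trans (insertAll-↭ n τ p) (↭-trans (_↭_.prep n (h τ (here refl))) (↭-sym (upTo-suc-↭ n)))
  go (τ ∷ ps) h (there p) = go ps (λ ρ ρ∈ → h ρ (there ρ∈)) p

perms-length : ∀ n {σ} → σ ∈ perms n → length σ ≡ n
perms-length n σ∈ = trans (↭-length (perms-↭ n σ∈)) (length-upTo n)

perms-All< : ∀ n {σ} → σ ∈ perms n → All (ℕ._< n) σ
perms-All< n σ∈ = All-resp-↭ (↭-sym (perms-↭ n σ∈)) (All.tabulate ∈-upTo⁻)

perms-pattern-length : ∀ m {σ} → σ ∈ perms (suc m) → length (pattern-of σ) ≡ m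
perms-pattern-length m {σ} σ∈ with σ | perms-length (suc m) σ∈
... | x ∷ r | l = trans (length-pattern x r) (ℕ.suc-injective l)

perms-D : ∀ m {σ} → σ ∈ perms (suc m) → D σ ≡ comp (pattern-of σ)
perms-D m {σ} σ∈ with σ | perms-length (suc m) σ∈
... | x ∷ r | l = D≡comp-pattern x r

∑-insertAll : ∀ m {σ} → σ ∈ perms (suc m) → ∀ (h : Word → ℚ) →
  ∑ (insertAll (suc m) σ) (h ∘ pattern-of) ≡ ∑ (insertions (pattern-of σ)) h
∑-insertAll m {σ} σ∈ h with σ | perms-length (suc m) σ∈ | perms-All< (suc m) σ∈
... | x ∷ r | l | lt = trans (sym (∑-map pattern-of (insertAll (suc m) (x ∷ r)) h))
  (cong (λ ws → ∑ ws h) (pattern-insertAll (suc m) x r lt))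

-- M_(1)^n is the sum of F_{D(σ)} over all σ, so this is the value of the linear functional M_e ↦ g e at M_(1)^n.
patternSum : ℕ → (Word → ℚ) → ℚ
patternSum n g = ∑ (perms n) (λ σ → ↑∑ (pattern-of σ) g)

patternSum-suc : ∀ m (g : List ℕ → ℚ) →
  patternSum (suc (suc m)) (g ∘ comp) ≡ patternSum (suc m) (λ e → ∑ (stuffle (comp e) (1 ∷ [])) g)
patternSum-suc m g = trans (∑-concatMap (insertAll (suc m)) (perms (suc m)) (λ σ → ↑∑ (pattern-of σ) (g ∘ comp)))
  (∑-cong (perms (suc m)) (λ σ σ∈ → trans (∑-insertAll m σ∈ (λ w → ↑∑ w (g ∘ comp))) (↑∑-insertions (pattern-of σ) g)))

module _ {φ : List ℕ → List ℕ → ℚ} (Φ : IsHopfEndo φ) where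
  open IsHopfEndo Φ

  -- Multiplicativity with second factor M_(1): in degree 1 the map Φ is the scalar λ, and the
  -- multiplicities `count` become sums of indicators.
  mult-one : ∀ m e γ → length e ≡ m → γ ∈ comps (suc (suc m)) →
    ∑ (stuffle (comp e) (1 ∷ [])) (λ δ → φ δ γ)
      ≡ lam φ * ∑ (words m) (λ e′ → φ (comp e) (comp e′) * ∑ (stuffle (comp e′) (1 ∷ [])) (kron γ))
  mult-one m e γ refl γ∈ = begin
    ∑ (stuffle (comp e) (1 ∷ [])) (λ δ → φ δ γ)
      ≡⟨ mult (suc m) 1 (comp e) (1 ∷ []) γ (comp∈comps e) (here refl)
           (subst (λ k → γ ∈ comps (suc k)) (sym (ℕ.+-comm m 1)) γ∈) ⟩
    ∑ (comps (suc m)) (λ α → φ (comp e) α * lam φ * ι (count γ (stuffle α (1 ∷ []))) + 0ℚ)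
      ≡⟨ ∑-ext (comps (suc m)) (λ α → trans (+-identityʳ _) (trans
           (lemma (φ (comp e) α) (lam φ) _) (cong (λ q → lam φ * (φ (comp e) α * q)) (ι-count γ (stuffle α (1 ∷ [])))))) ⟩
    ∑ (comps (suc m)) (λ α → lam φ * (φ (comp e) α * ∑ (stuffle α (1 ∷ [])) (kron γ)))
      ≡⟨ ∑-*ˡ (comps (suc m)) (lam φ) _ ⟩
    lam φ * ∑ (comps (suc m)) (λ α → φ (comp e) α * ∑ (stuffle α (1 ∷ [])) (kron γ))
      ≡⟨ cong (lam φ *_) (∑-comps m (λ α → φ (comp e) α * ∑ (stuffle α (1 ∷ [])) (kron γ))) ⟩
    lam φ * ∑ (words m) (λ e′ → φ (comp e) (comp e′) * ∑ (stuffle (comp e′) (1 ∷ [])) (kron γ)) ∎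
    where
    open ≡-Reasoning
    lemma : ∀ p q r → p * q * r ≡ q * (p * r)
    lemma = let open +-*-Solver in solve 3 (λ p q r → p :* q :* r := q :* (p :* r)) refl

  -- The coefficient of M_γ in Φ(M_(1)^n) = λ^n M_(1)^n; the induction splits off one factor M_(1)
  -- at a time.
  patternSum-eigen : ∀ m γ → γ ∈ comps (suc m) →
    patternSum (suc m) (λ e → φ (comp e) γ) ≡ (lam φ ^ℚ suc m) * patternSum (suc m) (kron γ ∘ comp)
  patternSum-eigen zero γ (here refl) = lemma (lam φ)
    where
    lemma : ∀ x → x + 0ℚ ≡ x * 1ℚ * (1ℚ + 0ℚ)
    lemma = let open +-*-Solver in solve 1 (λ x → x :+ con 0ℚ := x :* con 1ℚ :* (con 1ℚ :+ con 0ℚ)) refl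
  patternSum-eigen (suc m) γ γ∈ = begin
    patternSum (suc (suc m)) (λ e → φ (comp e) γ)
      ≡⟨ patternSum-suc m (λ α → φ α γ) ⟩
    patternSum (suc m) (λ e → ∑ (stuffle (comp e) (1 ∷ [])) (λ δ → φ δ γ))
      ≡⟨ ∑-cong (perms (suc m)) (λ σ σ∈ → trans
           (↑∑-cong (pattern-of σ) (λ e l → trans (mult-one m e γ (trans l (perms-pattern-length m σ∈)) γ∈)
             (cong (lam φ *_) (∑-ext (words m) (λ e′ → *-comm (φ (comp e) (comp e′)) _)))))
           (trans (↑∑-* (pattern-of σ) (lam φ) _) (cong (lam φ *_)
             (trans (↑∑-∑ (pattern-of σ) (words m) (λ e′ e → N e′ * φ (comp e) (comp e′)))
               (∑-ext (words m) (λ e′ → ↑∑-* (pattern-of σ) (N e′) _)))))) ⟩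
    ∑ (perms (suc m)) (λ σ → lam φ * ∑ (words m) (λ e′ → N e′ * ↑∑ (pattern-of σ) (λ e → φ (comp e) (comp e′))))
      ≡⟨ trans (∑-*ˡ (perms (suc m)) (lam φ) _) (cong (lam φ *_) (trans (∑-swap (perms (suc m)) (words m) (λ σ e′ → N e′ * ↑∑ (pattern-of σ) (λ e → φ (comp e) (comp e′))))
           (∑-ext (words m) (λ e′ → ∑-*ˡ (perms (suc m)) (N e′) (λ σ → ↑∑ (pattern-of σ) (λ e → φ (comp e) (comp e′))))))) ⟩
    lam φ * ∑ (words m) (λ e′ → N e′ * patternSum (suc m) (λ e → φ (comp e) (comp e′)))
      ≡⟨ cong (lam φ *_) (∑-cong (words m) (λ e′ e′∈ → cong (N e′ *_) (trans
           (patternSum-eigen m (comp e′) (subst (λ k → comp e′ ∈ comps (suc k)) (words-length m e′∈) (comp∈comps e′)))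
           (cong (L *_) (∑-ext (perms (suc m)) (λ σ → ↑∑-cong (pattern-of σ) (λ e _ → kron-comp e′ e))))))) ⟩
    lam φ * ∑ (words m) (λ e′ → N e′ * (L * patternSum (suc m) (wordKron e′)))
      ≡⟨ cong (lam φ *_) (trans (∑-ext (words m) (λ e′ → lemma (N e′) L _)) (∑-*ˡ (words m) L _)) ⟩
    lam φ * (L * ∑ (words m) (λ e′ → N e′ * patternSum (suc m) (wordKron e′)))
      ≡⟨ sym (*-assoc (lam φ) L _) ⟩
    lam φ * L * ∑ (words m) (λ e′ → N e′ * patternSum (suc m) (wordKron e′))
      ≡⟨ cong (lam φ * L *_) (trans (trans
           (∑-ext (words m) (λ e′ → sym (∑-*ˡ (perms (suc m)) (N e′) (λ σ → ↑∑ (pattern-of σ) (wordKron e′)))))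
           (sym (∑-swap (perms (suc m)) (words m) (λ σ e′ → N e′ * ↑∑ (pattern-of σ) (wordKron e′)))))
           (∑-cong (perms (suc m)) collapse)) ⟩
    lam φ * L * patternSum (suc m) N
      ≡⟨ cong (lam φ * L *_) (sym (patternSum-suc m (kron γ))) ⟩
    lam φ * L * patternSum (suc (suc m)) (kron γ ∘ comp) ∎
    where
    open ≡-Reasoning
    L = lam φ ^ℚ suc m
    -- The coefficient of M_γ in M_e′ M_(1).
    N : Word → ℚ
    N e′ = ∑ (stuffle (comp e′) (1 ∷ [])) (kron γ)
    lemma : ∀ p q r → p * (q * r) ≡ q * (p * r)
    lemma = let open +-*-Solver in solve 3 (λ p q r → p :* (q :* r) := q :* (p :* r)) refl
    collapse : ∀ σ → σ ∈ perms (suc m) →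
      ∑ (words m) (λ e′ → N e′ * ↑∑ (pattern-of σ) (wordKron e′)) ≡ ↑∑ (pattern-of σ) N
    collapse σ σ∈ = trans (∑-ext (words m) (λ e′ → sym (↑∑-* (pattern-of σ) (N e′) _)))
      (trans (sym (↑∑-∑ (pattern-of σ) (words m) (λ e′ e → N e′ * wordKron e′ e)))
        (↑∑-cong (pattern-of σ) (λ e l → trans
          (cong (λ k → ∑ (words k) (λ e′ → N e′ * wordKron e′ e)) (sym (trans l (perms-pattern-length m σ∈))))
          (∑-wordKronʳ e N))))

  -- The character F_d ↦ coefficient of M_(n) in Φ(F_d).
  character : Word → ℚ
  character d = ↑∑ d (λ e → φ (comp e) (single (suc (length e))))

  -- Compare the coefficients of the one-part monomial in Φ(F_d M_(1)) = λ Φ(F_d) M_(1). On the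
  -- right only the one-part term of Φ(F_d) contributes to it, and exactly once.
  character-insertions : ∀ d → lam φ * character d ≡ ∑ (insertions d) character
  character-insertions d = sym (begin
    ∑ (insertions d) character
      ≡⟨ ∑-cong (insertions d) (λ w w∈ → ↑∑-cong w (λ e l →
           cong (λ k → φ (comp e) (single (suc k))) (trans l (length-insertions d w∈)))) ⟩
    ∑ (insertions d) (λ w → ↑∑ w (λ e → φ (comp e) γ))
      ≡⟨ ↑∑-insertions d (λ α → φ α γ) ⟩
    ↑∑ d (λ e → ∑ (stuffle (comp e) (1 ∷ [])) (λ δ → φ δ γ))
      ≡⟨ ↑∑-cong d (λ e l → trans (mult-one m e γ l γ∈) (cong (lam φ *_) (collapse e l))) ⟩
    ↑∑ d (λ e → lam φ * φ (comp e) (single (suc (length e))))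
      ≡⟨ ↑∑-* d (lam φ) _ ⟩
    lam φ * character d ∎)
    where
    open ≡-Reasoning
    m = length d
    flatWord = replicate (suc m) false
    γ = single (suc (suc m))
    γ∈ : γ ∈ comps (suc (suc m))
    γ∈ = subst (λ k → γ ∈ comps (suc k)) (length-replicate (suc m))
      (subst (_∈ comps (suc (length flatWord))) (comp-single (suc m)) (comp∈comps flatWord))
    kron-flat : ∀ w → length w ≡ suc m → kron γ (comp w) ≡ flat w
    kron-flat w l = trans (cong (λ α → kron α (comp w)) (sym (comp-single (suc m))))
      (trans (kron-comp flatWord w) (wordKron-flat (suc m) w l))
    collapse : ∀ e → length e ≡ m →
      ∑ (words m) (λ e′ → φ (comp e) (comp e′) * ∑ (stuffle (comp e′) (1 ∷ [])) (kron γ)) ≡ φ (comp e) (single (suc (length e)))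
    collapse e refl-l = begin
      ∑ (words m) (λ e′ → φ (comp e) (comp e′) * ∑ (stuffle (comp e′) (1 ∷ [])) (kron γ))
        ≡⟨ ∑-cong (words m) (λ e′ e′∈ → cong (φ (comp e) (comp e′) *_) (trans (stuffle-comp (kron γ) e′) (trans
             (cong₂ _+_ (kron-flat (true ∷ e′) (cong suc (words-length m e′∈)))
               (trans (∑-cong (laterStuffles e′) (λ w w∈ → kron-flat w (trans (length-laterStuffles e′ w∈) (cong suc (words-length m e′∈)))))
                 (∑-laterStuffles-flat e′)))
             (trans (+-identityˡ _) (sym (wordKron-flat m e′ (words-length m e′∈))))))) ⟩
      ∑ (words m) (λ e′ → φ (comp e) (comp e′) * wordKron (replicate m false) e′)
        ≡⟨ cong (λ k → ∑ (words k) (λ e′ → φ (comp e) (comp e′) * wordKron (replicate m false) e′)) (sym (length-replicate m)) ⟩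
      ∑ (words (length (replicate m false))) (λ e′ → φ (comp e) (comp e′) * wordKron (replicate m false) e′)
        ≡⟨ ∑-wordKronˡ (replicate m false) (λ e′ → φ (comp e) (comp e′)) ⟩
      φ (comp e) (comp (replicate m false))
        ≡⟨ cong (φ (comp e)) (trans (comp-single m) (cong (single ∘ suc) (sym refl-l))) ⟩
      φ (comp e) (single (suc (length e))) ∎

-- Bounds for the character

-- Words with a change of letter, the codes of the compositions other than (n) and (1^n). The
-- constructor `here` marks a valley (b = `true`) or a peak (b = `false`) of any permutation with
-- that pattern.
data Mixed : Word → Set where
  here : ∀ b d → Mixed (b ∷ not b ∷ d)
  there : ∀ b {d} → Mixed d → Mixed (b ∷ d)

constant-or-mixed : ∀ d → Σ Bool (λ b → d ≡ replicate (length d) b) ⊎ Mixed d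
constant-or-mixed [] = inj₁ (true , refl)
constant-or-mixed (b ∷ []) = inj₁ (b , refl)
constant-or-mixed (b ∷ d@(c ∷ r)) with constant-or-mixed d
... | inj₂ m = inj₂ (there b m)
constant-or-mixed (true ∷ true ∷ r) | inj₁ (true , eq) = inj₁ (true , cong (true ∷_) eq)
constant-or-mixed (false ∷ true ∷ r) | inj₁ (true , eq) = inj₂ (here false r)
constant-or-mixed (true ∷ false ∷ r) | inj₁ (false , eq) = inj₂ (here true r)
constant-or-mixed (false ∷ false ∷ r) | inj₁ (false , eq) = inj₁ (false , cong (false ∷_) eq)

private
  laterInsertion-exists : ∀ r → Σ Word λ d → false ∷ r ∈ laterInsertions d
  laterInsertion-exists [] = [] , here refl
  laterInsertion-exists (true ∷ r) = true ∷ r , here refl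
  laterInsertion-exists (false ∷ r) with d , w∈ ← laterInsertion-exists r = false ∷ d , there (∈-map⁺ (false ∷_) w∈)

  mixed-laterInsertion : ∀ r → Mixed (false ∷ r) → Σ Word λ d → Mixed (false ∷ d) × false ∷ r ∈ laterInsertions d
  mixed-laterInsertion [] (there _ ())
  mixed-laterInsertion (true ∷ r) _ = true ∷ r , here false r , here refl
  mixed-laterInsertion (false ∷ r) (there _ m) with d , m′ , w∈ ← mixed-laterInsertion r m =
    false ∷ d , there false m′ , there (∈-map⁺ (false ∷_) w∈)

-- A word is shortened by deleting the maximum of a suitable permutation with that pattern. The
-- maximum may sit at any peak, ends included, and the cases choose a peak whose removal leaves a
-- change of letter. From length 2 only one-letter words would remain.
mixed-insertion : ∀ w → Mixed w → 3 ℕ.≤ length w → Σ Word λ d → Mixed d × w ∈ insertions d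
mixed-insertion (true ∷ w) (there _ m) _ = w , m , here refl
mixed-insertion (true ∷ false ∷ true ∷ r) (here _ _) _ = false ∷ true ∷ r , here false r , here refl
mixed-insertion (true ∷ false ∷ false ∷ r) (here _ _) _ with d , w∈ ← laterInsertion-exists r =
  true ∷ false ∷ d , here true d , there (there (∈-map⁺ (true ∷_) (there (∈-map⁺ (false ∷_) w∈))))
mixed-insertion (false ∷ true ∷ true ∷ r) _ _ = false ∷ true ∷ r , here false r , there (here refl)
mixed-insertion (false ∷ true ∷ false ∷ r) _ _ = true ∷ false ∷ r , here true r , there (here refl)
mixed-insertion (false ∷ false ∷ r) (there _ m) _ with d , m′ , w∈ ← mixed-laterInsertion r m =
  false ∷ d , m′ , there (there (∈-map⁺ (false ∷_) w∈))
mixed-insertion (false ∷ []) (there _ ())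
mixed-insertion (false ∷ true ∷ []) _ (s≤s (s≤s ()))
mixed-insertion (true ∷ false ∷ []) _ (s≤s (s≤s ()))

-- Every word beginning with `false` is reached at least once: `false ∷ true ∷ d` from `true ∷ d`,
-- and `false ∷ false ∷ d` by induction behind the first letter.
∑-laterInsertions-≥ : ∀ m (G : Word → ℚ) → (∀ w → length w ≡ suc m → 0ℚ ≤ G w) →
  ∑ (words m) (G ∘ (false ∷_)) ≤ ∑ (words m) (λ d → ∑ (laterInsertions d) G)
∑-laterInsertions-≥ zero G nn = ≤-reflexive (sym (cong (_+ 0ℚ) (+-identityʳ (G (false ∷ [])))))
∑-laterInsertions-≥ (suc m) G nn = begin
  ∑ (words (suc m)) (G ∘ (false ∷_))
    ≡⟨ ∑-words m (G ∘ (false ∷_)) ⟩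
  ∑ (words m) (λ d → G (false ∷ true ∷ d)) + ∑ (words m) (λ d → G (false ∷ false ∷ d))
    ≤⟨ +-mono-≤
        (∑-mono {f = λ d → G (false ∷ true ∷ d)} {g = λ d → ∑ (laterInsertions (true ∷ d)) G} (words m) (λ d d∈ → p≤p+q (∑-nonneg (map (true ∷_) (laterInsertions d)) (λ w w∈ →
          nn w (length-laterInsertions (true ∷ d) (there w∈) ∙ cong (suc ∘ suc) (words-length m d∈))))))
        (≤-trans (∑-laterInsertions-≥ m (G ∘ (false ∷_)) (λ w l → nn (false ∷ w) (cong suc l)))
          (∑-mono {g = λ d → ∑ (laterInsertions (false ∷ d)) G} (words m) (λ d d∈ →
            ≤-trans (≤-reflexive (sym (∑-map (false ∷_) (laterInsertions d) G)))
              (q≤p+q (nn (false ∷ true ∷ d) (cong (suc ∘ suc) (words-length m d∈))))))) ⟩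
  ∑ (words m) (λ d → ∑ (laterInsertions (true ∷ d)) G) + ∑ (words m) (λ d → ∑ (laterInsertions (false ∷ d)) G)
    ≡⟨ sym (∑-words m (λ d → ∑ (laterInsertions d) G)) ⟩
  ∑ (words (suc m)) (λ d → ∑ (laterInsertions d) G) ∎
  where
  open ≤-Reasoning
  _∙_ = trans

-- Words beginning with `true` come from front insertions, the others from later ones, so no word of
-- length m + 1 is missed on the right.
∑-insertions-≥ : ∀ m (G : Word → ℚ) → (∀ w → length w ≡ suc m → 0ℚ ≤ G w) →
  ∑ (words (suc m)) G ≤ ∑ (words m) (λ d → ∑ (insertions d) G)
∑-insertions-≥ m G nn = begin
  ∑ (words (suc m)) G
    ≡⟨ ∑-words m G ⟩
  ∑ (words m) (G ∘ (true ∷_)) + ∑ (words m) (G ∘ (false ∷_))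
    ≤⟨ +-monoʳ-≤ (∑ (words m) (G ∘ (true ∷_))) (∑-laterInsertions-≥ m G nn) ⟩
  ∑ (words m) (G ∘ (true ∷_)) + ∑ (words m) (λ d → ∑ (laterInsertions d) G)
    ≡⟨ sym (∑-+ (words m) (G ∘ (true ∷_)) (λ d → ∑ (laterInsertions d) G)) ⟩
  ∑ (words m) (λ d → ∑ (insertions d) G) ∎
  where open ≤-Reasoning

-- The value at M_(m+1) = Σ_d (-1)^{#true} F_d of the linear functional F_d ↦ g d.
alternating : ℕ → (Word → ℚ) → ℚ
alternating zero g = g []
alternating (suc m) g = alternating m (g ∘ (false ∷_)) - alternating m (g ∘ (true ∷_))

alternating-cong : ∀ m {f g : Word → ℚ} → (∀ d → length d ≡ m → f d ≡ g d) → alternating m f ≡ alternating m g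
alternating-cong zero eq = eq [] refl
alternating-cong (suc m) eq = cong₂ _-_ (alternating-cong m (λ d l → eq (false ∷ d) (cong suc l)))
  (alternating-cong m (λ d l → eq (true ∷ d) (cong suc l)))

alternating-+ : ∀ m f g → alternating m (λ d → f d + g d) ≡ alternating m f + alternating m g
alternating-+ zero f g = refl
alternating-+ (suc m) f g = trans
  (cong₂ _-_ (alternating-+ m (f ∘ (false ∷_)) (g ∘ (false ∷_))) (alternating-+ m (f ∘ (true ∷_)) (g ∘ (true ∷_))))
  (lemma (alternating m (f ∘ (false ∷_))) (alternating m (g ∘ (false ∷_))) (alternating m (f ∘ (true ∷_))) (alternating m (g ∘ (true ∷_))))
  where
  lemma : ∀ p q r s → (p + q) - (r + s) ≡ (p - r) + (q - s)
  lemma = let open +-*-Solver in solve 4 (λ p q r s → (p :+ q) :- (r :+ s) := (p :- r) :+ (q :- s)) refl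

alternating-* : ∀ m c f → alternating m (λ d → c * f d) ≡ c * alternating m f
alternating-* zero c f = refl
alternating-* (suc m) c f = trans
  (cong₂ _-_ (alternating-* m c (f ∘ (false ∷_))) (alternating-* m c (f ∘ (true ∷_))))
  (lemma c (alternating m (f ∘ (false ∷_))) (alternating m (f ∘ (true ∷_))))
  where
  lemma : ∀ c p q → c * p - c * q ≡ c * (p - q)
  lemma = let open +-*-Solver in solve 3 (λ c p q → c :* p :- c :* q := c :* (p :- q)) refl

-- Möbius inversion: removing the words above `true ∷ d` from those above `false ∷ d` leaves those
-- beginning with `false`.
alternating-↑∑ : ∀ m h → alternating m (λ d → ↑∑ d h) ≡ h (replicate m false)
alternating-↑∑ zero h = refl
alternating-↑∑ (suc m) h = begin
  alternating m (λ d → ↑∑ d (h ∘ (true ∷_)) + ↑∑ d (h ∘ (false ∷_))) - alternating m (λ d → ↑∑ d (h ∘ (true ∷_)))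
    ≡⟨ cong (_- t) (alternating-+ m (λ d → ↑∑ d (h ∘ (true ∷_))) (λ d → ↑∑ d (h ∘ (false ∷_)))) ⟩
  (t + f) - t
    ≡⟨ lemma t f ⟩
  f
    ≡⟨ alternating-↑∑ m (h ∘ (false ∷_)) ⟩
  h (false ∷ replicate m false) ∎
  where
  open ≡-Reasoning
  t = alternating m (λ d → ↑∑ d (h ∘ (true ∷_)))
  f = alternating m (λ d → ↑∑ d (h ∘ (false ∷_)))
  lemma : ∀ p q → (p + q) - p ≡ q
  lemma = let open +-*-Solver in solve 2 (λ p q → (p :+ q) :- p := q) refl

∣alternating∣≤∑ : ∀ m (g : Word → ℚ) → (∀ d → length d ≡ m → 0ℚ ≤ g d) → ∣ alternating m g ∣ ≤ ∑ (words m) g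
∣alternating∣≤∑ zero g nn = ≤-reflexive (trans (0≤p⇒∣p∣≡p (nn [] refl)) (sym (+-identityʳ _)))
∣alternating∣≤∑ (suc m) g nn = begin
  ∣ f - t ∣                                                  ≤⟨ ∣p-q∣≤∣p∣+∣q∣ f t ⟩
  ∣ f ∣ + ∣ t ∣                                              ≤⟨ +-mono-≤ (∣alternating∣≤∑ m (g ∘ (false ∷_)) (λ d l → nn (false ∷ d) (cong suc l)))
                                                                         (∣alternating∣≤∑ m (g ∘ (true ∷_)) (λ d l → nn (true ∷ d) (cong suc l))) ⟩
  ∑ (words m) (g ∘ (false ∷_)) + ∑ (words m) (g ∘ (true ∷_)) ≡⟨ +-comm (∑ (words m) (g ∘ (false ∷_))) (∑ (words m) (g ∘ (true ∷_))) ⟩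
  ∑ (words m) (g ∘ (true ∷_)) + ∑ (words m) (g ∘ (false ∷_)) ≡⟨ sym (∑-words m g) ⟩
  ∑ (words (suc m)) g                                        ∎
  where
  open ≤-Reasoning
  f = alternating m (g ∘ (false ∷_))
  t = alternating m (g ∘ (true ∷_))

∣p-q∣<p+q : ∀ {p q} → 0ℚ < p → 0ℚ < q → ∣ p - q ∣ < p + q
∣p-q∣<p+q {p} {q} 0<p 0<q with ∣p∣≡p∨∣p∣≡-p (p - q)
... | inj₁ eq = subst (_< p + q) (sym eq) (+-monoʳ-< p (<-trans (neg-antimono-< 0<q) 0<q))
... | inj₂ eq = subst₂ _<_ (sym (trans eq (lemma p q))) (+-comm q p)
    (+-monoʳ-< q (<-trans (neg-antimono-< 0<p) 0<p))
  where
  lemma : ∀ p q → - (p - q) ≡ q - p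
  lemma = let open +-*-Solver in solve 2 (λ p q → :- (p :- q) := q :- p) refl

∣^∣ : ∀ x k → ∣ x ^ℚ k ∣ ≡ ∣ x ∣ ^ℚ k
∣^∣ x zero = refl
∣^∣ x (suc k) = trans (∣p*q∣≡∣p∣*∣q∣ x (x ^ℚ k)) (cong (∣ x ∣ *_) (∣^∣ x k))

^ℚ-+ : ∀ x j k → x ^ℚ (j ℕ.+ k) ≡ (x ^ℚ j) * (x ^ℚ k)
^ℚ-+ x zero k = sym (*-identityˡ _)
^ℚ-+ x (suc j) k = trans (cong (x *_) (^ℚ-+ x j k)) (sym (*-assoc x _ _))

-- The estimate of t_k, isolated from Φ: it rests on the insertion rule, nonnegativity in the top
-- degree and one positive value at a mixed word. Here l is λ, and words of length N encode Comp(N +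
-- 1).
module Contraction (l : ℚ) (N : ℕ) (ζ : Word → ℚ)
  (ζ-[] : ζ [] ≡ l)
  (ζ-insertions : ∀ d → l * ζ d ≡ ∑ (insertions d) ζ)
  (ζ-nonneg : ∀ d → length d ≡ N → 0ℚ ≤ ζ d)
  (w₀ : Word) (w₀-length : length w₀ ≡ N) (w₀-mixed : Mixed w₀) (ζ-w₀ : 0ℚ < ζ w₀)
  where

  -- Multiplying by a power of l turns the values of ζ in degree below N + 1 into sums of values in degree N + 1.
  G : Word → ℚ
  G d = (l ^ℚ (N ∸ length d)) * ζ d

  G-insertions : ∀ d → length d ℕ.< N → G d ≡ ∑ (insertions d) G
  G-insertions d lt = begin
    (l ^ℚ (N ∸ length d)) * ζ d
      ≡⟨ cong (λ k → (l ^ℚ k) * ζ d) (ℕ.+-∸-assoc 1 lt) ⟩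
    l * (l ^ℚ (N ∸ suc (length d))) * ζ d
      ≡⟨ lemma l (l ^ℚ (N ∸ suc (length d))) (ζ d) ⟩
    (l ^ℚ (N ∸ suc (length d))) * (l * ζ d)
      ≡⟨ cong ((l ^ℚ (N ∸ suc (length d))) *_) (ζ-insertions d) ⟩
    (l ^ℚ (N ∸ suc (length d))) * ∑ (insertions d) ζ
      ≡⟨ sym (∑-*ˡ (insertions d) (l ^ℚ (N ∸ suc (length d))) ζ) ⟩
    ∑ (insertions d) (λ w → (l ^ℚ (N ∸ suc (length d))) * ζ w)
      ≡⟨ ∑-cong (insertions d) (λ w w∈ → cong (λ k → (l ^ℚ (N ∸ k)) * ζ w) (sym (length-insertions d w∈))) ⟩
    ∑ (insertions d) G ∎
    where
    open ≡-Reasoning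
    lemma : ∀ p q r → p * q * r ≡ q * (p * r)
    lemma = let open +-*-Solver in solve 3 (λ p q r → p :* q :* r := q :* (p :* r)) refl

  G-top : ∀ d → length d ≡ N → G d ≡ ζ d
  G-top d refl = trans (cong (λ k → (l ^ℚ k) * ζ d) (ℕ.n∸n≡0 (length d))) (*-identityˡ (ζ d))

  -- Induction on the distance k to the top degree, where nonnegativity is given. The sign of l
  -- never enters, since its powers are part of G.
  G-nonneg′ : ∀ k d → length d ℕ.+ k ≡ N → 0ℚ ≤ G d
  G-nonneg′ zero d eq = subst (0ℚ ≤_) (sym (G-top d len)) (ζ-nonneg d len)
    where len = trans (sym (ℕ.+-identityʳ _)) eq
  G-nonneg′ (suc k) d eq = subst (0ℚ ≤_)
    (sym (G-insertions d (subst (length d ℕ.<_) eq (ℕ.m<m+n (length d) (s≤s z≤n)))))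
    (∑-nonneg (insertions d) (λ w w∈ → G-nonneg′ k w
      (trans (cong (ℕ._+ k) (length-insertions d w∈)) (trans (sym (ℕ.+-suc (length d) k)) eq))))

  G-nonneg : ∀ d → length d ℕ.≤ N → 0ℚ ≤ G d
  G-nonneg d le = G-nonneg′ (N ∸ length d) d (ℕ.m+[n∸m]≡n le)

  G-insertion-≥ : ∀ d {w} → length d ℕ.< N → w ∈ insertions d → G w ≤ G d
  G-insertion-≥ d lt w∈ = ≤-trans
    (term≤∑ (λ v v∈ → G-nonneg v (subst (ℕ._≤ N) (sym (length-insertions d v∈)) lt)) w∈)
    (≤-reflexive (sym (G-insertions d lt)))

  -- Passing from a mixed word to a shorter mixed word of which it is an insertion does not decrease
  -- G, so positivity is carried down to length 2.
  mixed-pair : ∀ k w → length w ≡ 2 ℕ.+ k → length w ℕ.≤ N → Mixed w → 0ℚ < G w →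
    Σ Word λ v → length v ≡ 2 × Mixed v × 0ℚ < G v
  mixed-pair zero w len le m pos = w , len , m , pos
  mixed-pair (suc k) w len le m pos
    with d , m′ , w∈ ← mixed-insertion w m (subst (3 ℕ.≤_) (sym len) (s≤s (s≤s (s≤s z≤n)))) =
    mixed-pair k d (ℕ.suc-injective (trans (sym (length-insertions d w∈)) len)) (ℕ.<⇒≤ lt) m′
      (<-≤-trans pos (G-insertion-≥ d lt w∈))
    where lt = subst (ℕ._≤ N) (length-insertions d w∈) le

  mixed-length : ∀ {w} → Mixed w → 2 ℕ.≤ length w
  mixed-length (here b d) = s≤s (s≤s z≤n)
  mixed-length (there b m) = s≤s (ℕ.<⇒≤ (mixed-length m))

  2≤N : 2 ℕ.≤ N
  2≤N = subst (2 ℕ.≤_) w₀-length (mixed-length w₀-mixed)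

  G₂ : Bool → Bool → ℚ
  G₂ a b = G (a ∷ b ∷ [])

  G₂-nonneg : ∀ a b → 0ℚ ≤ G₂ a b
  G₂-nonneg a b = G-nonneg (a ∷ b ∷ []) 2≤N

  0<G₂+G₂ : 0ℚ < G₂ true false + G₂ false true
  0<G₂+G₂ with mixed-pair (N ∸ 2) w₀ (trans w₀-length (sym (ℕ.m+[n∸m]≡n 2≤N))) (ℕ.≤-reflexive w₀-length) w₀-mixed
      (subst (0ℚ <_) (sym (G-top w₀ w₀-length)) ζ-w₀)
  ... | true ∷ _ ∷ [] , _ , here _ _ , pos = <-≤-trans pos (p≤p+q (G₂-nonneg false true))
  ... | false ∷ _ ∷ [] , _ , here _ _ , pos = <-≤-trans pos (q≤p+q (G₂-nonneg true false))
  ... | _ ∷ _ ∷ [] , _ , there _ (there _ ()) , pos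

  total : ℕ → ℚ
  total m = ∑ (words m) G

  total-suc : ∀ m → m ℕ.< N → total (suc m) ≤ total m
  total-suc m lt = ≤-trans
    (∑-insertions-≥ m G (λ w len → G-nonneg w (subst (ℕ._≤ N) (sym len) lt)))
    (≤-reflexive (sym (∑-cong (words m) (λ d d∈ → G-insertions d (subst (ℕ._< N) (sym (words-length m d∈)) lt)))))

  total-0 : total 0 ≡ l ^ℚ suc N
  total-0 = trans (+-identityʳ _) (trans (cong ((l ^ℚ N) *_) ζ-[]) (*-comm (l ^ℚ N) l))

  total-1 : total 1 ≡ l ^ℚ suc N
  total-1 = trans (sym (trans (+-identityʳ _) (G-insertions [] (ℕ.<-trans (s≤s z≤n) 2≤N)))) total-0

  -- The insertions of a one-letter word are its doubling and both mixed words of length 2.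
  G-[] : ∀ b → G (b ∷ []) ≡ G₂ b b + (G₂ true false + G₂ false true)
  G-[] true = trans (G-insertions (true ∷ []) 2≤N) (lemma (G₂ true true) (G₂ false true) (G₂ true false))
    where
    lemma : ∀ p q r → p + (q + (r + 0ℚ)) ≡ p + (r + q)
    lemma = let open +-*-Solver in solve 3 (λ p q r → p :+ (q :+ (r :+ con 0ℚ)) := p :+ (r :+ q)) refl
  G-[] false = trans (G-insertions (false ∷ []) 2≤N) (lemma (G₂ true false) (G₂ false true) (G₂ false false))
    where
    lemma : ∀ p q r → p + (q + (r + 0ℚ)) ≡ r + (p + q)
    lemma = let open +-*-Solver in solve 3 (λ p q r → p :+ (q :+ (r :+ con 0ℚ)) := r :+ (p :+ q)) refl

  0<G-[] : ∀ b → 0ℚ < G (b ∷ [])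
  0<G-[] b = subst (0ℚ <_) (sym (G-[] b)) (<-≤-trans 0<G₂+G₂ (q≤p+q (G₂-nonneg b b)))

  -- Each mixed word of length 2 is an insertion of both one-letter words, so it counts twice in
  -- `total 1` and once in `total 2`.
  total-2 : total 2 < l ^ℚ suc N
  total-2 = subst (total 2 <_) total-1 (subst₂ _<_ (+-identityʳ (total 2))
    (sym (trans (cong₂ (λ p q → p + (q + 0ℚ)) (G-[] true) (G-[] false))
      (lemma (G₂ true true) (G₂ true false) (G₂ false true) (G₂ false false))))
    (+-monoʳ-< (total 2) 0<G₂+G₂))
    where
    lemma : ∀ tt tf ft ff → (tt + (tf + ft)) + ((ff + (tf + ft)) + 0ℚ) ≡ (tt + (ft + (tf + (ff + 0ℚ)))) + (tf + ft)
    lemma = let open +-*-Solver in solve 4 (λ tt tf ft ff →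
      (tt :+ (tf :+ ft)) :+ ((ff :+ (tf :+ ft)) :+ con 0ℚ) := (tt :+ (ft :+ (tf :+ (ff :+ con 0ℚ)))) :+ (tf :+ ft)) refl

  total-< : ∀ k → 2 ℕ.+ k ℕ.≤ N → total (2 ℕ.+ k) < l ^ℚ suc N
  total-< zero le = total-2
  total-< (suc k) le = ≤-<-trans (total-suc (2 ℕ.+ k) le) (total-< k (ℕ.<⇒≤ le))

  ∣alternating-G∣< : ∀ k → 1 ℕ.≤ k → k ℕ.≤ N → ∣ alternating k G ∣ < l ^ℚ suc N
  -- For k = 1 the total still equals l^(N+1); strictness comes from the cancellation between two
  -- positive values.
  ∣alternating-G∣< (suc zero) _ le = subst (∣ alternating 1 G ∣ <_)
    (trans (trans (+-comm (G (false ∷ [])) _) (cong (G (true ∷ []) +_) (sym (+-identityʳ _)))) total-1)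
    (∣p-q∣<p+q (0<G-[] false) (0<G-[] true))
  ∣alternating-G∣< (suc (suc k)) _ le = ≤-<-trans
    (∣alternating∣≤∑ (2 ℕ.+ k) G (λ d len → G-nonneg d (subst (ℕ._≤ N) (sym len) le))) (total-< k le)

  -- On words of length k the functions G and ζ differ by the factor l^(N-k), whose absolute value
  -- is cancelled here.
  ∣alternating-ζ∣< : ∀ k → 1 ℕ.≤ k → k ℕ.≤ N → ∣ alternating k ζ ∣ < ∣ l ∣ ^ℚ suc k
  ∣alternating-ζ∣< k 1≤k k≤N = *-cancelˡ-<-nonNeg (∣ l ∣ ^ℚ (N ∸ k)) {{nonNegative pow-nonneg}} (begin-strict
    (∣ l ∣ ^ℚ (N ∸ k)) * ∣ alternating k ζ ∣
      ≡⟨ cong (_* ∣ alternating k ζ ∣) (sym (∣^∣ l (N ∸ k))) ⟩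
    ∣ l ^ℚ (N ∸ k) ∣ * ∣ alternating k ζ ∣
      ≡⟨ sym (∣p*q∣≡∣p∣*∣q∣ (l ^ℚ (N ∸ k)) (alternating k ζ)) ⟩
    ∣ (l ^ℚ (N ∸ k)) * alternating k ζ ∣
      ≡⟨ cong ∣_∣ (trans (sym (alternating-* k (l ^ℚ (N ∸ k)) ζ))
           (alternating-cong k (λ d len → cong (λ j → (l ^ℚ (N ∸ j)) * ζ d) (sym len)))) ⟩
    ∣ alternating k G ∣
      <⟨ ∣alternating-G∣< k 1≤k k≤N ⟩
    l ^ℚ suc N
      ≡⟨ sym (0≤p⇒∣p∣≡p (subst (0ℚ ≤_) total-0 (∑-nonneg (words 0) (λ d d∈ → G-nonneg d (subst (ℕ._≤ N) (sym (words-length 0 d∈)) z≤n))))) ⟩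
    ∣ l ^ℚ suc N ∣
      ≡⟨ ∣^∣ l (suc N) ⟩
    ∣ l ∣ ^ℚ suc N
      ≡⟨ cong (∣ l ∣ ^ℚ_) (sym (trans (ℕ.+-suc (N ∸ k) k) (cong suc (ℕ.m∸n+n≡m k≤N)))) ⟩
    ∣ l ∣ ^ℚ ((N ∸ k) ℕ.+ suc k)
      ≡⟨ ^ℚ-+ ∣ l ∣ (N ∸ k) (suc k) ⟩
    (∣ l ∣ ^ℚ (N ∸ k)) * (∣ l ∣ ^ℚ suc k) ∎)
    where
    open ≤-Reasoning
    pow-nonneg : 0ℚ ≤ ∣ l ∣ ^ℚ (N ∸ k)
    pow-nonneg = subst (0ℚ ≤_) (∣^∣ l (N ∸ k)) (0≤∣p∣ (l ^ℚ (N ∸ k)))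

-- Triangularity

AllPositive : List ℕ → Set
AllPositive = All (1 ℕ.≤_)

comp-positive : ∀ d → AllPositive (comp d)
comp-positive [] = s≤s z≤n ∷ []
comp-positive (true ∷ d) = s≤s z≤n ∷ comp-positive d
comp-positive (false ∷ d) with comp d | comp-nonempty d | comp-positive d
... | _ | a , as , refl | _ ∷ ps = s≤s z≤n ∷ ps

sum-comp : ∀ d → sum (comp d) ≡ suc (length d)
sum-comp [] = refl
sum-comp (true ∷ d) = cong suc (sum-comp d)
sum-comp (false ∷ d) with comp d | comp-nonempty d | sum-comp d
... | _ | a , as , refl | eq = cong suc eq

length-comp≤ : ∀ d → length (comp d) ℕ.≤ suc (length d)
length-comp≤ [] = ℕ.≤-refl
length-comp≤ (true ∷ d) = s≤s (length-comp≤ d)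
length-comp≤ (false ∷ d) with comp d | comp-nonempty d | length-comp≤ d
... | _ | a , as , refl | le = ℕ.m≤n⇒m≤1+n le

word-of : ∀ a as → AllPositive as → Σ Word λ d → suc a ∷ as ≡ comp d
word-of zero [] _ = [] , refl
word-of zero (suc b ∷ bs) (_ ∷ ps) with d , eq ← word-of b bs ps = true ∷ d , cong (1 ∷_) eq
word-of (suc a) as ps with d , eq ← word-of a as ps = false ∷ d , cong bump eq

positive-∈comps : ∀ α → AllPositive α → α ∈ comps (sum α)
positive-∈comps [] _ = here refl
positive-∈comps (suc a ∷ as) (_ ∷ ps) with d , eq ← word-of a as ps =
  subst₂ (λ β k → β ∈ comps k) (sym eq) (trans (sym (sum-comp d)) (cong sum (sym eq))) (comp∈comps d)

deconcat-++ : ∀ α {p} → p ∈ deconcat α → proj₁ p ++ proj₂ p ≡ α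
deconcat-++ [] (here refl) = refl
deconcat-++ (a ∷ as) (here refl) = refl
deconcat-++ (a ∷ as) (there p∈) with p , p∈ , refl ← ∈-map⁻ _ p∈ = cong (a ∷_) (deconcat-++ as p∈)

deconcat-head : ∀ α → Σ (List (List ℕ × List ℕ)) λ ps → deconcat α ≡ ([] , α) ∷ ps
deconcat-head [] = [] , refl
deconcat-head (a ∷ as) = _ , refl

-- Every cut except the first puts at least one part on the left.
deconcat-tail : ∀ α {p ps} → deconcat α ≡ ([] , α) ∷ ps → p ∈ ps → length (proj₂ p) ℕ.< length α
deconcat-tail [] refl ()
deconcat-tail (a ∷ as) refl p∈ with q , q∈ , refl ← ∈-map⁻ _ p∈ =
  s≤s (subst (length (proj₂ q) ℕ.≤_) (trans (sym (length-++ (proj₁ q))) (cong length (deconcat-++ as q∈)))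
    (ℕ.m≤n+m (length (proj₂ q)) (length (proj₁ q))))

kron-≢ : ∀ {α β} → α ≢ β → kron α β ≡ 0ℚ
kron-≢ {α} {β} ne with eqList α β in eq
... | true = contradiction (eqList⇒≡ α β eq) ne
... | false = refl

*-cancelʳ : ∀ {x y} z → z ≢ 0ℚ → x * z ≡ y * z → x ≡ y
*-cancelʳ {x} {y} z z≢0 eq = trans (sym (undo x)) (trans (cong (_* (1/ z)) eq) (undo y))
  where
  instance _ = ≢-nonZero z≢0
  undo : ∀ w → w * z * (1/ z) ≡ w
  undo w = trans (*-assoc w z (1/ z)) (trans (cong (w *_) (*-inverseʳ z)) (*-identityʳ w))

module _ {φ : List ℕ → List ℕ → ℚ} (Φ : IsHopfEndo φ) where
  open IsHopfEndo Φ

  diagonal : List ℕ → ℚ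
  diagonal [] = 1ℚ
  diagonal (a ∷ as) = φ (a ∷ []) (a ∷ []) * diagonal as

  -- Φ is triangular in the monomial basis: the coefficient of M_γ in Φ(M_α) is a sum over the ways to cut α into blocks
  -- of sizes γ₁, γ₂, …, so α has at least as many parts as γ.
  triangular : ∀ γ α → AllPositive γ → AllPositive α → sum α ≡ sum γ → length α ℕ.≤ length γ →
    φ α γ ≡ kron α γ * diagonal γ
  triangular [] [] _ _ _ _ = trans unit (sym (*-identityˡ 1ℚ))
  triangular (zero ∷ γ) _ (() ∷ _)
  triangular (suc g ∷ γ) (a ∷ as) (1≤g ∷ γ⁺) (1≤a ∷ as⁺) sums (s≤s le)
    with rest , deconcat≡ ← deconcat-head as = begin
    φ (a ∷ as) (suc g ∷ γ)
      ≡⟨ comult (suc g) (sum γ) (a ∷ as) (suc g ∷ []) γ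
           (subst (λ k → a ∷ as ∈ comps k) sums (positive-∈comps (a ∷ as) (1≤a ∷ as⁺)))
           (subst (λ k → suc g ∷ [] ∈ comps k) (ℕ.+-identityʳ (suc g)) (positive-∈comps (suc g ∷ []) (1≤g ∷ [])))
           (positive-∈comps γ γ⁺) ⟩
    -- The cut in front of all parts has left sum 0, which differs from `suc g`.
    0ℚ + ∑ (map (λ p → a ∷ proj₁ p , proj₂ p) (deconcat as)) block
      ≡⟨ trans (+-identityˡ _) (∑-map (λ p → a ∷ proj₁ p , proj₂ p) (deconcat as) block) ⟩
    ∑ (deconcat as) (λ p → block (a ∷ proj₁ p , proj₂ p))
      ≡⟨ cong (λ ps → ∑ ps (λ p → block (a ∷ proj₁ p , proj₂ p))) deconcat≡ ⟩
    block (a ∷ [] , as) + ∑ rest (λ p → block (a ∷ proj₁ p , proj₂ p))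
      ≡⟨ cong (block (a ∷ [] , as) +_) (∑-zero rest (λ p p∈ → rest-zero p (subst (p ∈_) (sym deconcat≡) (there p∈)) (deconcat-tail as deconcat≡ p∈))) ⟩
    block (a ∷ [] , as) + 0ℚ
      ≡⟨ +-identityʳ _ ⟩
    block (a ∷ [] , as)
      ≡⟨ head-block ⟩
    kron (a ∷ as) (suc g ∷ γ) * (φ (suc g ∷ []) (suc g ∷ []) * diagonal γ) ∎
    where
    open ≡-Reasoning
    block : List ℕ × List ℕ → ℚ
    block p = if sum (proj₁ p) ≡ᵇ suc g then φ (proj₁ p) (suc g ∷ []) * φ (proj₂ p) γ else 0ℚ
    -- A first block of several parts leaves fewer parts than γ has for the rest, and there the
    -- induction hypothesis gives zero.
    rest-zero : ∀ p → p ∈ deconcat as → length (proj₂ p) ℕ.< length as → block (a ∷ proj₁ p , proj₂ p) ≡ 0ℚ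
    rest-zero (q , r) p∈ lt with a ℕ.+ sum q ≡ᵇ suc g in eq
    ... | false = refl
    ... | true = trans (cong (φ (a ∷ q) (suc g ∷ []) *_) (trans
        (triangular γ r γ⁺ (All.++⁻ʳ q (subst AllPositive (sym (deconcat-++ as p∈)) as⁺)) sum-r (ℕ.≤-trans (ℕ.<⇒≤ lt) le))
        (trans (cong (_* diagonal γ) (kron-≢ {r} {γ} λ { refl → ℕ.<-irrefl refl (ℕ.<-≤-trans lt le) })) (*-zeroˡ (diagonal γ)))))
      (*-zeroʳ (φ (a ∷ q) (suc g ∷ [])))
      where
      sum-r : sum r ≡ sum γ
      sum-r = ℕ.+-cancelˡ-≡ (suc g) (sum r) (sum γ) (trans (cong (ℕ._+ sum r) (sym (≡ᵇ⇒≡ (a ℕ.+ sum q) (suc g) eq)))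
        (trans (ℕ.+-assoc a (sum q) (sum r)) (trans (cong (a ℕ.+_) (trans (sym (sum-++ q r)) (cong sum (deconcat-++ as p∈)))) sums)))
    head-block : block (a ∷ [] , as) ≡ kron (a ∷ as) (suc g ∷ γ) * (φ (suc g ∷ []) (suc g ∷ []) * diagonal γ)
    head-block rewrite ℕ.+-identityʳ a with a ≡ᵇ suc g in eq
    ... | false = sym (*-zeroˡ (φ (suc g ∷ []) (suc g ∷ []) * diagonal γ))
    ... | true with refl ← ≡ᵇ⇒≡ a (suc g) eq = trans
      (cong (φ (suc g ∷ []) (suc g ∷ []) *_) (triangular γ as γ⁺ as⁺ (ℕ.+-cancelˡ-≡ (suc g) (sum as) (sum γ) sums) le))
      (lemma (φ (suc g ∷ []) (suc g ∷ [])) (kron as γ) (diagonal γ))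
      where
      lemma : ∀ p q r → p * (q * r) ≡ q * (p * r)
      lemma = let open +-*-Solver in solve 3 (λ p q r → p :* (q :* r) := q :* (p :* r)) refl

  module _ (N : ℕ) (0<l^ : 0ℚ < lam φ ^ℚ suc N)
    (part-bound : ∀ k → 1 ℕ.≤ k → k ℕ.≤ N → ∣ φ (suc k ∷ []) (suc k ∷ []) ∣ < ∣ lam φ ∣ ^ℚ suc k)
    where

    private
      l = ∣ lam φ ∣

      0<l : 0ℚ < l
      0<l with 0ℚ <? l
      ... | yes lt = lt
      ... | no nlt = contradiction 0<l^ (<-irrefl (sym (trans
        (cong (_* (lam φ ^ℚ N)) (∣p∣≡0⇒p≡0 (lam φ) (≤-antisym (≮⇒≥ nlt) (0≤∣p∣ (lam φ))))) (*-zeroˡ (lam φ ^ℚ N)))))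

      *-pos : ∀ {p q} → 0ℚ < p → 0ℚ < q → 0ℚ < p * q
      *-pos {p} {q} 0<p 0<q = subst (_< p * q) (*-zeroʳ p) (*-monoʳ-<-pos p {{positive 0<p}} 0<q)

      0<l^k : ∀ k → 0ℚ < l ^ℚ k
      0<l^k zero = positive⁻¹ 1ℚ
      0<l^k (suc k) = *-pos 0<l (0<l^k k)

      ≤∧<⇒*< : ∀ {p q r s} → 0ℚ ≤ p → 0ℚ < s → p < r → q ≤ s → p * q < r * s
      ≤∧<⇒*< {p} {q} {r} {s} 0≤p 0<s p<r q≤s =
        ≤-<-trans (*-monoˡ-≤-nonNeg p {{nonNegative 0≤p}} q≤s) (*-monoˡ-<-pos s {{positive 0<s}} p<r)

    -- A part equal to 1 contributes exactly |λ|, while a part k ≥ 2 contributes strictly less than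
    -- |λ|^k; equality therefore leaves only parts 1.
    diagonal-bound : ∀ γ → AllPositive γ → sum γ ℕ.≤ suc N →
      (γ ≡ replicate (length γ) 1 × ∣ diagonal γ ∣ ≡ l ^ℚ sum γ) ⊎ ∣ diagonal γ ∣ < l ^ℚ sum γ
    diagonal-bound [] _ _ = inj₁ (refl , refl)
    diagonal-bound (suc zero ∷ γ) (_ ∷ ps) le with diagonal-bound γ ps (ℕ.<⇒≤ le)
    ... | inj₁ (eq , d) = inj₁ (cong (1 ∷_) eq , trans (∣p*q∣≡∣p∣*∣q∣ (lam φ) (diagonal γ)) (cong (l *_) d))
    ... | inj₂ d = inj₂ (subst (_< l * (l ^ℚ sum γ)) (sym (∣p*q∣≡∣p∣*∣q∣ (lam φ) (diagonal γ)))
        (*-monoʳ-<-pos l {{positive 0<l}} d))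
    diagonal-bound (suc (suc k) ∷ γ) (_ ∷ ps) le = inj₂ (subst₂ _<_
      (sym (∣p*q∣≡∣p∣*∣q∣ (φ (2 ℕ.+ k ∷ []) (2 ℕ.+ k ∷ [])) (diagonal γ))) (sym (^ℚ-+ l (2 ℕ.+ k) (sum γ)))
      (≤∧<⇒*< (0≤∣p∣ (φ (2 ℕ.+ k ∷ []) (2 ℕ.+ k ∷ []))) (0<l^k (sum γ))
        (part-bound (suc k) (s≤s z≤n) (ℕ.≤-trans (ℕ.m≤m+n (suc k) (sum γ)) (ℕ.≤-pred le)))
        (weaken (diagonal-bound γ ps (ℕ.≤-trans (ℕ.m≤n+m (sum γ) (2 ℕ.+ k)) le)))))
      where
      weaken : (γ ≡ replicate (length γ) 1 × ∣ diagonal γ ∣ ≡ l ^ℚ sum γ) ⊎ ∣ diagonal γ ∣ < l ^ℚ sum γ →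
        ∣ diagonal γ ∣ ≤ l ^ℚ sum γ
      weaken (inj₁ (_ , d)) = ≤-reflexive d
      weaken (inj₂ d) = <⇒≤ d

    diagonal-≢ : ∀ d → length d ≡ N → d ≢ replicate N true → diagonal (comp d) ≢ lam φ ^ℚ suc N
    diagonal-≢ d refl d≢ eq with diagonal-bound (comp d) (comp-positive d) (ℕ.≤-reflexive (sum-comp d))
    ... | inj₁ (ones≡ , _) = d≢ (comp-injective d _ (trans ones≡ (trans (cong (λ k → replicate k 1) len) (sym (comp-ones (length d))))))
      where
      sum-replicate : ∀ k → sum (replicate k 1) ≡ k
      sum-replicate zero = refl
      sum-replicate (suc k) = cong suc (sum-replicate k)
      len : length (comp d) ≡ suc (length d)
      len = trans (sym (sum-replicate _)) (trans (cong sum (sym ones≡)) (sum-comp d))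
    ... | inj₂ lt = <-irrefl (trans (cong ∣_∣ eq) (trans (∣^∣ (lam φ) (suc N)) (cong (l ^ℚ_) (sym (sum-comp d))))) lt

    -- Descending induction on the number of parts. In the equation at d the coordinates with more
    -- parts are already zero, those with at most as many parts are removed by triangularity except
    -- d itself, and λ^n differs from the diagonal entry at d.
    eigenvector-zero : (v : Word → ℚ) →
      (∀ d → length d ≡ N → ∑ (words N) (λ e → v e * φ (comp e) (comp d)) ≡ (lam φ ^ℚ suc N) * v d) →
      v (replicate N true) ≡ 0ℚ → ∀ d → length d ≡ N → v d ≡ 0ℚ
    eigenvector-zero v eigen v₁ d len = go (suc N) d len (ℕ.m≤n+m (suc N) (length (comp d)))
      where
      L = lam φ ^ℚ suc N
      -- The counter k bounds N + 1 minus the number of parts; N + 1 is the largest possible number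
      -- of parts.
      go : ∀ k d → length d ≡ N → suc N ℕ.≤ length (comp d) ℕ.+ k → v d ≡ 0ℚ
      go k d refl le with ≡-dec Bool._≟_ d (replicate N true)
      ... | yes d≡ = trans (cong v d≡) v₁
      ... | no d≢ = cancel (diagonal (comp d)) L (v d) (diagonal-≢ d refl d≢) (begin
        diagonal (comp d) * v d
          ≡⟨ cong (diagonal (comp d) *_) (sym (∑-wordKronʳ d v)) ⟩
        diagonal (comp d) * ∑ (words N) (λ e → v e * wordKron e d)
          ≡⟨ sym (∑-*ˡ (words N) (diagonal (comp d)) (λ e → v e * wordKron e d)) ⟩
        ∑ (words N) (λ e → diagonal (comp d) * (v e * wordKron e d))
          ≡⟨ ∑-cong (words N) (λ e e∈ → sym (term e (words-length N e∈))) ⟩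
        ∑ (words N) (λ e → v e * φ (comp e) (comp d))
          ≡⟨ eigen d refl ⟩
        L * v d ∎)
        where
        open ≡-Reasoning
        cancel : ∀ x y z → x ≢ y → x * z ≡ y * z → z ≡ 0ℚ
        cancel x y z x≢y eq with z ≟ 0ℚ
        ... | yes z≡0 = z≡0
        ... | no z≢0 = contradiction (*-cancelʳ z z≢0 eq) x≢y
        term : ∀ e → length e ≡ N → v e * φ (comp e) (comp d) ≡ diagonal (comp d) * (v e * wordKron e d)
        term e len-e with length (comp e) ℕ.≤? length (comp d)
        ... | yes le′ = trans
          (cong (v e *_) (trans (triangular (comp d) (comp e) (comp-positive d) (comp-positive e)
            (trans (sum-comp e) (trans (cong suc len-e) (sym (sum-comp d)))) le′) (cong (_* diagonal (comp d)) (kron-comp e d))))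
          (lemma (v e) (wordKron e d) (diagonal (comp d)))
          where
          lemma : ∀ p q r → p * (q * r) ≡ r * (p * q)
          lemma = let open +-*-Solver in solve 3 (λ p q r → p :* (q :* r) := r :* (p :* q)) refl
        ... | no nle = zero-term k le (ℕ.≰⇒> nle)
          where
          lemma : v e ≡ 0ℚ → v e * φ (comp e) (comp d) ≡ diagonal (comp d) * (v e * wordKron e d)
          lemma eq rewrite eq = trans (*-zeroˡ (φ (comp e) (comp d))) (sym (trans
            (cong (diagonal (comp d) *_) (*-zeroˡ (wordKron e d))) (*-zeroʳ (diagonal (comp d)))))
          zero-term : ∀ k → suc N ℕ.≤ length (comp d) ℕ.+ k → length (comp d) ℕ.< length (comp e) →
            v e * φ (comp e) (comp d) ≡ diagonal (comp d) * (v e * wordKron e d)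
          zero-term zero le gt = contradiction (ℕ.≤-trans gt (subst (λ j → length (comp e) ℕ.≤ suc j) len-e (length-comp≤ e)))
            (ℕ.≤⇒≯ (subst (suc N ℕ.≤_) (ℕ.+-identityʳ _) le))
          zero-term (suc k) le gt = lemma (go k e len-e (ℕ.≤-trans le (subst (ℕ._≤ length (comp e) ℕ.+ k)
            (sym (ℕ.+-suc (length (comp d)) k)) (ℕ.+-monoˡ-≤ k gt))))

-- The chain on compositions

ι-+ : ∀ m n → ι (m ℕ.+ n) ≡ ι m + ι n
ι-+ zero n = sym (+-identityˡ (ι n))
ι-+ (suc m) n = trans (ι-suc (m ℕ.+ n)) (trans (cong (1ℚ +_) (ι-+ m n))
  (trans (sym (+-assoc 1ℚ (ι m) (ι n))) (cong (_+ ι n) (sym (ι-suc m)))))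

ι-* : ∀ m n → ι (m ℕ.* n) ≡ ι m * ι n
ι-* zero n = sym (*-zeroˡ (ι n))
ι-* (suc m) n = begin
  ι (n ℕ.+ m ℕ.* n)     ≡⟨ ι-+ n (m ℕ.* n) ⟩
  ι n + ι (m ℕ.* n)     ≡⟨ cong (ι n +_) (ι-* m n) ⟩
  ι n + ι m * ι n       ≡⟨ lemma (ι n) (ι m) ⟩
  (1ℚ + ι m) * ι n      ≡⟨ cong (_* ι n) (sym (ι-suc m)) ⟩
  ι (suc m) * ι n       ∎
  where
  open ≡-Reasoning
  lemma : ∀ p q → p + q * p ≡ (1ℚ + q) * p
  lemma = let open +-*-Solver in solve 2 (λ p q → p :+ q :* p := (con 1ℚ :+ q) :* p) refl

0≤ι : ∀ n → 0ℚ ≤ ι n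
0≤ι n = nonNegative⁻¹ (ι n) {{normalize-nonNeg n 1}}

ι*1/ : ∀ k .{{_ : ℕ.NonZero k}} → ι k * (ℤ.1ℤ / k) ≡ 1ℚ
ι*1/ (suc j) = toℚᵘ-injective (begin
  toℚᵘ (ι (suc j) * (ℤ.1ℤ / suc j))
    ≈⟨ toℚᵘ-homo-* (ι (suc j)) (ℤ.1ℤ / suc j) ⟩
  toℚᵘ (ι (suc j)) ℚᵘ.* toℚᵘ (ℤ.1ℤ / suc j)
    ≈⟨ ℚᵘ.*-cong (toℚᵘ-fromℚᵘ (mkℚᵘ (ℤ.+ suc j) 0)) (toℚᵘ-fromℚᵘ (mkℚᵘ ℤ.1ℤ j)) ⟩
  mkℚᵘ (ℤ.+ suc j) 0 ℚᵘ.* mkℚᵘ ℤ.1ℤ j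
    ≈⟨ *≡* (trans (cong (ℤ._* ℤ.1ℤ) (ℤ.*-identityʳ (ℤ.+ suc j))) (cong (λ k → ℤ.+ suc k) (trans (ℕ.*-identityʳ j) (sym (ℕ.+-identityʳ (j ℕ.+ 0) ∙ ℕ.+-identityʳ j))))) ⟩
  toℚᵘ 1ℚ ∎)
  where
  open ℚᵘ.≃-Reasoning
  _∙_ = trans

∑-1 : ∀ {A : Set} (xs : List A) → ∑ xs (λ _ → 1ℚ) ≡ ι (length xs)
∑-1 [] = refl
∑-1 (x ∷ xs) = trans (cong (1ℚ +_) (∑-1 xs)) (sym (ι-suc (length xs)))

length-insertAll : ∀ x ys → length (insertAll x ys) ≡ suc (length ys)
length-insertAll x [] = refl
length-insertAll x (y ∷ ys) = cong suc (trans (length-map (y ∷_) (insertAll x ys)) (length-insertAll x ys))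

∑-perms-1 : ∀ n → ∑ (perms n) (λ _ → 1ℚ) ≡ ι (n !)
∑-perms-1 zero = refl
∑-perms-1 (suc n) = begin
  ∑ (perms (suc n)) (λ _ → 1ℚ)
    ≡⟨ ∑-concatMap (insertAll n) (perms n) (λ _ → 1ℚ) ⟩
  ∑ (perms n) (λ σ → ∑ (insertAll n σ) (λ _ → 1ℚ))
    ≡⟨ ∑-cong (perms n) (λ σ σ∈ → trans (∑-1 (insertAll n σ)) (trans
         (cong ι (trans (length-insertAll n σ) (cong suc (perms-length n σ∈)))) (sym (*-identityʳ (ι (suc n)))))) ⟩
  ∑ (perms n) (λ σ → ι (suc n) * 1ℚ)
    ≡⟨ ∑-*ˡ (perms n) (ι (suc n)) (λ _ → 1ℚ) ⟩
  ι (suc n) * ∑ (perms n) (λ _ → 1ℚ)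
    ≡⟨ cong (ι (suc n) *_) (∑-perms-1 n) ⟩
  ι (suc n) * ι (n !)
    ≡⟨ sym (ι-* (suc n) (n !)) ⟩
  ι (suc n !) ∎
  where open ≡-Reasoning

n!*invFact : ∀ n → ι (n !) * invFact n ≡ 1ℚ
n!*invFact n = ι*1/ (n !) {{n ℕ.!≢0}}

0≤invFact : ∀ n → 0ℚ ≤ invFact n
0≤invFact n = nonNegative⁻¹ (invFact n) {{normalize-nonNeg 1 (n !) {{n ℕ.!≢0}}}}

÷₀-cancel : ∀ p q → q ≢ 0ℚ → (p ÷₀ q) * q ≡ p
÷₀-cancel p q q≢0 with q ≟ 0ℚ
... | yes q≡0 = contradiction q≡0 q≢0
... | no q≢0′ = trans (*-assoc p (1/ q) q) (trans (cong (p *_) (*-inverseˡ q)) (*-identityʳ p))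
  where instance _ = ≢-nonZero q≢0′

-- Adjointness of the two summations: both sides sum `f a * g e` over all pairs with `a ⊑ e`.
∑-↓∑-↑∑ : ∀ m (f g : Word → ℚ) → ∑ (words m) (λ e → ↓∑ e f * g e) ≡ ∑ (words m) (λ a → f a * ↑∑ a g)
∑-↓∑-↑∑ zero f g = refl
∑-↓∑-↑∑ (suc m) f g = begin
  ∑ (words (suc m)) (λ e → ↓∑ e f * g e)
    ≡⟨ ∑-words m (λ e → ↓∑ e f * g e) ⟩
  ∑ (words m) (λ e → (↓∑ e f₁ + ↓∑ e f₀) * g₁ e) + ∑ (words m) (λ e → ↓∑ e f₀ * g₀ e)
    ≡⟨ cong₂ _+_ (trans (∑-ext (words m) (λ e → *-distribʳ-+ (g₁ e) (↓∑ e f₁) (↓∑ e f₀)))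
         (trans (∑-+ (words m) (λ e → ↓∑ e f₁ * g₁ e) (λ e → ↓∑ e f₀ * g₁ e))
           (cong₂ _+_ (∑-↓∑-↑∑ m f₁ g₁) (∑-↓∑-↑∑ m f₀ g₁)))) (∑-↓∑-↑∑ m f₀ g₀) ⟩
  (∑ (words m) (λ a → f₁ a * ↑∑ a g₁) + ∑ (words m) (λ a → f₀ a * ↑∑ a g₁)) + ∑ (words m) (λ a → f₀ a * ↑∑ a g₀)
    ≡⟨ +-assoc (∑ (words m) (λ a → f₁ a * ↑∑ a g₁)) (∑ (words m) (λ a → f₀ a * ↑∑ a g₁)) (∑ (words m) (λ a → f₀ a * ↑∑ a g₀)) ⟩
  ∑ (words m) (λ a → f₁ a * ↑∑ a g₁) + (∑ (words m) (λ a → f₀ a * ↑∑ a g₁) + ∑ (words m) (λ a → f₀ a * ↑∑ a g₀))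
    ≡⟨ cong (∑ (words m) (λ a → f₁ a * ↑∑ a g₁) +_) (trans
         (sym (∑-+ (words m) (λ a → f₀ a * ↑∑ a g₁) (λ a → f₀ a * ↑∑ a g₀)))
         (∑-ext (words m) (λ a → sym (*-distribˡ-+ (f₀ a) (↑∑ a g₁) (↑∑ a g₀))))) ⟩
  ∑ (words m) (λ a → f₁ a * ↑∑ a g₁) + ∑ (words m) (λ a → f₀ a * (↑∑ a g₁ + ↑∑ a g₀))
    ≡⟨ sym (∑-words m (λ a → f a * ↑∑ a g)) ⟩
  ∑ (words (suc m)) (λ a → f a * ↑∑ a g) ∎
  where
  open ≡-Reasoning
  f₁ = f ∘ (true ∷_)
  f₀ = f ∘ (false ∷_)
  g₁ = g ∘ (true ∷_)
  g₀ = g ∘ (false ∷_)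

module _ {φ c : List ℕ → List ℕ → ℚ} (Φ : IsHopfEndo φ) (N : ℕ) (coeffs : IsFCoeffs φ c (suc N)) where

  -- The two expressions for the coefficient of M_δ in Φ(F_d).
  ↑∑≡↓∑ : ∀ d δ → length d ≡ N → length δ ≡ N →
    ↑∑ d (λ e → φ (comp e) (comp δ)) ≡ ↓∑ δ (λ e → c (comp d) (comp e))
  ↑∑≡↓∑ d δ refl len = begin
    ↑∑ d (λ e → φ (comp e) (comp δ))
      ≡⟨ sym (↑∑-comps d (λ β → φ β (comp δ))) ⟩
    ∑ (comps (suc N)) (λ β → if comp d ≤ᶜ β then φ β (comp δ) else 0ℚ)
      ≡⟨ coeffs (comp d) (comp δ) (comp∈comps d) (subst (λ k → comp δ ∈ comps (suc k)) len (comp∈comps δ)) ⟩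
    ∑ (comps (suc N)) (λ β → if β ≤ᶜ comp δ then c (comp d) β else 0ℚ)
      ≡⟨ cong (λ k → ∑ (comps (suc k)) (λ β → if β ≤ᶜ comp δ then c (comp d) β else 0ℚ)) (sym len) ⟩
    ∑ (comps (suc (length δ))) (λ β → if β ≤ᶜ comp δ then c (comp d) β else 0ℚ)
      ≡⟨ ↓∑-comps δ (c (comp d)) ⟩
    ↓∑ δ (λ e → c (comp d) (comp e)) ∎
    where open ≡-Reasoning

  -- Among the F_β only F_(n) contains M_(n), so the F-coefficient and the M-coefficient agree
  -- there.
  c-single : ∀ d → length d ≡ N → c (comp d) (single (suc N)) ≡ character Φ d
  c-single d len = begin
    c (comp d) (single (suc N))
      ≡⟨ cong (c (comp d)) (sym (comp-single N)) ⟩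
    c (comp d) (comp (replicate N false))
      ≡⟨ sym (↓∑-single N (λ e → c (comp d) (comp e))) ⟩
    ↓∑ (replicate N false) (λ e → c (comp d) (comp e))
      ≡⟨ sym (↑∑≡↓∑ d (replicate N false) len (length-replicate N)) ⟩
    ↑∑ d (λ e → φ (comp e) (comp (replicate N false)))
      ≡⟨ ↑∑-cong d (λ e l → cong (φ (comp e)) (trans (comp-single N) (cong (single ∘ suc) (sym (trans l len))))) ⟩
    character Φ d ∎
    where open ≡-Reasoning

  private
    L = lam φ ^ℚ suc N
    n = suc N

  weight : Word → ℚ
  weight d = ι (count (comp d) (map D (perms n)))

  weight≡∑ : ∀ d → weight d ≡ ∑ (perms n) (λ σ → wordKron d (pattern-of σ))
  weight≡∑ d = trans (ι-count (comp d) (map D (perms n))) (trans (∑-map D (perms n) (kron (comp d)))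
    (∑-cong (perms n) (λ σ σ∈ → trans (cong (kron (comp d)) (perms-D N σ∈)) (kron-comp d (pattern-of σ)))))

  ∑-weight : ∀ (h : Word → ℚ) → ∑ (words N) (λ d → weight d * h d) ≡ ∑ (perms n) (h ∘ pattern-of)
  ∑-weight h = begin
    ∑ (words N) (λ d → weight d * h d)
      ≡⟨ ∑-ext (words N) (λ d → trans (*-comm (weight d) (h d)) (trans (cong (h d *_) (weight≡∑ d))
           (sym (∑-*ˡ (perms n) (h d) (λ σ → wordKron d (pattern-of σ)))))) ⟩
    ∑ (words N) (λ d → ∑ (perms n) (λ σ → h d * wordKron d (pattern-of σ)))
      ≡⟨ ∑-swap (words N) (perms n) (λ d σ → h d * wordKron d (pattern-of σ)) ⟩
    ∑ (perms n) (λ σ → ∑ (words N) (λ d → h d * wordKron d (pattern-of σ)))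
      ≡⟨ ∑-cong (perms n) (λ σ σ∈ → trans
           (cong (λ k → ∑ (words k) (λ d → h d * wordKron d (pattern-of σ))) (sym (perms-pattern-length N σ∈)))
           (∑-wordKronʳ (pattern-of σ) h)) ⟩
    ∑ (perms n) (h ∘ pattern-of) ∎
    where open ≡-Reasoning

  -- `weight` lists the F-coefficients of M_(1)^n. The eigenvector identity is known for
  -- M-coefficients, and `↓∑-injective` carries it over to the F-basis.
  weight-eigen : ∀ e → length e ≡ N → ∑ (words N) (λ d → weight d * c (comp d) (comp e)) ≡ L * weight e
  weight-eigen e len = trans (∑-weight (λ d → c (comp d) (comp e)))
    (↓∑-injective N (λ e → ∑ (perms n) (λ σ → c (comp (pattern-of σ)) (comp e))) (λ e → L * weight e) sums e len)
    where
    open ≡-Reasoning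
    sums : ∀ δ → length δ ≡ N →
      ↓∑ δ (λ e → ∑ (perms n) (λ σ → c (comp (pattern-of σ)) (comp e))) ≡ ↓∑ δ (λ e → L * weight e)
    sums δ len = begin
      ↓∑ δ (λ e → ∑ (perms n) (λ σ → c (comp (pattern-of σ)) (comp e)))
        ≡⟨ ↓∑-∑ δ (perms n) (λ σ e → c (comp (pattern-of σ)) (comp e)) ⟩
      ∑ (perms n) (λ σ → ↓∑ δ (λ e → c (comp (pattern-of σ)) (comp e)))
        ≡⟨ ∑-cong (perms n) (λ σ σ∈ → sym (↑∑≡↓∑ (pattern-of σ) δ (perms-pattern-length N σ∈) len)) ⟩
      patternSum n (λ e → φ (comp e) (comp δ))
        ≡⟨ patternSum-eigen Φ N (comp δ) (subst (λ k → comp δ ∈ comps (suc k)) len (comp∈comps δ)) ⟩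
      L * patternSum n (kron (comp δ) ∘ comp)
        ≡⟨ cong (L *_) (∑-cong (perms n) (λ σ σ∈ → trans
             (↑∑-cong (pattern-of σ) (λ e _ → kron-comp δ e))
             (sym (↓∑-wordKron δ (pattern-of σ) (trans len (sym (perms-pattern-length N σ∈))))))) ⟩
      L * ∑ (perms n) (λ σ → ↓∑ δ (λ e → wordKron e (pattern-of σ)))
        ≡⟨ cong (L *_) (sym (↓∑-∑ δ (perms n) (λ σ e → wordKron e (pattern-of σ)))) ⟩
      L * ↓∑ δ (λ e → ∑ (perms n) (λ σ → wordKron e (pattern-of σ)))
        ≡⟨ cong (L *_) (↓∑-cong δ (λ e _ → sym (weight≡∑ e))) ⟩
      L * ↓∑ δ weight
        ≡⟨ sym (↓∑-* δ L weight) ⟩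
      ↓∑ δ (λ e → L * weight e) ∎

  module _ (0<L : 0ℚ < L) where

    private
      L≢0 : L ≢ 0ℚ
      L≢0 L≡0 = <-irrefl (sym L≡0) 0<L

    -- Clearing the denominator λ^n turns stationarity for K̄ into an eigenvector equation for the
    -- matrix `c`.
    stationary-eigen : ∀ (μ : List ℕ → ℚ) β → ∑ (comps n) (λ α → μ α * Kbar φ c n α β) * L ≡ ∑ (words N) (λ d → μ (comp d) * c (comp d) β)
    stationary-eigen μ β = begin
      ∑ (comps n) (λ α → μ α * Kbar φ c n α β) * L
        ≡⟨ sym (∑-*ʳ (comps n) L (λ α → μ α * Kbar φ c n α β)) ⟩
      ∑ (comps n) (λ α → μ α * Kbar φ c n α β * L)
        ≡⟨ ∑-ext (comps n) (λ α → trans (*-assoc (μ α) (Kbar φ c n α β) L) (cong (μ α *_) (÷₀-cancel (c α β) L L≢0))) ⟩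
      ∑ (comps n) (λ α → μ α * c α β)
        ≡⟨ ∑-comps N (λ α → μ α * c α β) ⟩
      ∑ (words N) (λ d → μ (comp d) * c (comp d) β) ∎
      where open ≡-Reasoning

    descentDist-comp : ∀ d → descentDist n (comp d) ≡ weight d * invFact n
    descentDist-comp d = refl

    descentDist-stationary : IsStationary (comps n) (Kbar φ c n) (descentDist n)
    descentDist-stationary = nonneg , total , invariant
      where
      open ≡-Reasoning
      nonneg : ∀ α → α ∈ comps n → 0ℚ ≤ descentDist n α
      nonneg α _ = 0≤* (0≤ι (count α (map D (perms n)))) (0≤invFact n)
      total : ∑ (comps n) (descentDist n) ≡ 1ℚ
      total = begin
        ∑ (comps n) (descentDist n)                        ≡⟨ trans (∑-comps N (descentDist n)) (∑-ext (words N) descentDist-comp) ⟩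
        ∑ (words N) (λ d → weight d * invFact n)           ≡⟨ ∑-weight (λ _ → invFact n) ⟩
        ∑ (perms n) (λ _ → invFact n)                      ≡⟨ ∑-ext (perms n) (λ _ → sym (*-identityˡ (invFact n))) ⟩
        ∑ (perms n) (λ _ → 1ℚ * invFact n)                 ≡⟨ ∑-*ʳ (perms n) (invFact n) (λ _ → 1ℚ) ⟩
        ∑ (perms n) (λ _ → 1ℚ) * invFact n                 ≡⟨ cong (_* invFact n) (∑-perms-1 n) ⟩
        ι (n !) * invFact n                                ≡⟨ n!*invFact n ⟩
        1ℚ                                                 ∎
      Invariant : List ℕ → Set
      Invariant β = ∑ (comps n) (λ α → descentDist n α * Kbar φ c n α β) ≡ descentDist n β
      invariant : ∀ β → β ∈ comps n → Invariant β
      invariant β β∈ = let e , len , β≡ = comps-word β∈ in subst Invariant (sym β≡) (invariant-comp e len)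
        where
        invariant-comp : ∀ e → length e ≡ N → Invariant (comp e)
        invariant-comp e len = *-cancelʳ L L≢0 (begin
          ∑ (comps n) (λ α → descentDist n α * Kbar φ c n α (comp e)) * L
            ≡⟨ stationary-eigen (descentDist n) (comp e) ⟩
          ∑ (words N) (λ d → descentDist n (comp d) * c (comp d) (comp e))
            ≡⟨ ∑-ext (words N) (λ d → trans (cong (_* c (comp d) (comp e)) (descentDist-comp d)) (lemma (weight d) (invFact n) (c (comp d) (comp e)))) ⟩
          ∑ (words N) (λ d → weight d * c (comp d) (comp e) * invFact n)
            ≡⟨ ∑-*ʳ (words N) (invFact n) (λ d → weight d * c (comp d) (comp e)) ⟩
          ∑ (words N) (λ d → weight d * c (comp d) (comp e)) * invFact n
            ≡⟨ cong (_* invFact n) (weight-eigen e len) ⟩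
          L * weight e * invFact n
            ≡⟨ trans (*-assoc L (weight e) (invFact n)) (trans (*-comm L (weight e * invFact n)) (cong (_* L) (sym (descentDist-comp e)))) ⟩
          descentDist n (comp e) * L ∎)
          where
          lemma : ∀ p q r → p * q * r ≡ p * r * q
          lemma = let open +-*-Solver in solve 3 (λ p q r → p :* q :* r := p :* r :* q) refl

    module _ (c-nonneg : ∀ α → α ∈ comps n → 0ℚ ≤ c α (single n))
      (w₀ : Word) (w₀-length : length w₀ ≡ N) (w₀-mixed : Mixed w₀) (c-w₀ : 0ℚ < c (comp w₀) (single n)) where

      open Contraction (lam φ) N (character Φ) refl (character-insertions Φ)
        (λ d len → subst (0ℚ ≤_) (c-single d len) (c-nonneg (comp d) (subst (λ k → comp d ∈ comps (suc k)) len (comp∈comps d))))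
        w₀ w₀-length w₀-mixed (subst (0ℚ <_) (c-single w₀ w₀-length) c-w₀)
        using (∣alternating-ζ∣<)

      -- M_(k+1) is the alternating sum of the F_d with d of length k; this identifies the quantity
      -- bounded in `Contraction` with the diagonal entry t_(k+1).
      character-alternating : ∀ k → alternating k (character Φ) ≡ φ (suc k ∷ []) (suc k ∷ [])
      character-alternating k = trans (alternating-↑∑ k (λ e → φ (comp e) (single (suc (length e)))))
        (cong₂ φ (comp-single k) (cong (single ∘ suc) (length-replicate k)))

      Kbar-stationary-unique : ∀ (μ ν : List ℕ → ℚ) →
        IsStationary (comps n) (Kbar φ c n) μ → IsStationary (comps n) (Kbar φ c n) ν → ∀ α → α ∈ comps n → μ α ≡ ν α
      Kbar-stationary-unique μ ν (_ , ∑μ , μK) (_ , ∑ν , νK) α α∈ with e , len , refl ← comps-word α∈ =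
        p-q≡0⇒p≡q (μ (comp e)) (ν (comp e)) (↓∑-injective N x (λ _ → 0ℚ) (λ d l → trans (v≡0 d l) (sym (↓∑-0 d))) e len)
        where
        open ≡-Reasoning
        x : Word → ℚ
        x d = μ (comp d) - ν (comp d)
        eigen : ∀ ρ → (∀ β → β ∈ comps n → ∑ (comps n) (λ α → ρ α * Kbar φ c n α β) ≡ ρ β) →
          ∀ d → length d ≡ N → ∑ (words N) (λ a → ρ (comp a) * c (comp a) (comp d)) ≡ L * ρ (comp d)
        eigen ρ ρK d l = trans (sym (stationary-eigen ρ (comp d))) (trans
          (cong (_* L) (ρK (comp d) (subst (λ k → comp d ∈ comps (suc k)) l (comp∈comps d)))) (*-comm (ρ (comp d)) L))
        x-eigen : ∀ d → length d ≡ N → ∑ (words N) (λ a → x a * c (comp a) (comp d)) ≡ L * x d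
        x-eigen d l = begin
          ∑ (words N) (λ a → x a * c (comp a) (comp d))
            ≡⟨ ∑-ext (words N) (λ a → lemma (μ (comp a)) (ν (comp a)) (c (comp a) (comp d))) ⟩
          ∑ (words N) (λ a → μ (comp a) * c (comp a) (comp d) - ν (comp a) * c (comp a) (comp d))
            ≡⟨ ∑-- (words N) (λ a → μ (comp a) * c (comp a) (comp d)) (λ a → ν (comp a) * c (comp a) (comp d)) ⟩
          ∑ (words N) (λ a → μ (comp a) * c (comp a) (comp d)) - ∑ (words N) (λ a → ν (comp a) * c (comp a) (comp d))
            ≡⟨ cong₂ _-_ (eigen μ μK d l) (eigen ν νK d l) ⟩
          L * μ (comp d) - L * ν (comp d)
            ≡⟨ lemma′ L (μ (comp d)) (ν (comp d)) ⟩
          L * x d ∎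
          where
          lemma : ∀ p q r → (p - q) * r ≡ p * r - q * r
          lemma = let open +-*-Solver in solve 3 (λ p q r → (p :- q) :* r := p :* r :- q :* r) refl
          lemma′ : ∀ p q r → p * q - p * r ≡ p * (q - r)
          lemma′ = let open +-*-Solver in solve 3 (λ p q r → p :* q :- p :* r := p :* (q :- r)) refl
        -- With x as F-coordinates of an element of Q_n, v gives its M-coordinates, in which Φ is
        -- triangular.
        v : Word → ℚ
        v d = ↓∑ d x
        v-eigen : ∀ d → length d ≡ N → ∑ (words N) (λ e → v e * φ (comp e) (comp d)) ≡ L * v d
        v-eigen d l = begin
          ∑ (words N) (λ e → ↓∑ e x * φ (comp e) (comp d))
            ≡⟨ ∑-↓∑-↑∑ N x (λ e → φ (comp e) (comp d)) ⟩
          ∑ (words N) (λ a → x a * ↑∑ a (λ e → φ (comp e) (comp d)))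
            ≡⟨ ∑-cong (words N) (λ a a∈ → trans (cong (x a *_) (↑∑≡↓∑ a d (words-length N a∈) l))
                 (sym (↓∑-* d (x a) (λ e → c (comp a) (comp e))))) ⟩
          ∑ (words N) (λ a → ↓∑ d (λ e → x a * c (comp a) (comp e)))
            ≡⟨ sym (↓∑-∑ d (words N) (λ a e → x a * c (comp a) (comp e))) ⟩
          ↓∑ d (λ e → ∑ (words N) (λ a → x a * c (comp a) (comp e)))
            ≡⟨ ↓∑-cong d (λ e l′ → x-eigen e (trans l′ l)) ⟩
          ↓∑ d (λ e → L * x e)
            ≡⟨ ↓∑-* d L x ⟩
          L * v d ∎
        -- Every word lies below the all-`true` word, so this coordinate is the difference of two
        -- total masses.
        v-ones : v (replicate N true) ≡ 0ℚ
        v-ones = begin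
          ↓∑ (replicate N true) x
            ≡⟨ ↓∑-ones N x ⟩
          ∑ (words N) x
            ≡⟨ ∑-- (words N) (μ ∘ comp) (ν ∘ comp) ⟩
          ∑ (words N) (μ ∘ comp) - ∑ (words N) (ν ∘ comp)
            ≡⟨ cong₂ _-_ (trans (sym (∑-comps N μ)) ∑μ) (trans (sym (∑-comps N ν)) ∑ν) ⟩
          1ℚ - 1ℚ
            ≡⟨ +-inverseʳ 1ℚ ⟩
          0ℚ ∎
        v≡0 : ∀ d → length d ≡ N → v d ≡ 0ℚ
        v≡0 = eigenvector-zero Φ N 0<L
          (λ k 1≤k k≤N → subst (λ p → ∣ p ∣ < ∣ lam φ ∣ ^ℚ suc k) (character-alternating k) (∣alternating-ζ∣< k 1≤k k≤N))
          v v-eigen v-ones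

-- The group of permutations

Unique-resp-↭ : ∀ {A : Set} {xs ys : List A} → xs ↭ ys → Unique xs → Unique ys
Unique-resp-↭ {A} p = ↭ₛ.Unique-resp-↭ (setoid A) (↭⇒↭ₛ p)

-- Lists without repetitions and with the same members are permutations of each other. The maps need
-- to be mutually inverse only on `xs`, since `compose` and `inverse` misbehave off the
-- permutations.
bijection-↭ : ∀ {A : Set} {xs : List A} → Unique xs → (f g : A → A) →
  (∀ {x} → x ∈ xs → f x ∈ xs) → (∀ {x} → x ∈ xs → g x ∈ xs) →
  (∀ {x} → x ∈ xs → f (g x) ≡ x) → (∀ {x} → x ∈ xs → g (f x) ≡ x) → map f xs ↭ xs
bijection-↭ {xs = xs} unique f g f∈ g∈ fg gf = ∼bag⇒↭ (unique∧set⇒bag (injective-map xs id unique) unique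
  (mk⇔ (λ y∈ → let x , x∈ , eq = ∈-map⁻ f y∈ in subst (_∈ xs) (sym eq) (f∈ x∈))
       (λ y∈ → subst (_∈ map f xs) (fg y∈) (∈-map⁺ f (g∈ y∈)))))
  where
  injective-map : ∀ ys → (∀ {y} → y ∈ ys → y ∈ xs) → Unique ys → Unique (map f ys)
  injective-map [] sub [] = []
  injective-map (y ∷ ys) sub (y∉ ∷ u) =
    All.map⁺ (All.tabulate (λ {z} z∈ eq → All.lookup y∉ z∈
      (trans (sym (gf (sub (here refl)))) (trans (cong g eq) (gf (sub (there z∈)))))))
    ∷ injective-map ys (sub ∘ there) u

∈-insertAll : ∀ x ys zs → ys ++ x ∷ zs ∈ insertAll x (ys ++ zs)
∈-insertAll x [] [] = here refl
∈-insertAll x [] (z ∷ zs) = here refl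
∈-insertAll x (y ∷ ys) zs = there (∈-map⁺ (y ∷_) (∈-insertAll x ys zs))

↭-∈perms : ∀ n {σ} → σ ↭ upTo n → σ ∈ perms n
↭-∈perms zero p with refl ← ↭-empty-inv p = here refl
↭-∈perms (suc n) {σ} p with ys , zs , refl ← ∈-∃++ (∈-resp-↭ (↭-sym p) (∈-upTo⁺ (ℕ.n<1+n n))) =
  ∈-concatMap⁺ (insertAll n) (lose (↭-∈perms n (drop-mid ys [] (↭-trans p (upTo-suc-↭ n)))) (∈-insertAll n ys zs))

private
  without : ℕ → List ℕ → List ℕ
  without x = filter (λ y → ¬? (x ℕ.≟ y))

  -- Deleting x undoes its insertion, so insertions of a new value into different words are
  -- different.
  without-insertAll : ∀ x ys {zs} → All (x ≢_) ys → zs ∈ insertAll x ys → without x zs ≡ ys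
  without-insertAll x [] _ (here refl) = filter-reject (λ y → ¬? (x ℕ.≟ y)) (λ ne → ne refl)
  without-insertAll x (y ∷ ys) x∉ (here refl) =
    trans (filter-reject (λ y → ¬? (x ℕ.≟ y)) (λ ne → ne refl)) (filter-all (λ y → ¬? (x ℕ.≟ y)) x∉)
  without-insertAll x (y ∷ ys) (x≢y ∷ x∉) (there zs∈) with zs , zs∈ , refl ← ∈-map⁻ (y ∷_) zs∈ =
    trans (filter-accept (λ y → ¬? (x ℕ.≟ y)) x≢y) (cong (y ∷_) (without-insertAll x ys x∉ zs∈))

insertAll-unique : ∀ x ys → All (x ≢_) ys → Unique (insertAll x ys)
insertAll-unique x [] _ = [] ∷ []
insertAll-unique x (y ∷ ys) (x≢y ∷ x∉) =
  All.map⁺ (All.tabulate (λ _ eq → x≢y (∷-injectiveˡ eq))) ∷ Unique.map⁺ ∷-injectiveʳ (insertAll-unique x ys x∉)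

perms-≢ : ∀ n {σ} → σ ∈ perms n → All (n ≢_) σ
perms-≢ n σ∈ = All.map (λ lt eq → ℕ.<-irrefl (sym eq) lt) (perms-All< n σ∈)

perms-unique : ∀ n → Unique (perms n)
perms-unique zero = [] ∷ []
perms-unique (suc n) = Unique.concat⁺
  (All.map⁺ (All.tabulate (λ {σ} σ∈ → insertAll-unique n σ (perms-≢ n σ∈))))
  (AllPairs.map⁺ (disjoint (perms n) (All.tabulate (perms-≢ n)) (perms-unique n)))
  where
  disjoint : ∀ ps → All (All (n ≢_)) ps → Unique ps → AllPairs (Disjoint on insertAll n) ps
  disjoint [] _ [] = []
  disjoint (σ ∷ ps) (n∉σ ∷ n∉) (σ∉ ∷ u) = All.tabulate (λ {τ} τ∈ (∈σ , ∈τ) → All.lookup σ∉ τ∈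
    (trans (sym (without-insertAll n σ n∉σ ∈σ)) (without-insertAll n τ (All.lookup n∉ τ∈) ∈τ))) ∷ disjoint ps n∉ u

at-map : ∀ (f : ℕ → ℕ) xs {i} → i ℕ.< length xs → at (map f xs) i ≡ f (at xs i)
at-map f (x ∷ xs) {zero} lt = refl
at-map f (x ∷ xs) {suc i} (s≤s lt) = at-map f xs lt

at-applyUpTo : ∀ f n {i} → i ℕ.< n → at (applyUpTo f n) i ≡ f i
at-applyUpTo f (suc n) {zero} lt = refl
at-applyUpTo f (suc n) {suc i} (s≤s lt) = at-applyUpTo (f ∘ suc) n lt

map-at-upTo : ∀ xs → map (at xs) (upTo (length xs)) ≡ xs
map-at-upTo xs = trans (map-upTo (at xs) (length xs)) (go xs)
  where
  go : ∀ xs → applyUpTo (at xs) (length xs) ≡ xs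
  go [] = refl
  go (x ∷ xs) = cong (x ∷_) (go xs)

at-∈ : ∀ xs {i} → i ℕ.< length xs → at xs i ∈ xs
at-∈ (x ∷ xs) {zero} lt = here refl
at-∈ (x ∷ xs) {suc i} (s≤s lt) = there (at-∈ xs lt)

at-indexOf : ∀ {j} xs → j ∈ xs → at xs (indexOf j xs) ≡ j
at-indexOf {j} (x ∷ xs) j∈ with j ≡ᵇ x in eq | j∈
... | true | _ = sym (≡ᵇ⇒≡ j x eq)
... | false | here refl = contradiction (trans (sym eq) (≡ᵇ-refl j)) (λ ())
... | false | there j∈ = at-indexOf xs j∈

indexOf-at : ∀ xs {i} → Unique xs → i ℕ.< length xs → indexOf (at xs i) xs ≡ i
indexOf-at (x ∷ xs) {zero} _ lt rewrite ≡ᵇ-refl x = refl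
indexOf-at (x ∷ xs) {suc i} (x∉ ∷ u) (s≤s lt) with at xs i ≡ᵇ x in eq
... | true = contradiction (sym (≡ᵇ⇒≡ (at xs i) x eq)) (All.lookup x∉ (at-∈ xs lt))
... | false = cong suc (indexOf-at xs u lt)

IsPerm : ℕ → List ℕ → Set
IsPerm n σ = σ ↭ upTo n

module _ {n : ℕ} where

  perm-length : ∀ {σ} → IsPerm n σ → length σ ≡ n
  perm-length p = trans (↭-length p) (length-upTo n)

  perm-All< : ∀ {σ} → IsPerm n σ → All (ℕ._< n) σ
  perm-All< p = All-resp-↭ (↭-sym p) (All.tabulate ∈-upTo⁻)

  perm-unique : ∀ {σ} → IsPerm n σ → Unique σ
  perm-unique p = Unique-resp-↭ (↭-sym p) (Unique.upTo⁺ n)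

  perm-at< : ∀ {σ i} → IsPerm n σ → i ℕ.< n → at σ i ℕ.< n
  perm-at< {σ} p lt = All.lookup (perm-All< p) (at-∈ σ (subst (_ ℕ.<_) (sym (perm-length p)) lt))

  perm-at-injective : ∀ {σ i j} → IsPerm n σ → i ℕ.< n → j ℕ.< n → at σ i ≡ at σ j → i ≡ j
  perm-at-injective {σ} p i< j< eq = trans (sym (indexOf-at σ (perm-unique p) (subst (_ ℕ.<_) (sym (perm-length p)) i<)))
    (trans (cong (λ x → indexOf x σ) eq) (indexOf-at σ (perm-unique p) (subst (_ ℕ.<_) (sym (perm-length p)) j<)))

  compose-identityʳ : ∀ {σ} → IsPerm n σ → compose σ (upTo n) ≡ σ
  compose-identityʳ {σ} p = trans (cong (λ k → map (at σ) (upTo k)) (sym (perm-length p))) (map-at-upTo σ)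

  compose-identityˡ : ∀ {σ} → IsPerm n σ → compose (upTo n) σ ≡ σ
  compose-identityˡ p = map-id-local (All.map (at-applyUpTo id n) (perm-All< p))

  compose-perm : ∀ {σ τ} → IsPerm n σ → IsPerm n τ → IsPerm n (compose σ τ)
  compose-perm {σ} p q = ↭-trans (map⁺ (at σ) q) (subst (_↭ upTo n) (sym (compose-identityʳ p)) p)

  compose-map : ∀ (f : ℕ → ℕ) {σ τ} → IsPerm n σ → IsPerm n τ → compose (map f σ) τ ≡ map f (compose σ τ)
  compose-map f {σ} {τ} p q = trans
    (map-cong-local (All.map (λ lt → at-map f σ (subst (_ ℕ.<_) (sym (perm-length p)) lt)) (perm-All< q)))
    (map-∘ τ)

  compose-assoc : ∀ {σ τ ρ} → IsPerm n τ → IsPerm n ρ → compose (compose σ τ) ρ ≡ compose σ (compose τ ρ)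
  compose-assoc {σ} q r = compose-map (at σ) q r

  map-indexOf : ∀ {σ} → IsPerm n σ → map (λ j → indexOf j σ) σ ≡ upTo n
  map-indexOf {σ} p = begin
    map (λ j → indexOf j σ) σ
      ≡⟨ cong (map (λ j → indexOf j σ)) (sym (compose-identityʳ p)) ⟩
    map (λ j → indexOf j σ) (map (at σ) (upTo n))
      ≡⟨ sym (map-∘ (upTo n)) ⟩
    map (λ i → indexOf (at σ i) σ) (upTo n)
      ≡⟨ map-id-local (All.tabulate (λ i∈ → indexOf-at σ (perm-unique p) (subst (_ ℕ.<_) (sym (perm-length p)) (∈-upTo⁻ i∈)))) ⟩
    upTo n ∎
    where open ≡-Reasoning

  inverse≡ : ∀ {σ} → IsPerm n σ → inverse σ ≡ map (λ j → indexOf j σ) (upTo n)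
  inverse≡ {σ} p = cong (λ k → map (λ j → indexOf j σ) (upTo k)) (perm-length p)

  inverse-perm : ∀ {σ} → IsPerm n σ → IsPerm n (inverse σ)
  inverse-perm {σ} p = ↭-trans (↭-reflexive (inverse≡ p))
    (↭-trans (map⁺ (λ j → indexOf j σ) (↭-sym p)) (↭-reflexive (map-indexOf p)))

  compose-inverseʳ : ∀ {σ} → IsPerm n σ → compose σ (inverse σ) ≡ upTo n
  compose-inverseʳ {σ} p = begin
    map (at σ) (inverse σ)
      ≡⟨ cong (map (at σ)) (inverse≡ p) ⟩
    map (at σ) (map (λ j → indexOf j σ) (upTo n))
      ≡⟨ sym (map-∘ (upTo n)) ⟩
    map (λ j → at σ (indexOf j σ)) (upTo n)
      ≡⟨ map-id-local (All.tabulate (λ j∈ → at-indexOf σ (∈-resp-↭ (↭-sym p) j∈))) ⟩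
    upTo n ∎
    where open ≡-Reasoning

  compose-inverseˡ : ∀ {σ} → IsPerm n σ → compose (inverse σ) σ ≡ upTo n
  compose-inverseˡ {σ} p = begin
    map (at (inverse σ)) σ
      ≡⟨ cong (λ l → map (at l) σ) (trans (inverse≡ p) (map-upTo (λ j → indexOf j σ) n)) ⟩
    map (at (applyUpTo (λ j → indexOf j σ) n)) σ
      ≡⟨ map-cong-local (All.map (at-applyUpTo (λ j → indexOf j σ) n) (perm-All< p)) ⟩
    map (λ j → indexOf j σ) σ
      ≡⟨ map-indexOf p ⟩
    upTo n ∎
    where open ≡-Reasoning

-- The group laws hold only for lists that are permutations, hence the restricted carrier; equality
-- compares the lists and ignores the proofs.
permGroup : ℕ → Group 0ℓ 0ℓ
permGroup n = record
  { Carrier = Σ (List ℕ) (IsPerm n)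
  ; _≈_ = _≡_ on proj₁
  ; _∙_ = λ (σ , p) (τ , q) → compose σ τ , compose-perm p q
  ; ε = upTo n , _↭_.refl
  ; _⁻¹ = λ (σ , p) → inverse σ , inverse-perm p
  ; isGroup = record
    { isMonoid = record
      { isSemigroup = record
        { isMagma = record
          { isEquivalence = record { refl = refl ; sym = sym ; trans = trans }
          ; ∙-cong = cong₂ compose
          }
        ; assoc = λ (σ , _) (_ , q) (_ , r) → compose-assoc {σ = σ} q r
        }
      ; identity = (λ (_ , p) → compose-identityˡ p) , (λ (_ , p) → compose-identityʳ p)
      }
    ; inverse = (λ (_ , p) → compose-inverseˡ p) , (λ (_ , p) → compose-inverseʳ p)
    ; ⁻¹-cong = cong inverse
    }
  }

-- K(π, τ) = Prob (quotient π τ).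
quotient : List ℕ → List ℕ → List ℕ
quotient π τ = inverse (compose τ (inverse π))

module _ {n : ℕ} where
  open Group (permGroup n) using (_∙_; _⁻¹; assoc; inverseˡ; inverseʳ; identityʳ; identityˡ; ∙-congˡ; ∙-congʳ) renaming (trans to ≈-trans; sym to ≈-sym; setoid to permSetoid)
  open import Algebra.Properties.Group (permGroup n) using (⁻¹-anti-homo-∙; ⁻¹-involutive)
  open import Relation.Binary.Reasoning.Setoid permSetoid

  quotient-perm : ∀ {π τ} → IsPerm n π → IsPerm n τ → IsPerm n (quotient π τ)
  quotient-perm p q = inverse-perm (compose-perm q (inverse-perm p))

  quotient≡ : ∀ {π τ} → IsPerm n π → IsPerm n τ → quotient π τ ≡ compose π (inverse τ)
  quotient≡ {π} {τ} p q = begin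
    (y ∙ x ⁻¹) ⁻¹       ≈⟨ ⁻¹-anti-homo-∙ y (x ⁻¹) ⟩
    (x ⁻¹) ⁻¹ ∙ y ⁻¹    ≈⟨ ∙-congʳ {y ⁻¹} {(x ⁻¹) ⁻¹} {x} (⁻¹-involutive x) ⟩
    x ∙ y ⁻¹            ∎
    where
    x = π , p
    y = τ , q

  -- So K moves from στ to τ with probability `Prob c n σ`.
  quotient-compose : ∀ {σ τ} → IsPerm n σ → IsPerm n τ → quotient (compose σ τ) τ ≡ σ
  quotient-compose {σ} {τ} p q = trans (quotient≡ (compose-perm p q) q) (begin
    (x ∙ y) ∙ y ⁻¹      ≈⟨ assoc x y (y ⁻¹) ⟩
    x ∙ (y ∙ y ⁻¹)      ≈⟨ ∙-congˡ {x} {y ∙ y ⁻¹} {Group.ε (permGroup n)} (inverseʳ y) ⟩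
    x ∙ Group.ε (permGroup n)  ≈⟨ identityʳ x ⟩
    x                   ∎)
    where
    x = σ , p
    y = τ , q

  compose-quotient : ∀ {π τ} → IsPerm n π → IsPerm n τ → compose (quotient π τ) τ ≡ π
  compose-quotient {π} {τ} p q = trans (cong (λ σ → compose σ τ) (quotient≡ p q)) (begin
    (x ∙ y ⁻¹) ∙ y      ≈⟨ assoc x (y ⁻¹) y ⟩
    x ∙ (y ⁻¹ ∙ y)      ≈⟨ ∙-congˡ {x} {y ⁻¹ ∙ y} {Group.ε (permGroup n)} (inverseˡ y) ⟩
    x ∙ Group.ε (permGroup n)  ≈⟨ identityʳ x ⟩
    x                   ∎)
    where
    x = π , p
    y = τ , q

  quotient-inverse-compose : ∀ {π ρ} → IsPerm n π → IsPerm n ρ → quotient π (compose (inverse ρ) π) ≡ ρ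
  quotient-inverse-compose {π} {ρ} p r = begin
    ((z ⁻¹ ∙ x) ∙ x ⁻¹) ⁻¹   ≈⟨ cong inverse (≈-trans {(z ⁻¹ ∙ x) ∙ x ⁻¹} {z ⁻¹ ∙ (x ∙ x ⁻¹)} {z ⁻¹} (assoc (z ⁻¹) x (x ⁻¹))
                                  (≈-trans {z ⁻¹ ∙ (x ∙ x ⁻¹)} {z ⁻¹ ∙ Group.ε (permGroup n)} {z ⁻¹}
                                    (∙-congˡ {z ⁻¹} {x ∙ x ⁻¹} {Group.ε (permGroup n)} (inverseʳ x)) (identityʳ (z ⁻¹)))) ⟩
    (z ⁻¹) ⁻¹                ≈⟨ ⁻¹-involutive z ⟩
    z                        ∎
    where
    x = π , p
    z = ρ , r

  inverse-quotient-compose : ∀ {π τ} → IsPerm n π → IsPerm n τ → compose (inverse (quotient π τ)) π ≡ τ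
  inverse-quotient-compose {π} {τ} p q = begin
    ((y ∙ x ⁻¹) ⁻¹) ⁻¹ ∙ x   ≈⟨ ∙-congʳ {x} {((y ∙ x ⁻¹) ⁻¹) ⁻¹} {y ∙ x ⁻¹} (⁻¹-involutive (y ∙ x ⁻¹)) ⟩
    (y ∙ x ⁻¹) ∙ x           ≈⟨ assoc y (x ⁻¹) x ⟩
    y ∙ (x ⁻¹ ∙ x)           ≈⟨ ∙-congˡ {y} {x ⁻¹ ∙ x} {Group.ε (permGroup n)} (inverseˡ x) ⟩
    y ∙ Group.ε (permGroup n)       ≈⟨ identityʳ y ⟩
    y                        ∎
    where
    x = π , p
    y = τ , q

  -- For fixed π the quotient runs through the group once as τ does, which yields the row sums of K;
  -- `∑-quotientˡ` likewise yields the column sums.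
  ∑-quotientʳ : ∀ {π} → IsPerm n π → ∀ (h : List ℕ → ℚ) → ∑ (perms n) (λ τ → h (quotient π τ)) ≡ ∑ (perms n) h
  ∑-quotientʳ {π} p h = trans (sym (∑-map (quotient π) (perms n) h)) (∑-↭ h (bijection-↭ (perms-unique n)
    (quotient π) (λ ρ → compose (inverse ρ) π)
    (λ τ∈ → ↭-∈perms n (quotient-perm p (perms-↭ n τ∈)))
    (λ ρ∈ → ↭-∈perms n (compose-perm (inverse-perm (perms-↭ n ρ∈)) p))
    (λ ρ∈ → quotient-inverse-compose p (perms-↭ n ρ∈)) (λ τ∈ → inverse-quotient-compose p (perms-↭ n τ∈))))

  ∑-quotientˡ : ∀ {τ} → IsPerm n τ → ∀ (h : List ℕ → ℚ) → ∑ (perms n) (λ π → h (quotient π τ)) ≡ ∑ (perms n) h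
  ∑-quotientˡ {τ} q h = trans (sym (∑-map (λ π → quotient π τ) (perms n) h)) (∑-↭ h (bijection-↭ (perms-unique n)
    (λ π → quotient π τ) (λ ρ → compose ρ τ)
    (λ π∈ → ↭-∈perms n (quotient-perm (perms-↭ n π∈) q))
    (λ ρ∈ → ↭-∈perms n (compose-perm (perms-↭ n ρ∈) q))
    (λ ρ∈ → quotient-compose (perms-↭ n ρ∈) q) (λ π∈ → compose-quotient (perms-↭ n π∈) q)))

-- Generation by the permutations with a given pattern

<⇒<ᵇ≡true : ∀ {m n} → m ℕ.< n → (m <ᵇ n) ≡ true
<⇒<ᵇ≡true {zero} {suc n} lt = refl
<⇒<ᵇ≡true {suc m} {suc n} (s≤s lt) = <⇒<ᵇ≡true lt

≤⇒<ᵇ≡false : ∀ {m n} → n ℕ.≤ m → (m <ᵇ n) ≡ false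
≤⇒<ᵇ≡false {m} z≤n = refl
≤⇒<ᵇ≡false (s≤s le) = ≤⇒<ᵇ≡false le

<ᵇ≡true⇒< : ∀ {m n} → (m <ᵇ n) ≡ true → m ℕ.< n
<ᵇ≡true⇒< {m} {n} eq = ℕ.<ᵇ⇒< m n (subst T (sym eq) _)

<ᵇ≡false⇒≤ : ∀ {m n} → (m <ᵇ n) ≡ false → n ℕ.≤ m
<ᵇ≡false⇒≤ eq = ℕ.≮⇒≥ λ lt → contradiction (trans (sym eq) (<⇒<ᵇ≡true lt)) λ ()

-- Step b x y says that the letter b occurs in the pattern of a word in which x is followed by y.
Step : Bool → ℕ → ℕ → Set
Step b x y = (y <ᵇ x) ≡ b

Step-trans : ∀ b {x y z} → Step b x y → Step b y z → Step b x z
Step-trans true {x} {y} {z} p q = <⇒<ᵇ≡true (ℕ.<-trans (<ᵇ≡true⇒< {z} {y} q) (<ᵇ≡true⇒< {y} {x} p))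
Step-trans false {x} {y} {z} p q = ≤⇒<ᵇ≡false (ℕ.≤-trans (<ᵇ≡false⇒≤ {y} {x} p) (<ᵇ≡false⇒≤ {z} {y} q))

Step-total : ∀ b {x y} → x ≢ y → Step b x y ⊎ Step b y x
Step-total b {x} {y} x≢y with ℕ.<-cmp x y
Step-total true x≢y | tri< lt _ _ = inj₂ (<⇒<ᵇ≡true lt)
Step-total false x≢y | tri< lt _ _ = inj₁ (≤⇒<ᵇ≡false (ℕ.<⇒≤ lt))
Step-total b x≢y | tri≈ _ eq _ = contradiction eq x≢y
Step-total true x≢y | tri> _ _ gt = inj₁ (<⇒<ᵇ≡true gt)
Step-total false x≢y | tri> _ _ gt = inj₂ (≤⇒<ᵇ≡false (ℕ.<⇒≤ gt))

-- On distinct numbers `Step b` is a total order; its first element is the maximum for `true` and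
-- the minimum for `false`.
extract-extreme : ∀ b y ys → Unique (y ∷ ys) →
  Σ ℕ λ m → Σ (List ℕ) λ rest → m ∷ rest ↭ y ∷ ys × All (Step b m) rest
extract-extreme b y [] _ = y , [] , _↭_.refl , []
extract-extreme b y (z ∷ zs) (y∉ ∷ u) with extract-extreme b z zs u
... | m , rest , p , ext with Step-total b {y} {m} (All.lookup y∉ (∈-resp-↭ p (here refl)))
...   | inj₁ st = y , z ∷ zs , _↭_.refl , All-resp-↭ p (st ∷ All.map (λ {x} → Step-trans b {y} {m} {x} st) ext)
...   | inj₂ st = m , y ∷ rest , ↭-trans (↭-swap m y _↭_.refl) (↭-prep y p) , st ∷ ext

-- Greedy choice: put the maximum of the remaining values before a descent and the minimum before an
-- ascent; then any continuation realises the letter.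
arrangement : ∀ d ys → Unique ys → length ys ≡ suc (length d) →
  Σ (List ℕ) λ w → w ↭ ys × pattern-of w ≡ d
arrangement [] (y ∷ []) _ _ = y ∷ [] , _↭_.refl , refl
arrangement (b ∷ d) (y ∷ ys) u len with extract-extreme b y ys u
... | m , rest , p , ext with Unique-resp-↭ (↭-sym p) u
...   | _ ∷ u′ with arrangement d rest u′ (ℕ.suc-injective (trans (↭-length p) len))
...     | [] , q , pat = contradiction (trans (ℕ.suc-injective (trans (↭-length p) len)) refl)
            (subst (_≢ suc (length d)) (↭-length q) λ ())
...     | x ∷ w , q , refl = m ∷ x ∷ w , ↭-trans (↭-prep m q) p ,
            cong (_∷ pattern-of (x ∷ w)) (All.lookup ext (∈-resp-↭ q (here refl)))

pattern-++ : ∀ b c e x w y v → All (λ z → Step b z e) (x ∷ w) → All (Step c e) (y ∷ v) →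
  pattern-of ((x ∷ w) ++ e ∷ y ∷ v) ≡ pattern-of (x ∷ w) ++ b ∷ c ∷ pattern-of (y ∷ v)
pattern-++ b c e x [] y v (p ∷ _) (q ∷ _) = cong₂ (λ b c → b ∷ c ∷ pattern-of (y ∷ v)) p q
pattern-++ b c e x (z ∷ w) y v (_ ∷ ps) qs = cong ((z <ᵇ x) ∷_) (pattern-++ b c e z w y v ps qs)

pattern-map : ∀ (f : ℕ → ℕ) (P : ℕ → Set) → (∀ {x y} → P x → P y → x ℕ.< y → f x ℕ.< f y) →
  ∀ w → All P w → pattern-of (map f w) ≡ pattern-of w
pattern-map f P mono [] _ = refl
pattern-map f P mono (x ∷ []) _ = refl
pattern-map f P mono (x ∷ y ∷ w) (px ∷ py ∷ pw) = cong₂ _∷_ step (pattern-map f P mono (y ∷ w) (py ∷ pw))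
  where
  step : (f y <ᵇ f x) ≡ (y <ᵇ x)
  step with ℕ.<-cmp y x
  ... | tri< lt _ _ = trans (<⇒<ᵇ≡true (mono py px lt)) (sym (<⇒<ᵇ≡true lt))
  ... | tri≈ _ refl _ = trans (≤⇒<ᵇ≡false (ℕ.≤-refl {f x})) (sym (≤⇒<ᵇ≡false (ℕ.≤-refl {x})))
  ... | tri> _ _ gt = trans (≤⇒<ᵇ≡false (ℕ.<⇒≤ (mono px py gt))) (sym (≤⇒<ᵇ≡false (ℕ.<⇒≤ gt)))

-- Transpositions of values

transpose : ℕ → ℕ → ℕ → ℕ
transpose a b x with x ℕ.≟ a | x ℕ.≟ b
... | yes _ | _ = b
... | no _ | yes _ = a
... | no _ | no _ = x

transpose-left : ∀ a b → transpose a b a ≡ b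
transpose-left a b with a ℕ.≟ a
... | yes _ = refl
... | no ne = contradiction refl ne

transpose-right : ∀ a b → transpose a b b ≡ a
transpose-right a b with b ℕ.≟ a | b ℕ.≟ b
... | yes eq | _ = eq
... | no _ | yes _ = refl
... | no _ | no ne = contradiction refl ne

transpose-other : ∀ {a b x} → x ≢ a → x ≢ b → transpose a b x ≡ x
transpose-other {a} {b} {x} ne ne′ with x ℕ.≟ a | x ℕ.≟ b
... | yes eq | _ = contradiction eq ne
... | no _ | yes eq = contradiction eq ne′
... | no _ | no _ = refl

transpose-elim : ∀ a b (P : ℕ → ℕ → Set) → P a b → P b a → (∀ x → x ≢ a → x ≢ b → P x x) → ∀ x → P x (transpose a b x)
transpose-elim a b P pa pb po x with x ℕ.≟ a | x ℕ.≟ b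
... | yes refl | _ = pa
... | no _ | yes refl = pb
... | no ne | no ne′ = po x ne ne′

transpose-involutive : ∀ a b x → transpose a b (transpose a b x) ≡ x
transpose-involutive a b = transpose-elim a b (λ x y → transpose a b y ≡ x)
  (transpose-right a b) (transpose-left a b) (λ _ → transpose-other)

transpose-comm : ∀ a b x → transpose b a x ≡ transpose a b x
transpose-comm a b = transpose-elim a b (λ x y → transpose b a x ≡ y)
  (transpose-right b a) (transpose-left b a) (λ _ ne ne′ → transpose-other ne′ ne)

transpose-conjugate : ∀ {a b c} → a ≢ b → b ≢ c → a ≢ c → ∀ x →
  transpose a b (transpose b c (transpose a b x)) ≡ transpose a c x
transpose-conjugate {a} {b} {c} a≢b b≢c a≢c = transpose-elim a b
  (λ x y → transpose a b (transpose b c y) ≡ transpose a c x)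
  (trans (cong (transpose a b) (transpose-left b c)) (trans (transpose-other (≢-sym a≢c) (≢-sym b≢c)) (sym (transpose-left a c))))
  (trans (cong (transpose a b) (transpose-other a≢b a≢c)) (trans (transpose-left a b) (sym (transpose-other (≢-sym a≢b) b≢c))))
  (λ x x≢a x≢b → transpose-elim b c (λ x y → x ≢ a → x ≢ b → transpose a b y ≡ transpose a c x)
    (λ _ ne → contradiction refl ne)
    (λ _ _ → trans (transpose-right a b) (sym (transpose-right a c)))
    (λ x x≢b x≢c x≢a _ → trans (transpose-other x≢a x≢b) (sym (transpose-other x≢a x≢c))) x x≢a x≢b)

transpose-< : ∀ {n a b x} → a ℕ.< n → b ℕ.< n → x ℕ.< n → transpose a b x ℕ.< n
transpose-< {n} {a} {b} {x} a<n b<n = transpose-elim a b (λ x y → x ℕ.< n → y ℕ.< n) (λ _ → b<n) (λ _ → a<n) (λ _ _ _ lt → lt) x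

transpose-perm : ∀ {n a b} → a ℕ.< n → b ℕ.< n → ∀ {τ} → IsPerm n τ → IsPerm n (map (transpose a b) τ)
transpose-perm {n} {a} {b} a<n b<n p = ↭-trans (map⁺ (transpose a b) p)
  (bijection-↭ (Unique.upTo⁺ n) (transpose a b) (transpose a b) bound bound
    (λ {x} _ → transpose-involutive a b x) (λ {x} _ → transpose-involutive a b x))
  where
  bound : ∀ {x} → x ∈ upTo n → transpose a b x ∈ upTo n
  bound x∈ = ∈-upTo⁺ (transpose-< a<n b<n (∈-upTo⁻ x∈))

-- No number lies strictly between v and v + 1, so exchanging them preserves the order on any set
-- that misses one of the two.
transpose-suc-mono₁ : ∀ v {x y} → x ≢ suc v → y ≢ suc v → x ℕ.< y → transpose v (suc v) x ℕ.< transpose v (suc v) y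
transpose-suc-mono₁ v {x} {y} = transpose-elim v (suc v)
  (λ x x′ → x ≢ suc v → y ≢ suc v → x ℕ.< y → x′ ℕ.< transpose v (suc v) y)
  (λ _ y≢ lt → subst (suc v ℕ.<_) (sym (transpose-other (≢-sym (ℕ.<⇒≢ lt)) y≢)) (ℕ.≤∧≢⇒< lt (≢-sym y≢)))
  (λ ne → contradiction refl ne)
  (λ x x≢v x≢sv _ → transpose-elim v (suc v) (λ y y′ → y ≢ suc v → x ℕ.< y → x ℕ.< y′)
    (λ _ lt → ℕ.m<n⇒m<1+n lt) (λ ne → contradiction refl ne) (λ _ _ _ _ lt → lt) y) x

transpose-suc-mono₂ : ∀ v {x y} → x ≢ v → y ≢ v → x ℕ.< y → transpose v (suc v) x ℕ.< transpose v (suc v) y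
transpose-suc-mono₂ v {x} {y} = transpose-elim v (suc v)
  (λ x x′ → x ≢ v → y ≢ v → x ℕ.< y → x′ ℕ.< transpose v (suc v) y)
  (λ ne → contradiction refl ne)
  (λ _ y≢ lt → subst (v ℕ.<_) (sym (transpose-other y≢ (≢-sym (ℕ.<⇒≢ lt)))) (ℕ.<-trans (ℕ.n<1+n v) lt))
  (λ x x≢v x≢sv _ → transpose-elim v (suc v) (λ y y′ → y ≢ v → x ℕ.< y → x ℕ.< y′)
    (λ ne → contradiction refl ne) (λ _ lt → ℕ.≤∧≢⇒< (ℕ.≤-pred lt) x≢v) (λ _ _ _ _ lt → lt) y) x

remove-∈ : ∀ {x : ℕ} {xs} → x ∈ xs → Σ (List ℕ) λ ys → x ∷ ys ↭ xs
remove-∈ {x} x∈ with ys , zs , refl ← ∈-∃++ x∈ = ys ++ zs , ↭-sym (shift x ys zs)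

mixed-split : ∀ {d} → Mixed d → Σ Bool λ b → Σ Word λ dL → Σ Word λ dR → d ≡ dL ++ b ∷ not b ∷ dR
mixed-split (here b d) = b , [] , d , refl
mixed-split (there c m) with b , dL , dR , eq ← mixed-split m = b , c ∷ dL , dR , cong (c ∷_) eq

-- For b = false the extreme value is the maximum n - 1, which can sit on top of an ascent followed by a descent;
-- for b = true it is the minimum 0.
record Extreme (n : ℕ) (b : Bool) : Set where
  field
    e e′ v₀ : ℕ
    e<n : e ℕ.< n
    e′<n : e′ ℕ.< n
    e′≢e : e′ ≢ e
    v₀<n : suc v₀ ℕ.< n
    v₀≢e : v₀ ≢ e
    sv₀≢e : suc v₀ ≢ e
    step-to : ∀ {x} → x ℕ.< n → x ≢ e → Step b x e
    step-from : ∀ {x} → x ℕ.< n → x ≢ e → Step (not b) e x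
    outside : ∀ {x y} → x ℕ.< y → y ℕ.< n → x ≢ e → y ≢ e → e ℕ.< x ⊎ y ℕ.< e
    interior : ∀ {j} → 0 ℕ.< j → suc j ℕ.< n → j ≢ e × j ≢ e′

-- The word `b ∷ not b ∷ []` already needs three values. The number e′ is the opposite end of the
-- range, so that an interior position differs from both e and e′; v₀ serves when any admissible v
-- will do.
extreme : ∀ k b → Extreme (3 ℕ.+ k) b
extreme k true = record
  { e = 0 ; e′ = 2 ℕ.+ k ; v₀ = 1
  ; e<n = s≤s z≤n ; e′<n = ℕ.≤-refl ; e′≢e = λ ()
  ; v₀<n = s≤s (s≤s (s≤s z≤n)) ; v₀≢e = λ () ; sv₀≢e = λ ()
  ; step-to = λ { {zero} _ ne → contradiction refl ne ; {suc x} _ _ → refl }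
  ; step-from = λ _ _ → refl
  ; outside = λ _ _ x≢ _ → inj₁ (ℕ.n≢0⇒n>0 x≢)
  ; interior = λ 0<j lt → (λ { refl → ℕ.<-irrefl refl 0<j }) , (λ { refl → ℕ.<-irrefl refl lt })
  }
extreme k false = record
  { e = 2 ℕ.+ k ; e′ = 0 ; v₀ = 0
  ; e<n = ℕ.≤-refl ; e′<n = s≤s z≤n ; e′≢e = λ ()
  ; v₀<n = s≤s (s≤s z≤n) ; v₀≢e = λ () ; sv₀≢e = λ ()
  ; step-to = λ lt _ → ≤⇒<ᵇ≡false (ℕ.≤-pred lt)
  ; step-from = λ lt ne → <⇒<ᵇ≡true (ℕ.≤∧≢⇒< (ℕ.≤-pred lt) ne)
  ; outside = λ _ lt _ y≢ → inj₂ (ℕ.≤∧≢⇒< (ℕ.≤-pred lt) y≢)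
  ; interior = λ 0<j lt → (λ { refl → ℕ.<-irrefl refl lt }) , (λ { refl → ℕ.<-irrefl refl 0<j })
  }

module _ {n : ℕ} where

  compose-compose-inverse : ∀ {σ τ} → IsPerm n σ → IsPerm n τ → compose σ (compose (inverse σ) τ) ≡ τ
  compose-compose-inverse {σ} {τ} p q = trans (sym (compose-assoc {σ = σ} (inverse-perm p) q))
    (trans (cong (λ l → compose l τ) (compose-inverseʳ p)) (compose-identityˡ q))

  perm-pattern-++ : ∀ {b} (X : Extreme n b) → ∀ x w y v →
    IsPerm n ((x ∷ w) ++ Extreme.e X ∷ y ∷ v) →
    pattern-of ((x ∷ w) ++ Extreme.e X ∷ y ∷ v) ≡ pattern-of (x ∷ w) ++ b ∷ not b ∷ pattern-of (y ∷ v)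
  perm-pattern-++ {b} X x w y v p = pattern-++ b (not b) e x w y v
    (All.zipWith (λ (lt , ne) → step-to lt ne) (All.++⁻ˡ (x ∷ w) lts , All.map ≢-sym (All.++⁻ˡ (x ∷ w) nes)))
    (All.zipWith (λ (lt , ne) → step-from lt ne) (All.tail (All.++⁻ʳ (x ∷ w) lts) , All.map ≢-sym (All.++⁻ʳ (x ∷ w) nes)))
    where
    open Extreme X
    lts = perm-All< p
    nes : All (e ≢_) ((x ∷ w) ++ y ∷ v)
    nes with ne ∷ _ ← Unique-resp-↭ (shift e (x ∷ w) (y ∷ v)) (perm-unique p) = ne

  module _ {A : Set} (H : List ℕ → A) where

    -- `map g τ` is left multiplication by g. As g is a bare function on values, `at σ` and
    -- `transpose a b` are covered alike.
    Invariant : (ℕ → ℕ) → Set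
    Invariant g = ∀ {τ} → IsPerm n τ → H (map g τ) ≡ H τ

    invariant-cong : ∀ {f g} → (∀ x → f x ≡ g x) → Invariant f → Invariant g
    invariant-cong eq inv {τ} p = trans (cong H (map-cong-local (All.tabulate (λ {x} _ → sym (eq x))))) (inv p)

    -- s is the product of sσ with the inverse of σ.
    invariant-left : ∀ {σ s} → IsPerm n σ → Invariant (at σ) → Invariant (at (map s σ)) → Invariant s
    invariant-left {σ} {s} p inv inv′ {τ} q = begin
      H (map s τ)                     ≡⟨ cong (H ∘ map s) (sym factor) ⟩
      H (map s (compose σ ρ))         ≡⟨ cong H (sym (compose-map s p r)) ⟩
      H (compose (map s σ) ρ)         ≡⟨ inv′ r ⟩
      H ρ                             ≡⟨ sym (inv r) ⟩
      H (compose σ ρ)                 ≡⟨ cong H factor ⟩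
      H τ                             ∎
      where
      open ≡-Reasoning
      ρ = compose (inverse σ) τ
      r = compose-perm (inverse-perm p) q
      factor = compose-compose-inverse p q

    -- The commutation hypothesis says that g is the conjugate of g′ by σ.
    invariant-conjugate : ∀ {σ g g′} → IsPerm n σ → Invariant (at σ) → Invariant g′ →
      (∀ {τ} → IsPerm n τ → IsPerm n (map g′ τ)) → (∀ {j} → j ℕ.< n → g (at σ j) ≡ at σ (g′ j)) → Invariant g
    invariant-conjugate {σ} {g} {g′} p inv inv′ perm′ comm {τ} q = begin
      H (map g τ)                     ≡⟨ cong (H ∘ map g) (sym factor) ⟩
      H (map g (compose σ ρ))         ≡⟨ cong H (sym (map-∘ ρ)) ⟩
      H (map (λ j → g (at σ j)) ρ)    ≡⟨ cong H (map-cong-local (All.map comm (perm-All< r))) ⟩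
      H (map (λ j → at σ (g′ j)) ρ)   ≡⟨ cong H (map-∘ ρ) ⟩
      H (compose σ (map g′ ρ))        ≡⟨ inv (perm′ r) ⟩
      H (map g′ ρ)                    ≡⟨ inv′ r ⟩
      H ρ                             ≡⟨ sym (inv r) ⟩
      H (compose σ ρ)                 ≡⟨ cong H factor ⟩
      H τ                             ∎
      where
      open ≡-Reasoning
      ρ = compose (inverse σ) τ
      r = compose-perm (inverse-perm p) q
      factor = compose-compose-inverse p q

    invariant-chain : ∀ {a b c} → a ℕ.< n → b ℕ.< n → c ℕ.< n → a ≢ b → b ≢ c → a ≢ c →
      Invariant (transpose a b) → Invariant (transpose b c) → Invariant (transpose a c)
    invariant-chain {a} {b} {c} a<n b<n c<n a≢b b≢c a≢c inv inv′ {τ} p = begin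
      H (map (transpose a c) τ)
        ≡⟨ cong H (map-cong-local (All.tabulate (λ {x} _ → sym (transpose-conjugate a≢b b≢c a≢c x)))) ⟩
      H (map (λ x → transpose a b (transpose b c (transpose a b x))) τ)
        ≡⟨ cong H (trans (map-∘ τ) (map-∘ (map (transpose a b) τ))) ⟩
      H (map (transpose a b) (map (transpose b c) (map (transpose a b) τ)))
        ≡⟨ inv (transpose-perm b<n c<n (transpose-perm a<n b<n p)) ⟩
      H (map (transpose b c) (map (transpose a b) τ))
        ≡⟨ inv′ (transpose-perm a<n b<n p) ⟩
      H (map (transpose a b) τ)
        ≡⟨ inv p ⟩
      H τ ∎
      where open ≡-Reasoning

    -- A derivation of `σ ↭ τ` is built from swaps of neighbouring entries. In a word without
    -- repetitions such a swap is left multiplication by the transposition of the two values; `pre`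
    -- is the prefix already passed.
    constant : (∀ {a b} → a ℕ.< n → b ℕ.< n → a ≢ b → Invariant (transpose a b)) →
      ∀ {σ τ} → IsPerm n σ → IsPerm n τ → H σ ≡ H τ
    constant inv p q = go [] (↭-trans p (↭-sym q)) p
      where
      open ≡-Reasoning
      go : ∀ pre {xs ys} → xs ↭ ys → IsPerm n (pre ++ xs) → H (pre ++ xs) ≡ H (pre ++ ys)
      go pre _↭_.refl p = refl
      go pre (_↭_.prep {xs} {ys} x r) p = begin
        H (pre ++ x ∷ xs)          ≡⟨ cong H (sym (++-assoc pre [ x ] xs)) ⟩
        H ((pre ++ [ x ]) ++ xs)   ≡⟨ go (pre ++ [ x ]) r (subst (IsPerm n) (sym (++-assoc pre [ x ] xs)) p) ⟩
        H ((pre ++ [ x ]) ++ ys)   ≡⟨ cong H (++-assoc pre [ x ] ys) ⟩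
        H (pre ++ x ∷ ys)          ∎
      go pre (_↭_.swap {xs} {ys} x y r) p = begin
        H (pre ++ x ∷ y ∷ xs)                       ≡⟨ sym (inv x<n y<n x≢y p) ⟩
        H (map (transpose x y) (pre ++ x ∷ y ∷ xs)) ≡⟨ cong H swapped ⟩
        H (pre ++ y ∷ x ∷ xs)                       ≡⟨ cong H (sym (++-assoc pre (y ∷ x ∷ []) xs)) ⟩
        H ((pre ++ y ∷ x ∷ []) ++ xs)               ≡⟨ go (pre ++ y ∷ x ∷ []) r (subst (IsPerm n) (sym (++-assoc pre (y ∷ x ∷ []) xs))
                                                        (subst (IsPerm n) swapped (transpose-perm x<n y<n p))) ⟩
        H ((pre ++ y ∷ x ∷ []) ++ ys)               ≡⟨ cong H (++-assoc pre (y ∷ x ∷ []) ys) ⟩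
        H (pre ++ y ∷ x ∷ ys)                       ∎
        where
        lts : All (ℕ._< n) (x ∷ y ∷ xs)
        lts = All.++⁻ʳ pre (perm-All< p)
        x<n = All.head lts
        y<n = All.head (All.tail lts)
        unique₁ : Unique (x ∷ (pre ++ y ∷ xs))
        unique₁ = Unique-resp-↭ (shift x pre (y ∷ xs)) (perm-unique p)
        unique₂ : Unique (y ∷ x ∷ (pre ++ xs))
        unique₂ = Unique-resp-↭ (↭-trans (↭-prep x (shift y pre xs)) (↭-swap x y _↭_.refl)) unique₁
        y∉ : All (y ≢_) (x ∷ (pre ++ xs))
        y∉ with z ∷ _ ← unique₂ = z
        x∉ : All (x ≢_) (pre ++ xs)
        x∉ with _ ∷ z ∷ _ ← unique₂ = z
        x≢y : x ≢ y
        x≢y = ≢-sym (All.head y∉)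
        fixed : All (λ z → transpose x y z ≡ z) (pre ++ xs)
        fixed = All.zipWith (λ (ne , ne′) → transpose-other (≢-sym ne) (≢-sym ne′)) (x∉ , All.tail y∉)
        swapped : map (transpose x y) (pre ++ x ∷ y ∷ xs) ≡ pre ++ y ∷ x ∷ xs
        swapped = trans (map-++ (transpose x y) pre (x ∷ y ∷ xs)) (cong₂ _++_ (map-id-local (All.++⁻ˡ pre fixed))
          (cong₂ _∷_ (transpose-left x y) (cong₂ _∷_ (transpose-right x y) (map-id-local (All.++⁻ʳ pre fixed)))))
      go pre (_↭_.trans r s) p = trans (go pre r p) (go pre s (↭-trans (++⁺ˡ pre (↭-sym r)) p))

-- v and v + 1 lie on different sides of e. Only the avoidance is recorded, because it makes the
-- exchange monotone on each side.
record Separated (n e v : ℕ) (dL dR : Word) : Set where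
  field
    x : ℕ
    xs : List ℕ
    y : ℕ
    ys : List ℕ
    isPerm : IsPerm n ((x ∷ xs) ++ e ∷ y ∷ ys)
    patternˡ : pattern-of (x ∷ xs) ≡ dL
    patternʳ : pattern-of (y ∷ ys) ≡ dR
    avoidˡ : All (_≢ suc v) (x ∷ xs)
    avoidʳ : All (_≢ v) (y ∷ ys)

separate : ∀ {n e v} dL dR → n ≡ 3 ℕ.+ (length dL ℕ.+ length dR) → e ℕ.< n → suc v ℕ.< n → v ≢ e → suc v ≢ e →
  Separated n e v dL dR
separate {n} {e} {v} dL dR n≡ e<n v<n v≢e sv≢e
  with ys₁ , p₁ ← remove-∈ (∈-upTo⁺ e<n)
  with v∈ ← ∈-resp-↭ (↭-sym p₁) (∈-upTo⁺ (ℕ.<⇒≤ v<n)) | sv∈ ← ∈-resp-↭ (↭-sym p₁) (∈-upTo⁺ v<n)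
  with ys₂ , p₂ ← remove-∈ (Any.tail v≢e v∈)
  with rest , p₃ ← remove-∈ (Any.tail (λ eq → ℕ.<-irrefl (sym eq) (ℕ.n<1+n v)) (∈-resp-↭ (↭-sym p₂) (Any.tail sv≢e sv∈)))
  with total ← ↭-trans (↭-prep e (↭-trans (↭-prep v p₃) p₂)) p₁
  with e∉ ∷ (v≢sv ∷ v∉) ∷ sv∉ ∷ u ← Unique-resp-↭ (↭-sym total) (Unique.upTo⁺ n)
  with len ← ℕ.suc-injective (ℕ.suc-injective (ℕ.suc-injective (trans (↭-length total) (trans (length-upTo n) n≡))))
  -- Of the values other than e, v and v + 1, the first |dL| join v on the left and the others join
  -- v + 1 on the right.
  with arrangement dL (v ∷ take (length dL) rest) (All.take⁺ (length dL) v∉ ∷ Unique.take⁺ (length dL) u)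
         (cong suc (trans (length-take (length dL) rest) (trans (cong (length dL ℕ.⊓_) len) (ℕ.m≤n⇒m⊓n≡m (ℕ.m≤m+n _ _)))))
     | arrangement dR (suc v ∷ drop (length dL) rest) (All.drop⁺ (length dL) sv∉ ∷ Unique.drop⁺ (length dL) u)
         (cong suc (trans (length-drop (length dL) rest) (trans (cong (ℕ._∸ length dL) len) (ℕ.m+n∸m≡n (length dL) (length dR)))))
... | [] , q , _ | _ = contradiction (↭-length q) λ ()
... | x ∷ xs , _ , _ | [] , r , _ = contradiction (↭-length r) λ ()
... | x ∷ xs , q , refl | y ∷ ys , r , refl = record
  { isPerm = ↭-trans (shift e (x ∷ xs) (y ∷ ys)) (↭-trans (↭-prep e (↭-trans (++⁺ q r) (↭-prep v (↭-trans
      (shift (suc v) (take (length (pattern-of (x ∷ xs))) rest) (drop (length (pattern-of (x ∷ xs))) rest))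
      (↭-prep (suc v) (↭-reflexive (take++drop≡id (length (pattern-of (x ∷ xs))) rest))))))) total)
  ; patternˡ = refl
  ; patternʳ = refl
  ; avoidˡ = All-resp-↭ (↭-sym q) (v≢sv ∷ All.map ≢-sym (All.take⁺ (length (pattern-of (x ∷ xs))) sv∉))
  ; avoidʳ = All-resp-↭ (↭-sym r) (≢-sym v≢sv ∷ All.map ≢-sym (All.drop⁺ (length (pattern-of (x ∷ xs))) v∉))
  }

at-++ : ∀ xs {z zs} → at (xs ++ z ∷ zs) (length xs) ≡ z
at-++ [] = refl
at-++ (x ∷ xs) = at-++ xs

-- The permutations with a given nonconstant pattern generate the symmetric group: they yield the adjacent
-- transpositions that avoid an extreme value e, and conjugation by one of them moves e.
module _ {A : Set} (H : List ℕ → A) (n : ℕ) (b : Bool) (X : Extreme n b) (dL dR : Word) (n≡ : n ≡ 3 ℕ.+ (length dL ℕ.+ length dR))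
  (H-invariant : ∀ {σ} → IsPerm n σ → pattern-of σ ≡ dL ++ b ∷ not b ∷ dR → Invariant {n} H (at σ)) where

  private
    open Extreme X

    pattern-separated : ∀ {v} (s : Separated n e v dL dR) →
      pattern-of ((Separated.x s ∷ Separated.xs s) ++ e ∷ Separated.y s ∷ Separated.ys s) ≡ dL ++ b ∷ not b ∷ dR
    pattern-separated s = trans (perm-pattern-++ X x xs y ys isPerm)
      (cong₂ (λ l r → l ++ b ∷ not b ∷ r) patternˡ patternʳ)
      where open Separated s

    -- Both σ and its product with the transposition have the prescribed pattern: comparisons with e
    -- are unaffected, and neither side contains both v and v + 1.
    adjacent-of : ∀ {v} → Separated n e v dL dR → suc v ℕ.< n → v ≢ e → suc v ≢ e → Invariant {n} H (transpose v (suc v))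
    adjacent-of {v} s lt v≢e sv≢e = invariant-left H isPerm (H-invariant isPerm (pattern-separated s))
      (H-invariant perm′ (trans (cong pattern-of map≡) (trans
        (perm-pattern-++ X (t x) (map t xs) (t y) (map t ys) (subst (IsPerm n) map≡ perm′))
        (cong₂ (λ l r → l ++ b ∷ not b ∷ r)
          (trans (pattern-map t (_≢ suc v) (transpose-suc-mono₁ v) (x ∷ xs) avoidˡ) patternˡ)
          (trans (pattern-map t (_≢ v) (transpose-suc-mono₂ v) (y ∷ ys) avoidʳ) patternʳ)))))
      where
      open Separated s
      t = transpose v (suc v)
      perm′ = transpose-perm (ℕ.<⇒≤ lt) lt isPerm
      map≡ : map t ((x ∷ xs) ++ e ∷ y ∷ ys) ≡ map t (x ∷ xs) ++ e ∷ map t (y ∷ ys)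
      map≡ = trans (map-++ t (x ∷ xs) (e ∷ y ∷ ys)) (cong (λ z → map t (x ∷ xs) ++ z ∷ map t (y ∷ ys))
        (transpose-other (≢-sym v≢e) (≢-sym sv≢e)))

    adjacent : ∀ v → suc v ℕ.< n → v ≢ e → suc v ≢ e → Invariant {n} H (transpose v (suc v))
    adjacent v lt v≢e sv≢e = adjacent-of (separate dL dR n≡ e<n lt v≢e sv≢e) lt v≢e sv≢e

    -- Adjacent transpositions are chained upwards from a to c; e lies outside the range, so none of
    -- them touches it.
    interval : ∀ a c → a ℕ.< c → c ℕ.< n → e ℕ.< a ⊎ c ℕ.< e → Invariant {n} H (transpose a c)
    interval a (suc c) (s≤s a≤c) c<n out with a ℕ.≟ c
    ... | yes refl = adjacent a c<n (ne out) (ne′ out)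
      where
      ne : e ℕ.< a ⊎ suc a ℕ.< e → a ≢ e
      ne (inj₁ lt) refl = ℕ.<-irrefl refl lt
      ne (inj₂ lt) refl = ℕ.<-asym lt (ℕ.n<1+n a)
      ne′ : e ℕ.< a ⊎ suc a ℕ.< e → suc a ≢ e
      ne′ (inj₁ lt) eq = ℕ.<-asym (subst (ℕ._< a) (sym eq) lt) (ℕ.n<1+n a)
      ne′ (inj₂ lt) eq = ℕ.<-irrefl eq lt
    ... | no a≢c = invariant-chain H (ℕ.<-trans a<c (ℕ.<⇒≤ c<n)) (ℕ.<⇒≤ c<n) c<n a≢c (ℕ.<⇒≢ (ℕ.n<1+n c)) (ℕ.<⇒≢ (s≤s a≤c))
        (interval a c a<c (ℕ.<⇒≤ c<n) (weaken out)) (adjacent c c<n (ne out) (ne′ out))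
      where
      a<c = ℕ.≤∧≢⇒< a≤c a≢c
      weaken : e ℕ.< a ⊎ suc c ℕ.< e → e ℕ.< a ⊎ c ℕ.< e
      weaken (inj₁ lt) = inj₁ lt
      weaken (inj₂ lt) = inj₂ (ℕ.<⇒≤ lt)
      ne : e ℕ.< a ⊎ suc c ℕ.< e → c ≢ e
      ne (inj₁ lt) eq = ℕ.<-irrefl (sym eq) (ℕ.<-trans lt a<c)
      ne (inj₂ lt) eq = ℕ.<-irrefl eq (ℕ.<⇒≤ lt)
      ne′ : e ℕ.< a ⊎ suc c ℕ.< e → suc c ≢ e
      ne′ (inj₁ lt) eq = ℕ.<-irrefl (sym eq) (ℕ.<-≤-trans lt (ℕ.m≤n⇒m≤1+n a≤c))
      ne′ (inj₂ lt) eq = ℕ.<-irrefl eq lt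

    avoiding : ∀ {a c} → a ℕ.< n → c ℕ.< n → a ≢ e → c ≢ e → a ≢ c → Invariant {n} H (transpose a c)
    avoiding {a} {c} a<n c<n a≢e c≢e a≢c with ℕ.<-cmp a c
    ... | tri< lt _ _ = interval a c lt c<n (outside lt c<n a≢e c≢e)
    ... | tri≈ _ eq _ = contradiction eq a≢c
    ... | tri> _ _ gt = invariant-cong H (transpose-comm a c) (interval c a gt a<n (outside gt a<n c≢e a≢e))

    -- Here e′ and j act as positions, j being that of e in σ. The transposition of e′ and j avoids
    -- the number e, and its conjugate by σ exchanges σ(e′) with e.
    moving-of : ∀ {v} → Separated n e v dL dR → Σ ℕ λ z → z ℕ.< n × z ≢ e × Invariant {n} H (transpose z e)
    moving-of s = z , perm-at< isPerm e′<n , z≢e ,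
      invariant-conjugate H {σ} {g′ = transpose e′ j} isPerm (H-invariant isPerm (pattern-separated s))
        (avoiding e′<n j<n e′≢e (proj₁ j≢) (≢-sym (proj₂ j≢))) (transpose-perm e′<n j<n) (λ {i} → commutes i)
      where
      open Separated s
      σ = (x ∷ xs) ++ e ∷ y ∷ ys
      j = length (x ∷ xs)
      z = at σ e′
      σj≡e : at σ j ≡ e
      σj≡e = at-++ (x ∷ xs)
      sj<n : suc j ℕ.< n
      sj<n = subst (suc j ℕ.<_) (trans (sym (length-++ (x ∷ xs))) (perm-length isPerm))
        (subst (2 ℕ.+ j ℕ.≤_) (sym (trans (ℕ.+-suc j (suc (length ys))) (cong suc (ℕ.+-suc j (length ys))))) (s≤s (s≤s (ℕ.m≤m+n j (length ys)))))
      j<n = ℕ.<⇒≤ sj<n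
      j≢ = interior (s≤s z≤n) sj<n
      z≢e : z ≢ e
      z≢e eq = proj₂ j≢ (sym (perm-at-injective isPerm e′<n j<n (trans eq (sym σj≡e))))
      commutes : ∀ i → i ℕ.< n → transpose z e (at σ i) ≡ at σ (transpose e′ j i)
      commutes = transpose-elim e′ j (λ i i′ → i ℕ.< n → transpose z e (at σ i) ≡ at σ i′)
        (λ _ → trans (transpose-left z e) (sym σj≡e))
        (λ _ → trans (cong (transpose z e) σj≡e) (transpose-right z e))
        (λ i i≢e′ i≢j i<n → transpose-other (λ eq → i≢e′ (perm-at-injective isPerm i<n e′<n eq))
          (λ eq → i≢j (perm-at-injective isPerm i<n j<n (trans eq (sym σj≡e)))))

    to-e-of : ∀ {z} → z ℕ.< n → z ≢ e → Invariant {n} H (transpose z e) → ∀ {a} → a ℕ.< n → a ≢ e → Invariant H (transpose a e)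
    to-e-of {z} z<n z≢e inv {a} a<n a≢e with a ℕ.≟ z
    ... | yes refl = inv
    ... | no a≢z = invariant-chain H a<n z<n e<n a≢z z≢e a≢e (avoiding a<n z<n a≢e z≢e a≢z) inv

    to-e : ∀ {a} → a ℕ.< n → a ≢ e → Invariant {n} H (transpose a e)
    to-e = let z , z<n , z≢e , inv = moving-of (separate dL dR n≡ e<n v₀<n v₀≢e sv₀≢e) in to-e-of z<n z≢e inv

    all-transpositions : ∀ {a c} → a ℕ.< n → c ℕ.< n → a ≢ c → Invariant {n} H (transpose a c)
    all-transpositions {a} {c} a<n c<n a≢c with a ℕ.≟ e | c ℕ.≟ e
    ... | yes refl | yes refl = contradiction refl a≢c
    ... | yes refl | no c≢e = invariant-cong H (transpose-comm e c) (to-e c<n c≢e)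
    ... | no a≢e | yes refl = to-e a<n a≢e
    ... | no a≢e | no c≢e = avoiding a<n c<n a≢e c≢e a≢c

  pattern-invariant-constant : ∀ {σ τ} → IsPerm n σ → IsPerm n τ → H σ ≡ H τ
  pattern-invariant-constant = constant H all-transpositions

-- The walk on permutations

0≤square : ∀ p → 0ℚ ≤ p * p
0≤square p with ∣p∣≡p∨∣p∣≡-p p
... | inj₁ eq = subst (λ q → 0ℚ ≤ q * q) eq (0≤* (0≤∣p∣ p) (0≤∣p∣ p))
... | inj₂ eq = subst (0ℚ ≤_) (trans (cong (λ q → q * q) eq) (lemma p)) (0≤* (0≤∣p∣ p) (0≤∣p∣ p))
  where
  lemma : ∀ p → (- p) * (- p) ≡ p * p
  lemma = let open +-*-Solver in solve 1 (λ p → (:- p) :* (:- p) := p :* p) refl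

-- For a doubly stochastic matrix and a stationary μ the Dirichlet form Σ P(x,y) (μ(x) - μ(y))² vanishes.
module _ {A : Set} (xs : List A) (P : A → A → ℚ)
  (P-nonneg : ∀ x y → x ∈ xs → y ∈ xs → 0ℚ ≤ P x y)
  (rows : ∀ x → x ∈ xs → ∑ xs (P x) ≡ 1ℚ)
  (columns : ∀ y → y ∈ xs → ∑ xs (λ x → P x y) ≡ 1ℚ)
  (μ : A → ℚ) (μP : ∀ y → y ∈ xs → ∑ xs (λ x → μ x * P x y) ≡ μ y) where

  private
    energy : A → A → ℚ
    energy x y = P x y * ((μ x - μ y) * (μ x - μ y))

    energy-nonneg : ∀ x y → x ∈ xs → y ∈ xs → 0ℚ ≤ energy x y
    energy-nonneg x y x∈ y∈ = 0≤* (P-nonneg x y x∈ y∈) (0≤square (μ x - μ y))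

    norm = ∑ xs (λ x → μ x * μ x)

    expand : ∀ p a b → p * ((a - b) * (a - b)) ≡ (a * a * p + b * b * p) - (b * (a * p) + b * (a * p))
    expand = let open +-*-Solver in solve 3 (λ p a b →
      p :* ((a :- b) :* (a :- b)) := (a :* a :* p :+ b :* b :* p) :- (b :* (a :* p) :+ b :* (a :* p))) refl

    ∑∑ : (A → A → ℚ) → ℚ
    ∑∑ f = ∑ xs (λ x → ∑ xs (f x))

    ∑∑-rows : ∑∑ (λ x y → μ x * μ x * P x y) ≡ norm
    ∑∑-rows = ∑-cong xs (λ x x∈ → trans (∑-*ˡ xs (μ x * μ x) (P x))
      (trans (cong (μ x * μ x *_) (rows x x∈)) (*-identityʳ (μ x * μ x))))

    ∑∑-columns : ∑∑ (λ x y → μ y * μ y * P x y) ≡ norm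
    ∑∑-columns = trans (∑-swap xs xs (λ x y → μ y * μ y * P x y))
      (∑-cong xs (λ y y∈ → trans (∑-*ˡ xs (μ y * μ y) (λ x → P x y))
        (trans (cong (μ y * μ y *_) (columns y y∈)) (*-identityʳ (μ y * μ y)))))

    ∑∑-mixed : ∑∑ (λ x y → μ y * (μ x * P x y)) ≡ norm
    ∑∑-mixed = trans (∑-swap xs xs (λ x y → μ y * (μ x * P x y)))
      (∑-cong xs (λ y y∈ → trans (∑-*ˡ xs (μ y) (λ x → μ x * P x y)) (cong (μ y *_) (μP y y∈))))

    ∑∑-+ : ∀ f g → ∑∑ (λ x y → f x y + g x y) ≡ ∑∑ f + ∑∑ g
    ∑∑-+ f g = trans (∑-ext xs (λ x → ∑-+ xs (f x) (g x))) (∑-+ xs (λ x → ∑ xs (f x)) (λ x → ∑ xs (g x)))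

    ∑∑-- : ∀ f g → ∑∑ (λ x y → f x y - g x y) ≡ ∑∑ f - ∑∑ g
    ∑∑-- f g = trans (∑-ext xs (λ x → ∑-- xs (f x) (g x))) (∑-- xs (λ x → ∑ xs (f x)) (λ x → ∑ xs (g x)))

    ∑∑-energy : ∑∑ energy ≡ 0ℚ
    ∑∑-energy = begin
      ∑∑ energy
        ≡⟨ ∑-ext xs (λ x → ∑-ext xs (λ y → expand (P x y) (μ x) (μ y))) ⟩
      ∑∑ (λ x y → (μ x * μ x * P x y + μ y * μ y * P x y) - (μ y * (μ x * P x y) + μ y * (μ x * P x y)))
        ≡⟨ ∑∑-- (λ x y → μ x * μ x * P x y + μ y * μ y * P x y) (λ x y → μ y * (μ x * P x y) + μ y * (μ x * P x y)) ⟩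
      ∑∑ (λ x y → μ x * μ x * P x y + μ y * μ y * P x y) - ∑∑ (λ x y → μ y * (μ x * P x y) + μ y * (μ x * P x y))
        -- Unit row and column sums turn the two squares into Σ μ² each, and stationarity does the
        -- same for each copy of the cross term.
        ≡⟨ cong₂ _-_
             (trans (∑∑-+ (λ x y → μ x * μ x * P x y) (λ x y → μ y * μ y * P x y)) (cong₂ _+_ ∑∑-rows ∑∑-columns))
             (trans (∑∑-+ (λ x y → μ y * (μ x * P x y)) (λ x y → μ y * (μ x * P x y))) (cong₂ _+_ ∑∑-mixed ∑∑-mixed)) ⟩
      (norm + norm) - (norm + norm)
        ≡⟨ +-inverseʳ (norm + norm) ⟩
      0ℚ ∎
      where open ≡-Reasoning

  stationary-along : ∀ {x y} → x ∈ xs → y ∈ xs → P x y ≢ 0ℚ → μ x ≡ μ y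
  stationary-along {x} {y} x∈ y∈ P≢0 = p-q≡0⇒p≡q (μ x) (μ y) difference
    where
    product-zero : ∀ p q → p * q ≡ 0ℚ → p ≢ 0ℚ → q ≡ 0ℚ
    product-zero p q eq p≢0 = *-cancelʳ p p≢0 (trans (*-comm q p) (trans eq (sym (*-zeroˡ p))))
    term : energy x y ≡ 0ℚ
    term = ∑≡0⇒term≡0 (λ y y∈ → energy-nonneg x y x∈ y∈)
      (∑≡0⇒term≡0 (λ x x∈ → ∑-nonneg xs (λ y y∈ → energy-nonneg x y x∈ y∈)) ∑∑-energy x∈) y∈
    difference : μ x - μ y ≡ 0ℚ
    difference with (μ x - μ y) ≟ 0ℚ
    ... | yes eq = eq
    ... | no ne = product-zero (μ x - μ y) (μ x - μ y) (product-zero (P x y) ((μ x - μ y) * (μ x - μ y)) term P≢0) ne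

module _ (c : List ℕ → List ℕ → ℚ) (m : ℕ) (d₀ : Word) (d₀-length : length d₀ ≡ m) (d₀-mixed : Mixed d₀)
  (c-nonneg : ∀ α → α ∈ comps (suc m) → 0ℚ ≤ c α (single (suc m)))
  (c-d₀ : 0ℚ < c (comp d₀) (single (suc m))) where

  private
    n = suc m

    f : List ℕ → ℚ
    f σ = c (D σ) (single n)

    f-nonneg : ∀ σ → σ ∈ perms n → 0ℚ ≤ f σ
    f-nonneg σ σ∈ = c-nonneg (D σ) (subst (_∈ comps n) (sym (perms-D m σ∈))
      (subst (λ l → comp (pattern-of σ) ∈ comps (suc l)) (perms-pattern-length m σ∈) (comp∈comps (pattern-of σ))))

    f-d₀ : ∀ {σ} → σ ∈ perms n → pattern-of σ ≡ d₀ → 0ℚ < f σ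
    f-d₀ σ∈ eq = subst (λ α → 0ℚ < c α (single n)) (sym (trans (perms-D m σ∈) (cong comp eq))) c-d₀

    mass = ∑ (perms n) f

    0<mass : 0ℚ < mass
    -- Some permutation has pattern d₀, so the normalising sum is positive.
    0<mass with arrangement d₀ (upTo n) (Unique.upTo⁺ n) (trans (length-upTo n) (cong suc (sym d₀-length)))
    ... | σ , p , eq = <-≤-trans (f-d₀ σ∈ eq) (term≤∑ f-nonneg σ∈)
      where σ∈ = ↭-∈perms n p

    mass≢0 : mass ≢ 0ℚ
    mass≢0 eq = <-irrefl (sym eq) 0<mass

    Prob*mass : ∀ σ → Prob c n σ * mass ≡ f σ
    Prob*mass σ = ÷₀-cancel (f σ) mass mass≢0

    Prob-nonneg : ∀ σ → σ ∈ perms n → 0ℚ ≤ Prob c n σ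
    Prob-nonneg σ σ∈ = *-cancelʳ-≤-pos mass {{positive 0<mass}}
      (subst₂ _≤_ (sym (*-zeroˡ mass)) (sym (Prob*mass σ)) (f-nonneg σ σ∈))

    ∑-Prob : ∑ (perms n) (Prob c n) ≡ 1ℚ
    ∑-Prob = *-cancelʳ mass mass≢0 (trans (sym (∑-*ʳ (perms n) mass (Prob c n)))
      (trans (∑-ext (perms n) Prob*mass) (sym (*-identityˡ mass))))

    K-nonneg : ∀ π τ → π ∈ perms n → τ ∈ perms n → 0ℚ ≤ K c n π τ
    K-nonneg π τ π∈ τ∈ = Prob-nonneg (quotient π τ) (↭-∈perms n (quotient-perm (perms-↭ n π∈) (perms-↭ n τ∈)))

    K-rows : ∀ π → π ∈ perms n → ∑ (perms n) (K c n π) ≡ 1ℚ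
    K-rows π π∈ = trans (∑-quotientʳ (perms-↭ n π∈) (Prob c n)) ∑-Prob

    K-columns : ∀ τ → τ ∈ perms n → ∑ (perms n) (λ π → K c n π τ) ≡ 1ℚ
    K-columns τ τ∈ = trans (∑-quotientˡ (perms-↭ n τ∈) (Prob c n)) ∑-Prob

    ∑-constant : ∀ q → ∑ (perms n) (λ _ → q) ≡ q * ι (n !)
    ∑-constant q = trans (∑-ext (perms n) (λ _ → sym (*-identityʳ q)))
      (trans (∑-*ˡ (perms n) q (λ _ → 1ℚ)) (cong (q *_) (∑-perms-1 n)))

  uniform-stationary : IsStationary (perms n) (K c n) (uniform n)
  uniform-stationary = (λ _ _ → 0≤invFact n) ,
    trans (∑-constant (invFact n)) (trans (*-comm (invFact n) (ι (n !))) (n!*invFact n)) ,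
    (λ τ τ∈ → trans (∑-*ˡ (perms n) (invFact n) (λ π → K c n π τ))
      (trans (cong (invFact n *_) (K-columns τ τ∈)) (*-identityʳ (invFact n))))

  K-stationary-unique : ∀ μ → IsStationary (perms n) (K c n) μ → ∀ σ → σ ∈ perms n → μ σ ≡ uniform n σ
  K-stationary-unique μ (_ , ∑μ , μK) σ σ∈ = begin
    μ σ                                   ≡⟨ sym (*-identityʳ (μ σ)) ⟩
    μ σ * 1ℚ                              ≡⟨ cong (μ σ *_) (sym (n!*invFact n)) ⟩
    μ σ * (ι (n !) * invFact n)           ≡⟨ sym (*-assoc (μ σ) (ι (n !)) (invFact n)) ⟩
    μ σ * ι (n !) * invFact n             ≡⟨ cong (_* invFact n) (sym (∑-constant (μ σ))) ⟩
    ∑ (perms n) (λ _ → μ σ) * invFact n   ≡⟨ cong (_* invFact n) (∑-cong (perms n) (λ τ τ∈ → μ-constant (perms-↭ n σ∈) (perms-↭ n τ∈))) ⟩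
    ∑ (perms n) μ * invFact n             ≡⟨ cong (_* invFact n) ∑μ ⟩
    1ℚ * invFact n                        ≡⟨ *-identityˡ (invFact n) ⟩
    invFact n                             ∎
    where
    open ≡-Reasoning
    along : ∀ {ρ} → IsPerm n ρ → pattern-of ρ ≡ d₀ → Invariant μ (at ρ)
    -- The step from ρτ to τ has probability `Prob c n ρ`, which is nonzero because ρ has pattern
    -- d₀.
    along {ρ} p eq {τ} q = stationary-along (perms n) (K c n) K-nonneg K-rows K-columns μ μK
      (↭-∈perms n (compose-perm p q)) (↭-∈perms n q)
      λ K≡0 → <-irrefl (sym (trans (sym (Prob*mass ρ)) (trans
        (cong (_* mass) (trans (cong (Prob c n) (sym (quotient-compose p q))) K≡0)) (*-zeroˡ mass)))) (f-d₀ (↭-∈perms n p) eq)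
    μ-constant : ∀ {σ τ} → IsPerm n σ → IsPerm n τ → μ σ ≡ μ τ
    μ-constant = let b , dL , dR , split = mixed-split d₀-mixed in
      pattern-invariant-constant μ n b (subst (λ l → Extreme l b) (sym (n≡ b dL dR split)) (extreme (length dL ℕ.+ length dR) b)) dL dR (n≡ b dL dR split) (λ p eq → along p (trans eq (sym split)))
      where
      n≡ : ∀ b dL dR → d₀ ≡ dL ++ b ∷ not b ∷ dR → n ≡ 3 ℕ.+ (length dL ℕ.+ length dR)
      n≡ b dL dR split = cong suc (trans (sym d₀-length) (trans (cong length split) (trans (length-++ dL)
        (trans (ℕ.+-suc (length dL) (suc (length dR))) (cong suc (ℕ.+-suc (length dL) (length dR)))))))

mixed-of : ∀ {m α} → α ∈ comps (suc m) → α ≢ single (suc m) → α ≢ ones (suc m) →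
  Σ Word λ d → length d ≡ m × Mixed d × α ≡ comp d
mixed-of {m} α∈ ≢single ≢ones with comps-word {m} α∈
... | d , d-length , α≡ with constant-or-mixed d
...   | inj₂ mixed = d , d-length , mixed , α≡
...   | inj₁ (true , eq) = contradiction (trans α≡ (trans (cong comp eq) (trans (comp-ones (length d)) (cong (ones ∘ suc) d-length)))) ≢ones
...   | inj₁ (false , eq) = contradiction (trans α≡ (trans (cong comp eq) (trans (comp-single (length d)) (cong (single ∘ suc) d-length)))) ≢single

theorem3p10 : (n : ℕ) (φ : List ℕ → List ℕ → ℚ) (c : List ℕ → List ℕ → ℚ) →
    IsHopfEndo φ →
    IsFCoeffs φ c n →
    (∀ α → α ∈ comps n → 0ℚ ≤ c α (single n)) →
    Σ (List ℕ) (λ α → α ∈ comps n × c α (single n) ≢ 0ℚ) →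
    Σ (List ℕ) (λ α → α ∈ comps n × α ≢ single n × α ≢ ones n × 0ℚ < c α (single n)) →
    0ℚ < lam φ ^ℚ n →
    IsStochastic (comps n) (Kbar φ c n) →
    UniqueStationary (perms n) (K c n) (uniform n) ×
    UniqueStationary (comps n) (Kbar φ c n) (descentDist n)
-- The only composition of 0 is empty and equals `single 0`, so no composition as demanded exists.
theorem3p10 zero φ c Φ coeffs nonneg _ (_ , here refl , ≢single , _) = contradiction refl ≢single
theorem3p10 (suc m) φ c Φ coeffs nonneg _ (α , α∈ , ≢single , ≢ones , pos) 0<L _ =
  let d , d-length , mixed , α≡ = mixed-of α∈ ≢single ≢ones
      pos′ = subst (λ β → 0ℚ < c β (single (suc m))) α≡ pos
      stationary = descentDist-stationary Φ m coeffs 0<L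
  in (uniform-stationary c m d d-length mixed nonneg pos′ , K-stationary-unique c m d d-length mixed nonneg pos′) ,
     (stationary , λ μ μ-stationary →
       Kbar-stationary-unique Φ m coeffs 0<L nonneg d d-length mixed pos′ μ (descentDist (suc m)) μ-stationary stationary)
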